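{- There is an absolute constant $C>0$ such that the following holds. Let $\mathcal{F}_1,\dots,\mathcal{F}_t$ be set systems on an $n$-point ground set $V$, and let $\mathcal{F}=\mathcal{F}_1\cup\cdots\cup\mathcal{F}_t$. Then \[ \operatorname{herdisc}\mathcal{F}\le C\sqrt{\log|\mathcal{F}|}\,\Bigl(\sum_{i=1}^t(\log|\mathcal{F}_i|)^2(\operatorname{herdisc}\mathcal{F}_i)^2\Bigr)^{1/2}. \]
   Context: For a set system $\mathcal{F}$ on ground set $V$, $\operatorname{disc}\mathcal{F}=\min_{x\in\{ -1,1\}^V}\max_{F\in\mathcal{F}}\bigl|\sum_{v\in F}x_v\bigr|$, and $\operatorname{herdisc}\mathcal{F}=\max_{J\subseteq V}\operatorname{disc}(\mathcal{F}|_J)$, where $\mathcal{F}|_J=\{F\cap J:F\in\mathcal{F}\}$.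
   Formalization: log|F| and log|F_i| are read as log max(|F|,2) and log max(|F_i|,2), since the printed bound fails for one-set systems (t=1, F_1={V}: herdisc 1, right side 0) and log 0 is undefined; when all |F_i| ≥ 2 the bound is as printed. -}

module Defs where

open import Data.Bool using (true; false; if_then_else_)
import Data.Bool as Bool
open import Data.Fin using (Fin)
open import Data.Fin.Subset using (Subset; _∩_)
open import Data.Integer using (ℤ; +_; 0ℤ; ∣_∣; _◃_)
import Data.Integer as ℤ
import Data.Integer.Properties as ℤ
open import Data.List using (List; []; _∷_; map; concat; tabulate; length; deduplicate; cartesianProductWith)
open import Data.List.Extrema.Nat using (min; max)
open import Data.Nat using (ℕ; zero; suc; z≤n)
import Data.Nat as ℕ
import Data.Nat.Properties as ℕ
import Data.Nat.Coprimality as Coprime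
open import Data.Product using (∃-syntax; _×_; _,_)
open import Data.Rational using (ℚ; mkℚ; 0ℚ; 1ℚ; ↥_; ↧ₙ_; *≤*)
import Data.Rational as ℚ
import Data.Rational.Properties as ℚ
open import Data.Sign using (Sign)
import Data.Sign as Sign
open import Data.Vec using (Vec; []; _∷_; lookup; replicate)
import Data.Vec.Functional as Vector
open import Data.Vec.Properties using (≡-dec)
open import Relation.Binary.PropositionalEquality using (subst; sym)

------------------------------------------------------------------------
-- Discrepancy

-- A set system on the ground set Fin n is the set of members of the list:
-- order and repetitions are irrelevant to every notion below.
SetSystem : ℕ → Set
SetSystem n = List (Subset n)

card : ∀ {n} → SetSystem n → ℕ
card 𝓕 = length (deduplicate (≡-dec Bool._≟_) 𝓕)

⋃ : ∀ {n t} → (Fin t → SetSystem n) → SetSystem n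
⋃ 𝓕 = concat (tabulate 𝓕)

Colouring : ℕ → Set
Colouring n = Vec Sign n

allVecs : ∀ {A : Set} → List A → (n : ℕ) → List (Vec A n)
allVecs xs zero    = [] ∷ []
allVecs xs (suc n) = cartesianProductWith _∷_ xs (allVecs xs n)

subsets : (n : ℕ) → List (Subset n)
subsets = allVecs (true ∷ false ∷ [])

colourings : (n : ℕ) → List (Colouring n)
colourings = allVecs (Sign.+ ∷ Sign.- ∷ [])

-- Σ_{v ∈ F} x_v
colourSum : ∀ {n} → Colouring n → Subset n → ℤ
colourSum x F = Vector.foldr ℤ._+_ 0ℤ (λ v → if lookup F v then lookup x v ◃ 1 else 0ℤ)

-- max_{F ∈ 𝓕} |Σ_{v ∈ F} x_v|, which is 0 for the empty system.
discOf : ∀ {n} → SetSystem n → Colouring n → ℕ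
discOf 𝓕 x = max 0 (map (λ F → ∣ colourSum x F ∣) 𝓕)

-- The first argument of min is the value at the all-plus colouring, which is
-- itself one of the colourings, so this is the minimum over all colourings.
disc : ∀ {n} → SetSystem n → ℕ
disc {n} 𝓕 = min (discOf 𝓕 (replicate n Sign.+)) (map (discOf 𝓕) (colourings n))

-- 𝓕 |_J is kept on the ground set Fin n. The points outside J lie in none of
-- its sets, so their colours do not affect disc (𝓕 ∣ J).
infixl 6 _∣_
_∣_ : ∀ {n} → SetSystem n → Subset n → SetSystem n
𝓕 ∣ J = map (_∩ J) 𝓕

herdisc : ∀ {n} → SetSystem n → ℕ
herdisc {n} 𝓕 = max 0 (map (λ J → disc (𝓕 ∣ J)) (subsets n))

------------------------------------------------------------------------
-- Nonnegative real numbers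

-- A nonnegative real x is given by its open upper cut { q ∈ ℚ : x < q }.
record ℝ₀⁺ : Set₁ where
  field
    Above     : ℚ → Set
    positive  : ∀ {q} → Above q → 0ℚ ℚ.< q
    upward    : ∀ {q r} → Above q → q ℚ.≤ r → Above r
    open′     : ∀ {q} → Above q → ∃[ p ] (p ℚ.< q × Above p)
    inhabited : ∃[ q ] Above q

open ℝ₀⁺

infix 4 _≤_ _<_
_≤_ : ℝ₀⁺ → ℝ₀⁺ → Set
x ≤ y = ∀ q → Above y q → Above x q

-- Some rational q satisfies x < q and q ≤ y.
_<_ : ℝ₀⁺ → ℝ₀⁺ → Set
x < y = ∃[ q ] (Above x q × (∀ r → Above y r → q ℚ.≤ r))

-- inf { p ∈ ℚ : p > 0 and P p }
inf : (P : ℚ → Set) → ∃[ p ] (0ℚ ℚ.< p × P p) → ℝ₀⁺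
inf P (p₀ , 0<p₀ , Pp₀) = record
  { Above     = λ q → ∃[ p ] ((0ℚ ℚ.< p × P p) × p ℚ.< q)
  ; positive  = λ { (p , (0<p , _) , p<q) → ℚ.<-trans 0<p p<q }
  ; upward    = λ { (p , Pp , p<q) q≤r → p , Pp , ℚ.<-≤-trans p<q q≤r }
  ; open′     = λ { (p , Pp , p<q) → let (m , p<m , m<q) = ℚ.<-dense p<q in m , m<q , p , Pp , p<m }
  ; inhabited = let (r , p₀<r) = above p₀ in r , p₀ , (0<p₀ , Pp₀) , p₀<r
  }
  where
  above : ∀ p → ∃[ r ] p ℚ.< r
  above p = p ℚ.+ 1ℚ , subst (ℚ._< p ℚ.+ 1ℚ) (ℚ.+-identityʳ p) (ℚ.+-monoʳ-< p (ℚ.positive⁻¹ 1ℚ))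

ℕ→ℚ : ℕ → ℚ
ℕ→ℚ n = mkℚ (+ n) 0 (Coprime.sym (Coprime.1-coprimeTo n))

0<ℕ→ℚ-suc : ∀ n → 0ℚ ℚ.< ℕ→ℚ (suc n)
0<ℕ→ℚ-suc n = ℚ.positive⁻¹ (ℕ→ℚ (suc n))

ℕ→ℚ-mono-≤ : ∀ {m n} → m ℕ.≤ n → ℕ→ℚ m ℚ.≤ ℕ→ℚ n
ℕ→ℚ-mono-≤ m≤n = *≤* (ℤ.*-monoʳ-≤-nonNeg (+ 1) (ℤ.+≤+ m≤n))

0<* : ∀ {a b} → 0ℚ ℚ.< a → 0ℚ ℚ.< b → 0ℚ ℚ.< a ℚ.* b
0<* {a} {b} 0<a 0<b = subst (ℚ._< a ℚ.* b) (ℚ.*-zeroʳ a) (ℚ.*-monoʳ-<-pos a {{ℚ.positive 0<a}} 0<b)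

n≤2^1+n : ∀ n → n ℕ.≤ 2 ℕ.^ suc n
n≤2^1+n zero    = z≤n
n≤2^1+n (suc n) = ℕ.≤-trans (ℕ.+-mono-≤ (ℕ.m^n>0 2 (suc n)) (n≤2^1+n n))
                            (ℕ.+-monoʳ-≤ (2 ℕ.^ suc n) (ℕ.m≤m+n (2 ℕ.^ suc n) 0))

fromℕ : ℕ → ℝ₀⁺
fromℕ n = inf (ℕ→ℚ n ℚ.≤_) (ℕ→ℚ (suc n) , 0<ℕ→ℚ-suc n , ℕ→ℚ-mono-≤ (ℕ.n≤1+n n))

infixl 6 _+_
_+_ : ℝ₀⁺ → ℝ₀⁺ → ℝ₀⁺
x + y = inf (λ p → ∃[ a ] ∃[ b ] (Above x a × Above y b × a ℚ.+ b ℚ.≤ p))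
  (let (a , x<a) = inhabited x ; (b , y<b) = inhabited y in
   a ℚ.+ b , ℚ.+-mono-< (positive x x<a) (positive y y<b) , a , b , x<a , y<b , ℚ.≤-refl)

infixl 7 _*_
_*_ : ℝ₀⁺ → ℝ₀⁺ → ℝ₀⁺
x * y = inf (λ p → ∃[ a ] ∃[ b ] (Above x a × Above y b × a ℚ.* b ℚ.≤ p))
  (let (a , x<a) = inhabited x ; (b , y<b) = inhabited y in
   a ℚ.* b , 0<* (positive x x<a) (positive y y<b) , a , b , x<a , y<b , ℚ.≤-refl)

infix 8 _²
_² : ℝ₀⁺ → ℝ₀⁺
x ² = x * x

√ : ℝ₀⁺ → ℝ₀⁺
√ x = inf (λ p → Above x (p ℚ.* p))
  (let (a , x<a) = inhabited x in a ℚ.+ 1ℚ , 0<a+1 (positive x x<a) , upward x x<a (a≤[a+1]² (positive x x<a)))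
  where
  0<a+1 : ∀ {a} → 0ℚ ℚ.< a → 0ℚ ℚ.< a ℚ.+ 1ℚ
  0<a+1 0<a = ℚ.+-mono-< 0<a (ℚ.positive⁻¹ 1ℚ)

  a≤[a+1]² : ∀ {a} → 0ℚ ℚ.< a → a ℚ.≤ (a ℚ.+ 1ℚ) ℚ.* (a ℚ.+ 1ℚ)
  a≤[a+1]² {a} 0<a = ℚ.≤-trans a≤c (subst (ℚ._≤ c ℚ.* c) (ℚ.*-identityʳ c)
      (ℚ.*-monoˡ-≤-nonNeg c {{ℚ.nonNegative (ℚ.<⇒≤ (0<a+1 0<a))}} 1≤c))
    where
    c = a ℚ.+ 1ℚ
    a≤c : a ℚ.≤ c
    a≤c = subst (ℚ._≤ c) (ℚ.+-identityʳ a) (ℚ.+-monoʳ-≤ a (ℚ.<⇒≤ (ℚ.positive⁻¹ 1ℚ)))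
    1≤c : 1ℚ ℚ.≤ c
    1≤c = subst (ℚ._≤ c) (ℚ.+-identityˡ 1ℚ) (ℚ.+-monoˡ-≤ 1ℚ (ℚ.<⇒≤ 0<a))

-- The binary logarithm of m ≥ 1 is the infimum of the p = a/b > 0 with
-- m ≤ 2^(a/b), that is, m^b ≤ 2^a. (log 0 is a junk value.)
log : ℕ → ℝ₀⁺
log m = inf (λ p → m ℕ.^ ↧ₙ p ℕ.≤ 2 ℕ.^ ∣ ↥ p ∣)
  (ℕ→ℚ (suc m) , 0<ℕ→ℚ-suc m , subst (ℕ._≤ 2 ℕ.^ suc m) (sym (ℕ.*-identityʳ m)) (n≤2^1+n m))

∑ : ∀ {t} → (Fin t → ℝ₀⁺) → ℝ₀⁺
∑ = Vector.foldr _+_ (fromℕ 0)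

{-# OPTIONS --safe #-}
module Submission where

-- Write q ≈ log |𝓕|, lᵢ ≈ log |𝓕ᵢ|, hᵢ = herdisc 𝓕ᵢ and Λ = Σ lᵢ² hᵢ². The points of J carry values in
-- [-1, 1], initially 0, and are fixed at ±1 in phases, each of which halves the number N of
-- points still alive.
--
-- (1) For every k there are at most k sets of 𝓕ᵢ such that, restricted to the alive points, every
-- set of 𝓕ᵢ is a combination of them plus a residue b with |b|² ≤ 151 hᵢ² N / k. Otherwise a greedy
-- choice gives k rows whose Gram–Schmidt vectors are all longer; pivoting on coordinates of large
-- leverage then yields k columns and pivots with a large product. But linear discrepancy is
-- at most hereditary discrepancy, so every rational point is within hᵢ + 1, measured on these rows,
-- of an integer point, and counting classes of grid points modulo the lattice bounds that product.
--
-- (2) Given at most N / 8 vectors to which all moves must be orthogonal, a walk whose steps do not increase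
-- the potential Σ_F (a - 2 H |x|² + (F·x)²/τ_F)^q fixes half of the alive points while every
-- residue with |b|² ≤ τ_F moves F·x by O(√(q τ_F)).
--
-- (3) In a phase with N alive points, about N lᵢ² hᵢ² / (16 Λ) rows of 𝓕ᵢ are kept orthogonal. A set
-- of 𝓕ᵢ then costs O(√(q N)) if N ≤ Λ/lᵢ² (a geometric series over the phases), nothing if all of
-- 𝓕ᵢ is kept orthogonal, and O(√(q Λ) / lᵢ) in the remaining phases. There are only lᵢ + O(1) of
-- those, so the total is O(√(q Λ)).

-- Step (1) is a determinant bound in disguise: the product of the pivots is, up to sign, a k × k
-- minor of the incidence matrix of the alive points. Usually such a minor is bounded by comparing
-- volumes; here the pigeonhole principle on a finite grid does it, so that everything stays
-- rational and finite. Step (2) uses no randomness. A random walk would have Gaussian tails and a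
-- union bound over the sets; the sum of q-th powers with 2^q at least the number of sets does the
-- same, since a bound on the sum bounds each summand at the price of a factor 2 in its base. Each
-- step raises the squares (F·x)² to second order, and the term -2 H |x|² pays for that: moves are
-- orthogonal to x, so |x|² grows at every move. The obstacle to (3) is the number of phases, about
-- log n, which must not enter the bound. A system may therefore be charged only while N lies in a
-- window around Λ/lᵢ² whose logarithmic width is lᵢ + O(1). Above the window the share of
-- orthogonal rows given to the system pays for all of its sets; below it the costs form a geometric
-- series. Roots are avoided by comparing squares, and logarithms are integers until the very end.

module Combinatorial where
  open import Data.Bool using (Bool; true; false; if_then_else_; _∧_)
  import Data.Bool as Bool
  open import Data.Bool.Properties using (¬-not)
  open import Data.Empty using (⊥-elim)
  import Data.Fin as Fin
  open import Data.Fin using (Fin; zero; suc; toℕ; fromℕ<; combine; remQuot)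
  open import Data.Fin.Properties using (toℕ-fromℕ<; toℕ<n; toℕ-injective; toℕ-cast; combine-injective; combine-remQuot; injective⇒≤)
  open import Data.Fin.Subset using (Subset; ∣_∣; _∈_; _∉_; _⊆_; _∩_) renaming (_-_ to _∖_)
  open import Data.Fin.Subset.Properties using (x∈p⇒∣p-x∣<∣p∣; p─q⊆p; x∈p∧x≢y⇒x∈p-y; _∈?_; ∩-assoc)
  import Data.Integer as ℤ
  import Data.Integer.DivMod as ℤ
  import Data.Integer.Properties as ℤ
  open import Data.Integer using (ℤ; _◃_)
  open import Data.Integer.Tactic.RingSolver using () renaming (solve-∀ to solve-∀ℤ)
  import Data.List as List
  open import Data.List using (List; []; _∷_; length; map; _++_; deduplicate)
  open import Data.List.Extrema.Nat using (argmin-sel; min≤xs; xs≤max; max≤v⁺)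
  open import Data.List.Membership.Propositional using (find) renaming (_∈_ to _∈ₗ_)
  open import Data.List.Membership.Propositional.Properties using (∈-cartesianProductWith⁺; ∈-map⁺; ∈-map⁻; ∈-deduplicate⁺; ∈-deduplicate⁻; ∈-concat⁻′; ∈-tabulate⁻; ∈-lookup)
  open import Data.List.Properties using (length-map; length-++)
  open import Data.List.Relation.Unary.All as All using (All; []; _∷_)
  open import Data.List.Relation.Unary.All.Properties as All using (++⁻ˡ; ++⁻ʳ)
  open import Data.List.Relation.Unary.Any as Any using (Any; here; there)
  import Data.List.Relation.Unary.Any.Properties as Any
  import Data.Nat as ℕ
  import Data.Nat.Coprimality as Coprime
  import Data.Nat.DivMod as ℕ
  import Data.Nat.Properties as ℕ
  open import Data.Nat using (ℕ; zero; suc; _!)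
  open import Data.Product hiding (map)
  open import Data.Rational hiding (∣_∣; floor; round)
  open import Data.Rational.Properties
  import Data.Rational.Unnormalised as ℚᵘ
  import Data.Rational.Unnormalised.Properties as ℚᵘ
  open import Data.Sign using (Sign)
  import Data.Sign as Sign
  import Data.Sum as Sum
  open import Data.Sum using (_⊎_; inj₁; inj₂)
  open import Data.Unit using (⊤; tt)
  open import Data.Vec using (Vec; lookup; tabulate; replicate; []; _∷_)
  import Data.Vec.Functional as Vector
  open import Data.Vec.Properties using (≡-dec; []=⇒lookup; lookup⇒[]=; lookup-zipWith; lookup∘tabulate; tabulate∘lookup)
  open import Function using (_∘_; id)
  open import Relation.Binary.PropositionalEquality
  open import Relation.Nullary using (Dec; yes; no; ¬_; contradiction)
  open import Relation.Nullary.Decidable using (⌊_⌋; dec⇒maybe)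
  open import Tactic.RingSolver using (solve-∀)
  open import Tactic.RingSolver.Core.AlmostCommutativeRing using (AlmostCommutativeRing; fromCommutativeRing)
  import Defs
  open Defs using (SetSystem; Colouring; ⋃; card; allVecs; subsets; colourings; colourSum; discOf; disc; herdisc; ℕ→ℚ; ℕ→ℚ-mono-≤; 0<ℕ→ℚ-suc)

  -- Ordered field and vector preliminaries

  ℚ-ring : AlmostCommutativeRing _ _
  ℚ-ring = fromCommutativeRing +-*-commutativeRing (λ x → dec⇒maybe (0ℚ ≟ x))

  -- Numerals compute, so that the ring solver can evaluate coefficients; ι does not.
  infix 9 #_
  #_ : ℕ → ℚ
  # n = ℕ→ℚ n

  opaque
    ι : ℕ → ℚ
    ι = ℕ→ℚ

    ι≡# : ∀ n → ι n ≡ # n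
    ι≡# n = refl

    ι-+ : ∀ m n → ι (m ℕ.+ n) ≡ ι m + ι n
    ι-+ m n = toℚᵘ-injective (ℚᵘ.≃-trans (ℚᵘ.*≡* eq) (ℚᵘ.≃-sym (toℚᵘ-homo-+ (ι m) (ι n))))
      where
      eq : ℤ.+ (m ℕ.+ n) ℤ.* ℤ.+ 1 ≡ (ℤ.+ m ℤ.* ℤ.+ 1 ℤ.+ ℤ.+ n ℤ.* ℤ.+ 1) ℤ.* ℤ.+ 1
      eq = cong (ℤ._* ℤ.+ 1) (sym (cong₂ ℤ._+_ (ℤ.*-identityʳ (ℤ.+ m)) (ℤ.*-identityʳ (ℤ.+ n))))

    ι-* : ∀ m n → ι (m ℕ.* n) ≡ ι m * ι n
    ι-* m n = toℚᵘ-injective (ℚᵘ.≃-trans (ℚᵘ.*≡* (cong (ℤ._* ℤ.+ 1) (ℤ.pos-* m n))) (ℚᵘ.≃-sym (toℚᵘ-homo-* (ι m) (ι n))))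

    ι-mono-≤ : ∀ {m n} → m ℕ.≤ n → ι m ≤ ι n
    ι-mono-≤ = ℕ→ℚ-mono-≤

    ι-cancel-≤ : ∀ {m n} → ι m ≤ ι n → m ℕ.≤ n
    ι-cancel-≤ {m} {n} (*≤* p) = ℤ.drop‿+≤+ (ℤ.*-cancelʳ-≤-pos (ℤ.+ m) (ℤ.+ n) (ℤ.+ 1) p)

  ι-suc : ∀ n → ι (suc n) ≡ 1ℚ + ι n
  ι-suc n = trans (ι-+ 1 n) (cong (_+ ι n) (ι≡# 1))

  ι-#* : ∀ k n → ι (k ℕ.* n) ≡ # k * ι n
  ι-#* k n = trans (ι-* k n) (cong (_* ι n) (ι≡# k))

  #≤ι : ∀ {k n} → k ℕ.≤ n → # k ≤ ι n
  #≤ι {k} {n} p = subst (_≤ ι n) (ι≡# k) (ι-mono-≤ p)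

  ι-mono-< : ∀ {m n} → m ℕ.< n → ι m < ι n
  ι-mono-< m<n = ≰⇒> (λ le → ℕ.<⇒≱ m<n (ι-cancel-≤ le))

  0≤ι : ∀ n → 0ℚ ≤ ι n
  0≤ι n = #≤ι ℕ.z≤n

  0≤# : ∀ n → 0ℚ ≤ # n
  0≤# n = ℕ→ℚ-mono-≤ {0} {n} ℕ.z≤n

  0<# : ∀ n .{{_ : ℕ.NonZero n}} → 0ℚ < # n
  0<# (suc n) = 0<ℕ→ℚ-suc n

  0<ι : ∀ n .{{_ : ℕ.NonZero n}} → 0ℚ < ι n
  0<ι (suc n) = subst (_< ι (suc n)) (ι≡# 0) (ι-mono-< (ℕ.s≤s ℕ.z≤n))

  0≤+ : ∀ {a b} → 0ℚ ≤ a → 0ℚ ≤ b → 0ℚ ≤ a + b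
  0≤+ = +-mono-≤

  0≤* : ∀ {a b} → 0ℚ ≤ a → 0ℚ ≤ b → 0ℚ ≤ a * b
  0≤* {a} {b} p q = subst (_≤ a * b) (*-zeroʳ a) (*-monoˡ-≤-nonNeg a {{nonNegative p}} q)

  0<* : ∀ {a b} → 0ℚ < a → 0ℚ < b → 0ℚ < a * b
  0<* {a} {b} p q = subst (_< a * b) (*-zeroʳ a) (*-monoʳ-<-pos a {{positive p}} q)

  0≤² : ∀ a → 0ℚ ≤ a * a
  0≤² a with ≤-total 0ℚ a
  ... | inj₁ p = 0≤* p p
  ... | inj₂ p = subst (0ℚ ≤_) (eq a) (0≤* p' p')
    where
    p' = neg-antimono-≤ p
    eq : ∀ a → (- a) * (- a) ≡ a * a
    eq = solve-∀ ℚ-ring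

  0≤- : ∀ {a b} → a ≤ b → 0ℚ ≤ b - a
  0≤- {a} {b} p = subst (_≤ b - a) (+-inverseʳ a) (+-monoˡ-≤ (- a) p)

  -- Most inequalities below are proved by exhibiting the slack c.
  slack-≤ : ∀ {a b} c → 0ℚ ≤ c → b ≡ a + c → a ≤ b
  slack-≤ {a} c p refl = subst (_≤ a + c) (+-identityʳ a) (+-monoʳ-≤ a p)

  slack-< : ∀ {a b} c → 0ℚ < c → b ≡ a + c → a < b
  slack-< {a} c p refl = subst (_< a + c) (+-identityʳ a) (+-monoʳ-< a p)

  0<- : ∀ {a b} → a < b → 0ℚ < b - a
  0<- {a} {b} p = subst (_< b - a) (+-inverseʳ a) (+-monoˡ-< (- a) p)

  *-monoˡ-≤ : ∀ {a b c} → 0ℚ ≤ c → a ≤ b → c * a ≤ c * b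
  *-monoˡ-≤ {c = c} p = *-monoˡ-≤-nonNeg c {{nonNegative p}}

  *-monoʳ-≤ : ∀ {a b c} → 0ℚ ≤ c → a ≤ b → a * c ≤ b * c
  *-monoʳ-≤ {c = c} p = *-monoʳ-≤-nonNeg c {{nonNegative p}}

  *-mono-≤ : ∀ {a b c d} → 0ℚ ≤ a → 0ℚ ≤ d → a ≤ b → c ≤ d → a * c ≤ b * d
  *-mono-≤ pa pd p q = ≤-trans (*-monoˡ-≤ pa q) (*-monoʳ-≤ pd p)

  *-cancelˡ-≤ : ∀ {a b c} → 0ℚ < c → c * a ≤ c * b → a ≤ b
  *-cancelˡ-≤ {c = c} p = *-cancelˡ-≤-pos c {{positive p}}

  ²-cancel-≤ : ∀ {a b} → 0ℚ ≤ b → a * a ≤ b * b → a ≤ b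
  ²-cancel-≤ {a} {b} 0≤b le with a ≤? b
  ... | yes p = p
  ... | no  p = ⊥-elim (<⇒≱ (≤-<-trans (*-monoˡ-≤ 0≤b (<⇒≤ b<a)) (*-monoˡ-<-pos a {{positive (≤-<-trans 0≤b b<a)}} b<a)) le)
    where
    b<a = ≰⇒> p
    <⇒≱ : ∀ {p q} → p < q → ¬ q ≤ p
    <⇒≱ p<q q≤p = <-irrefl refl (<-≤-trans p<q q≤p)

  opaque
    -- inv 0 = 0
    inv : ℚ → ℚ
    inv p with p ≟ 0ℚ
    ... | yes _  = 0ℚ
    ... | no p≢0 = (1/ p) {{≢-nonZero p≢0}}

    *-inv : ∀ {p} → p ≢ 0ℚ → p * inv p ≡ 1ℚ
    *-inv {p} p≢0 with p ≟ 0ℚ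
    ... | yes p≡0 = contradiction p≡0 p≢0
    ... | no  p≢0 = *-inverseʳ p {{≢-nonZero p≢0}}

  0≤inv : ∀ {p} → 0ℚ < p → 0ℚ ≤ inv p
  0≤inv {p} 0<p = ≮⇒≥ λ lt → <-irrefl refl (<-trans (positive⁻¹ 1ℚ)
    (subst₂ _<_ (*-inv (λ e → <-irrefl (sym e) 0<p)) (*-zeroʳ p) (*-monoʳ-<-pos p {{positive 0<p}} lt)))

  sum : ∀ {n} → (Fin n → ℚ) → ℚ
  sum {zero}  f = 0ℚ
  sum {suc n} f = f zero + sum (f ∘ suc)

  sum-cong : ∀ {n} {f g : Fin n → ℚ} → (∀ i → f i ≡ g i) → sum f ≡ sum g
  sum-cong {zero}  p = refl
  sum-cong {suc n} p = cong₂ _+_ (p zero) (sum-cong (p ∘ suc))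

  sum-+ : ∀ {n} (f g : Fin n → ℚ) → sum (λ i → f i + g i) ≡ sum f + sum g
  sum-+ {zero}  f g = refl
  sum-+ {suc n} f g = trans (cong (f zero + g zero +_) (sum-+ (f ∘ suc) (g ∘ suc))) (eq (f zero) (g zero) _ _)
    where
    eq : ∀ a b c d → a + b + (c + d) ≡ a + c + (b + d)
    eq = solve-∀ ℚ-ring

  sum-* : ∀ {n} c (f : Fin n → ℚ) → sum (λ i → c * f i) ≡ c * sum f
  sum-* {zero}  c f = sym (*-zeroʳ c)
  sum-* {suc n} c f = trans (cong (c * f zero +_) (sum-* c (f ∘ suc))) (sym (*-distribˡ-+ c (f zero) (sum (f ∘ suc))))

  sum-zero : ∀ {n} {f : Fin n → ℚ} → (∀ i → f i ≡ 0ℚ) → sum f ≡ 0ℚ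
  sum-zero {zero}  p = refl
  sum-zero {suc n} p = trans (cong₂ _+_ (p zero) (sum-zero (p ∘ suc))) (+-identityˡ 0ℚ)

  sum-swap : ∀ {m n} (f : Fin m → Fin n → ℚ) → sum (λ i → sum (f i)) ≡ sum (λ j → sum (λ i → f i j))
  sum-swap {zero}  {n} f = sym (sum-zero {n} (λ _ → refl))
  sum-swap {suc m} f = trans (cong (sum (f zero) +_) (sum-swap (f ∘ suc))) (sym (sum-+ (f zero) (λ j → sum (λ i → f (suc i) j))))

  sum-mono-≤ : ∀ {n} {f g : Fin n → ℚ} → (∀ i → f i ≤ g i) → sum f ≤ sum g
  sum-mono-≤ {zero}  p = ≤-refl
  sum-mono-≤ {suc n} p = +-mono-≤ (p zero) (sum-mono-≤ (p ∘ suc))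

  0≤sum : ∀ {n} {f : Fin n → ℚ} → (∀ i → 0ℚ ≤ f i) → 0ℚ ≤ sum f
  0≤sum {zero}  p = ≤-refl
  0≤sum {suc n} p = 0≤+ (p zero) (0≤sum (p ∘ suc))

  term≤sum : ∀ {n} {f : Fin n → ℚ} → (∀ i → 0ℚ ≤ f i) → ∀ i → f i ≤ sum f
  term≤sum {suc n} {f} p zero    = slack-≤ _ (0≤sum (p ∘ suc)) refl
  term≤sum {suc n} {f} p (suc i) = ≤-trans (term≤sum (p ∘ suc) i) (slack-≤ _ (p zero) (+-comm (f zero) _))

  sum<0⇒term<0 : ∀ {n} (f : Fin n → ℚ) → sum f < 0ℚ → ∃ λ i → f i < 0ℚ
  sum<0⇒term<0 {zero}  f lt = ⊥-elim (<-irrefl refl lt)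
  sum<0⇒term<0 {suc n} f lt with f zero <? 0ℚ
  ... | yes p = zero , p
  ... | no  p = let i , q = sum<0⇒term<0 (f ∘ suc) (≤-<-trans (slack-≤ _ (≮⇒≥ p) (+-comm (f zero) _)) lt) in suc i , q

  sum-const : ∀ n c → sum {n} (λ _ → c) ≡ ι n * c
  sum-const zero    c = sym (trans (cong (_* c) (ι≡# 0)) (*-zeroˡ c))
  sum-const (suc n) c = trans (cong (c +_) (sum-const n c)) (trans (eq c (ι n)) (cong (_* c) (sym (ι-suc n))))
    where
    eq : ∀ c k → c + k * c ≡ (1ℚ + k) * c
    eq = solve-∀ ℚ-ring

  V : ℕ → Set
  V n = Fin n → ℚ

  infix 8 _·_
  opaque
    _·_ : ∀ {n} → V n → V n → ℚ
    x · y = sum (λ i → x i * y i)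

    ·-def : ∀ {n} (x y : V n) → x · y ≡ sum (λ i → x i * y i)
    ·-def x y = refl

  opaque
    unfolding _·_

    ·-cong : ∀ {n} {x x' y y' : V n} → (∀ i → x i ≡ x' i) → (∀ i → y i ≡ y' i) → x · y ≡ x' · y'
    ·-cong p q = sum-cong (λ i → cong₂ _*_ (p i) (q i))

    ·-comm : ∀ {n} (x y : V n) → x · y ≡ y · x
    ·-comm x y = sum-cong (λ i → *-comm (x i) (y i))

  infixl 6 _⊕_⋆_
  _⊕_⋆_ : ∀ {n} → V n → ℚ → V n → V n
  (x ⊕ c ⋆ y) i = x i + c * y i

  opaque
    unfolding _·_

    ·-linˡ : ∀ {n} (x : V n) c y z → (x ⊕ c ⋆ y) · z ≡ x · z + c * y · z
    ·-linˡ x c y z = begin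
      sum (λ i → (x i + c * y i) * z i)         ≡⟨ sum-cong (λ i → eq (x i) c (y i) (z i)) ⟩
      sum (λ i → x i * z i + c * (y i * z i))   ≡⟨ sum-+ (λ i → x i * z i) (λ i → c * (y i * z i)) ⟩
      x · z + sum (λ i → c * (y i * z i))       ≡⟨ cong (x · z +_) (sum-* c (λ i → y i * z i)) ⟩
      x · z + c * y · z                         ∎
      where
      open ≡-Reasoning
      eq : ∀ x c y z → (x + c * y) * z ≡ x * z + c * (y * z)
      eq = solve-∀ ℚ-ring

  ·-linʳ : ∀ {n} (z : V n) x c y → z · (x ⊕ c ⋆ y) ≡ z · x + c * z · y
  ·-linʳ z x c y = trans (·-comm z _) (trans (·-linˡ x c y z) (cong₂ (λ a b → a + c * b) (·-comm x z) (·-comm y z)))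

  opaque
    unfolding _·_

    0≤·self : ∀ {n} (x : V n) → 0ℚ ≤ x · x
    0≤·self x = 0≤sum (λ i → 0≤² (x i))

    ·self≡0⇒·≡0 : ∀ {n} (x y : V n) → x · x ≡ 0ℚ → x · y ≡ 0ℚ
    ·self≡0⇒·≡0 {n} x y x²≡0 = sum-zero (λ i → trans (cong (_* y i) (x≡0 i)) (*-zeroˡ (y i)))
      where
      x≡0 : ∀ i → x i ≡ 0ℚ
      x≡0 i with x i ≟ 0ℚ
      ... | yes p = p
      ... | no  p = ⊥-elim (1≢0 (begin
        1ℚ                                        ≡⟨ cong₂ _*_ (*-inv p) (*-inv p) ⟨
        (x i * inv (x i)) * (x i * inv (x i))     ≡⟨ eq (x i) (inv (x i)) ⟩
        (x i * x i) * (inv (x i) * inv (x i))     ≡⟨ cong (_* (inv (x i) * inv (x i))) xx≡0 ⟩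
        0ℚ * (inv (x i) * inv (x i))              ≡⟨ *-zeroˡ (inv (x i) * inv (x i)) ⟩
        0ℚ                                        ∎))
        where
        open ≡-Reasoning
        eq : ∀ a b → (a * b) * (a * b) ≡ (a * a) * (b * b)
        eq = solve-∀ ℚ-ring
        xx≡0 : x i * x i ≡ 0ℚ
        xx≡0 = ≤-antisym (≤-trans (term≤sum (λ i → 0≤² (x i)) i) (≤-reflexive x²≡0)) (0≤² (x i))

  -- 0 ≤ |(y·y) x − (x·y) y|² = (y·y) ((x·x)(y·y) − (x·y)²)
  cauchy-schwarz : ∀ {n} (x y : V n) → (x · y) * (x · y) ≤ (x · x) * (y · y)
  cauchy-schwarz x y with y · y ≟ 0ℚ
  ... | yes y²≡0 = ≤-reflexive (trans (cong (λ t → t * t) (trans (·-comm x y) (·self≡0⇒·≡0 y x y²≡0)))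
                     (trans (*-zeroˡ 0ℚ) (sym (trans (cong (x · x *_) y²≡0) (*-zeroʳ (x · x))))))
  ... | no y²≢0 = *-cancelˡ-≤ 0<y² (slack-≤ (y · y * (y · y * z · z)) (0≤* (0≤·self y) (0≤* (0≤·self y) (0≤·self z)))
      (sym (begin
        d * (b * b) + d * (d * z · z)                       ≡⟨ cong (λ t → d * (b * b) + d * (d * t)) z·z ⟩
        d * (b * b) + d * (d * (a + c * b + c * (b + c * d))) ≡⟨ eq a b d (inv d) ⟩
        d * (b * b) + d * (d * a - b * b * (d * inv d) - b * b * (d * inv d) + b * b * ((d * inv d) * (d * inv d)))
          ≡⟨ cong (λ t → d * (b * b) + d * (d * a - b * b * t - b * b * t + b * b * (t * t))) (*-inv y²≢0) ⟩
        d * (b * b) + d * (d * a - b * b * 1ℚ - b * b * 1ℚ + b * b * (1ℚ * 1ℚ)) ≡⟨ eq₂ a b d ⟩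
        d * (a * d) ∎)))
    where
    open ≡-Reasoning
    a = x · x
    b = x · y
    d = y · y
    c = - (b * inv d)
    z = x ⊕ c ⋆ y
    0<y² : 0ℚ < y · y
    0<y² = ≰⇒> (λ le → y²≢0 (≤-antisym le (0≤·self y)))
    z·z : z · z ≡ a + c * b + c * (b + c * d)
    z·z = trans (·-linˡ x c y z) (cong₂ (λ a b → a + c * b) (·-linʳ x x c y) (trans (·-linʳ y x c y) (cong (_+ c * d) (·-comm y x))))
    eq : ∀ a b d i → d * (b * b) + d * (d * (a + (- (b * i)) * b + (- (b * i)) * (b + (- (b * i)) * d)))
         ≡ d * (b * b) + d * (d * a - b * b * (d * i) - b * b * (d * i) + b * b * ((d * i) * (d * i)))
    eq = solve-∀ ℚ-ring
    eq₂ : ∀ a b d → d * (b * b) + d * (d * a - b * b * 1ℚ - b * b * 1ℚ + b * b * (1ℚ * 1ℚ)) ≡ d * (a * d)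
    eq₂ = solve-∀ ℚ-ring

  e : ∀ {n} → Fin n → V n
  e zero    zero    = 1ℚ
  e zero    (suc i) = 0ℚ
  e (suc v) zero    = 0ℚ
  e (suc v) (suc i) = e v i

  opaque
    unfolding _·_

    ·-e : ∀ {n} (x : V n) v → x · e v ≡ x v
    ·-e {suc n} x zero    = trans (cong₂ _+_ (*-identityʳ (x zero))
      (sum-zero (λ i → *-zeroʳ (x (suc i))))) (+-identityʳ (x zero))
    ·-e {suc n} x (suc v) = trans (cong₂ _+_ (*-zeroʳ (x zero)) (·-e (x ∘ suc) v)) (+-identityˡ _)

  -- Orthogonal families

  Perp : ∀ {n} → V n → List (V n) → Set
  Perp y = All (λ b → y · b ≡ 0ℚ)

  infixr 5 _∷_
  data Orth {n} : List (V n) → Set where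
    []  : Orth []
    _∷_ : ∀ {b bs} → Perp b bs × b · b ≢ 0ℚ → Orth bs → Orth (b ∷ bs)

  -- The component of f orthogonal to the list, provided that the list is orthogonal: only then may
  -- the coefficient of b be read off f itself instead of off the remainder left by `bs`.
  res : ∀ {n} → V n → List (V n) → V n
  res f []       = f
  res f (b ∷ bs) = res f bs ⊕ - (inv (b · b) * f · b) ⋆ b

  a+c0≡a : ∀ a c {z} → z ≡ 0ℚ → a + c * z ≡ a
  a+c0≡a a c refl = trans (cong (a +_) (*-zeroʳ c)) (+-identityʳ a)

  Perp-⊕ : ∀ {n} {x y : V n} {bs} c → Perp x bs → Perp y bs → Perp (x ⊕ c ⋆ y) bs
  Perp-⊕ c [] [] = []
  Perp-⊕ {x = x} {y} {b ∷ bs} c (p ∷ ps) (q ∷ qs) = trans (·-linˡ x c y b) (trans (a+c0≡a _ c q) p) ∷ Perp-⊕ c ps qs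

  -- Only multiples of members of the list are subtracted, so orthogonality within the list is not
  -- at issue.
  res-· : ∀ {n} (f : V n) {bs y} → Perp y bs → res f bs · y ≡ f · y
  res-· f {[]}     _        = refl
  res-· f {b ∷ bs} {y} (p ∷ ps) = trans (·-linˡ (res f bs) (- (inv (b · b) * f · b)) b y) (trans (a+c0≡a _ (- (inv (b · b) * f · b)) (trans (·-comm b y) p)) (res-· f ps))

  res-perp : ∀ {n} (f : V n) {bs} → Orth bs → Perp (res f bs) bs
  res-perp f [] = []
  res-perp f {b ∷ bs} ((p , b≢0) ∷ o) = head ∷ Perp-⊕ c (res-perp f o) p
    where
    c = - (inv (b · b) * f · b)
    eq : ∀ d i s → s + (- (i * s)) * d ≡ s + - s * (d * i)
    eq = solve-∀ ℚ-ring
    eq₂ : ∀ s → s + - s * 1ℚ ≡ 0ℚ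
    eq₂ = solve-∀ ℚ-ring
    head : (res f bs ⊕ c ⋆ b) · b ≡ 0ℚ
    head = begin
      (res f bs ⊕ c ⋆ b) · b                          ≡⟨ ·-linˡ (res f bs) c b b ⟩
      res f bs · b + c * b · b                        ≡⟨ cong (_+ c * b · b) (res-· f p) ⟩
      f · b + c * b · b                               ≡⟨ eq (b · b) (inv (b · b)) (f · b) ⟩
      f · b + - (f · b) * (b · b * inv (b · b))       ≡⟨ cong (λ t → f · b + - (f · b) * t) (*-inv b≢0) ⟩
      f · b + - (f · b) * 1ℚ                          ≡⟨ eq₂ (f · b) ⟩
      0ℚ                                              ∎
      where open ≡-Reasoning

  res-self : ∀ {n} (f : V n) {bs} → Orth bs → res f bs · res f bs ≡ f · res f bs
  res-self f o = res-· f (res-perp f o)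

  -- Orthogonal projections are self-adjoint: both sides equal the product of the two residues.
  res-sym : ∀ {n} (f g : V n) {bs} → Orth bs → f · res g bs ≡ g · res f bs
  res-sym f g {bs} o = trans (sym (res-· f (res-perp g o))) (trans (·-comm (res f bs) (res g bs)) (res-· g (res-perp f o)))

  -- Pythagoras: the slack is the squared length of `f` minus its residue.
  res-norm : ∀ {n} (f : V n) {bs} → Orth bs → res f bs · res f bs ≤ f · f
  res-norm f {bs} o = slack-≤ (d · d) (0≤·self d) (sym (trans (cong (r · r +_) d·d) (eq (f · f) (r · r))))
    where
    r = res f bs
    d = f ⊕ - 1ℚ ⋆ r
    eq : ∀ a b → b + (a + - 1ℚ * b + - 1ℚ * (b + - 1ℚ * b)) ≡ a
    eq = solve-∀ ℚ-ring
    d·d : d · d ≡ f · f + - 1ℚ * r · r + - 1ℚ * (r · r + - 1ℚ * r · r)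
    d·d = trans (·-linˡ f (- 1ℚ) r d) (cong₂ (λ a b → a + - 1ℚ * b)
      (trans (·-linʳ f f (- 1ℚ) r) (cong (λ t → f · f + - 1ℚ * t) (sym (res-self f o))))
      (trans (·-linʳ r f (- 1ℚ) r) (cong (_+ - 1ℚ * r · r) (trans (·-comm r f) (sym (res-self f o))))))

  -- For an indicator χ this says that f vanishes wherever χ does. As an equation it passes to
  -- linear combinations without case distinctions.
  record Supp {n} (χ f : V n) : Set where
    constructor supp
    field at : ∀ v → χ v * f v ≡ f v
  open Supp

  Supp-⊕ : ∀ {n} {χ f g : V n} c → Supp χ f → Supp χ g → Supp χ (f ⊕ c ⋆ g)
  Supp-⊕ {χ = χ} {f} {g} c p q = supp λ v → trans (eq (χ v) (f v) c (g v)) (cong₂ (λ a b → a + c * b) (at p v) (at q v))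
    where
    eq : ∀ x f c g → x * (f + c * g) ≡ x * f + c * (x * g)
    eq = solve-∀ ℚ-ring

  Supp-res : ∀ {n} {χ f : V n} {bs} → Supp χ f → All (Supp χ) bs → Supp χ (res f bs)
  Supp-res p []       = p
  Supp-res {f = f} {b ∷ _} p (q ∷ qs) = Supp-⊕ (- (inv (b · b) * f · b)) (Supp-res p qs) q

  record Orthogonalised {n} (cs : List (V n)) : Set where
    field
      basis      : List (V n)
      orth       : Orth basis
      size       : length basis ℕ.≤ length cs
      perp       : ∀ {y} → Perp y basis → Perp y cs
      supported  : ∀ {χ} → All (Supp χ) cs → All (Supp χ) basis

  gram-schmidt : ∀ {n} (cs : List (V n)) → Orthogonalised cs
  gram-schmidt [] = record { basis = [] ; orth = [] ; size = ℕ.z≤n ; perp = λ _ → [] ; supported = λ _ → [] }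
  gram-schmidt (c ∷ cs) with gram-schmidt cs
  ... | record { basis = bs ; orth = o ; size = s ; perp = p ; supported = u } with res c bs · res c bs ≟ 0ℚ
  -- Here c lies in the span of the basis found so far, so orthogonality to c comes for free and c
  -- is dropped.
  ... | yes r≡0 = record
    { basis = bs ; orth = o ; size = ℕ.m≤n⇒m≤1+n s
    ; perp = λ {y} ⊥bs → trans (·-comm y c) (trans (sym (res-· c ⊥bs)) (·self≡0⇒·≡0 (res c bs) y r≡0)) ∷ p ⊥bs
    ; supported = λ { (_ ∷ ss) → u ss } }
  ... | no r≢0 = record
    { basis = res c bs ∷ bs ; orth = (res-perp c o , r≢0) ∷ o ; size = ℕ.s≤s s
    ; perp = λ { {y} (⊥r ∷ ⊥bs) → trans (·-comm y c) (trans (sym (res-· c ⊥bs)) (trans (·-comm (res c bs) y) ⊥r)) ∷ p ⊥bs }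
    ; supported = λ { (s ∷ ss) → Supp-res s (u ss) ∷ u ss } }

  e-self : ∀ {n} (v : Fin n) → e v v ≡ 1ℚ
  e-self zero    = refl
  e-self (suc v) = e-self v

  -- The diagonal of the projection onto the orthogonal complement, summed over χ. Each basis vector
  -- b removes exactly 1, as its own projection has diagonal entries b_v² / |b|² and all of them lie
  -- in χ.
  trace : ∀ {n} (χ : V n) {bs} → Orth bs → All (Supp χ) bs →
          sum (λ v → χ v * res (e v) bs v) ≡ sum χ - ι (length bs)
  trace χ [] [] = trans (sum-cong (λ v → trans (cong (χ v *_) (e-self v)) (*-identityʳ (χ v)))) (sym (trans (cong (λ t → sum χ - t) (ι≡# 0)) (+-identityʳ (sum χ))))
  trace χ {b ∷ bs} ((_ , b≢0) ∷ o) (s ∷ ss) = begin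
    sum (λ v → χ v * (res (e v) bs v + - (i * e v · b) * b v))
      ≡⟨ sum-cong (λ v → trans (cong (λ t → χ v * (res (e v) bs v + - (i * t) * b v)) (trans (·-comm (e v) b) (·-e b v)))
          (trans (eq (χ v) (res (e v) bs v) i (b v)) (cong (λ t → χ v * res (e v) bs v + - i * (b v * t)) (at s v)))) ⟩
    sum (λ v → χ v * res (e v) bs v + - i * (b v * b v))
      ≡⟨ sum-+ (λ v → χ v * res (e v) bs v) (λ v → - i * (b v * b v)) ⟩
    sum (λ v → χ v * res (e v) bs v) + sum (λ v → - i * (b v * b v))
      ≡⟨ cong₂ _+_ (trace χ o ss) (sum-* (- i) (λ v → b v * b v)) ⟩
    sum χ - ι (length bs) + - i * sum (λ v → b v * b v)
      ≡⟨ cong (λ t → sum χ - ι (length bs) + - i * t) (·-def b b) ⟨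
    sum χ - ι (length bs) + - i * b · b
      ≡⟨ cong (sum χ - ι (length bs) +_) (trans (eq₃ i (b · b)) (cong -_ (*-inv b≢0))) ⟩
    sum χ - ι (length bs) + - 1ℚ
      ≡⟨ trans (eq₂ (sum χ) (ι (length bs))) (cong (λ t → sum χ - t) (sym (ι-suc (length bs)))) ⟩
    sum χ - ι (suc (length bs)) ∎
    where
    open ≡-Reasoning
    i = inv (b · b)
    eq : ∀ x r i b → x * (r + - (i * b) * b) ≡ x * r + - i * (b * (x * b))
    eq = solve-∀ ℚ-ring
    eq₂ : ∀ a b → a - b + - 1ℚ ≡ a - (1ℚ + b)
    eq₂ = solve-∀ ℚ-ring
    eq₃ : ∀ i d → - i * d ≡ - (d * i)
    eq₃ = solve-∀ ℚ-ring

  -- The potential function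

  infixr 8 _^_
  _^_ : ℚ → ℕ → ℚ
  x ^ zero  = 1ℚ
  x ^ suc n = x * x ^ n

  0≤^ : ∀ {x} n → 0ℚ ≤ x → 0ℚ ≤ x ^ n
  0≤^ zero    p = <⇒≤ (positive⁻¹ 1ℚ)
  0≤^ (suc n) p = 0≤* p (0≤^ n p)

  0<^ : ∀ {x} n → 0ℚ < x → 0ℚ < x ^ n
  0<^ zero    p = positive⁻¹ 1ℚ
  0<^ (suc n) p = 0<* p (0<^ n p)

  ^-mono-≤ : ∀ {x y} n → 0ℚ ≤ x → x ≤ y → x ^ n ≤ y ^ n
  ^-mono-≤ zero    p q = ≤-refl
  ^-mono-≤ (suc n) p q = *-mono-≤ p (0≤^ n (≤-trans p q)) q (^-mono-≤ n p q)

  ^-mono-< : ∀ {x y} n → 0ℚ ≤ x → x < y → x ^ suc n < y ^ suc n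
  ^-mono-< {x} {y} n p q = ≤-<-trans (*-monoˡ-≤ p (^-mono-≤ n p (<⇒≤ q)))
    (*-monoˡ-<-pos (y ^ n) {{positive (0<^ n (≤-<-trans p q))}} q)

  ^-cancel-≤ : ∀ {x y} n → 0ℚ ≤ y → x ^ suc n ≤ y ^ suc n → x ≤ y
  ^-cancel-≤ {x} {y} n p le = ≮⇒≥ (λ lt → <-irrefl refl (<-≤-trans (^-mono-< n p lt) le))

  ^-distrib-* : ∀ x y n → (x * y) ^ n ≡ x ^ n * y ^ n
  ^-distrib-* x y zero    = refl
  ^-distrib-* x y (suc n) = trans (cong (x * y *_) (^-distrib-* x y n)) (eq x y (x ^ n) (y ^ n))
    where
    eq : ∀ x y a b → x * y * (a * b) ≡ x * a * (y * b)
    eq = solve-∀ ℚ-ring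

  ι-^ : ∀ m n → ι (m ℕ.^ n) ≡ ι m ^ n
  ι-^ m zero    = ι≡# 1
  ι-^ m (suc n) = trans (ι-* m (m ℕ.^ n)) (cong (ι m *_) (ι-^ m n))

  -- Passes the step-size hypothesis of `^-taylor` to the smaller exponent. For negative e lowering
  -- k raises the product, but it stays at most 0.
  ι-pred-* : ∀ k {e D} → 0ℚ ≤ D → ι (suc k) * e ≤ D → ι k * e ≤ D
  ι-pred-* k {e} {D} 0≤D le with ≤-total e 0ℚ
  ... | inj₁ e≤0 = ≤-trans (subst (ι k * e ≤_) (*-zeroʳ (ι k)) (*-monoˡ-≤ (0≤ι k) e≤0)) 0≤D
  ... | inj₂ 0≤e = ≤-trans (*-monoʳ-≤ 0≤e (ι-mono-≤ (ℕ.n≤1+n k))) le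

  -- A second-order Bernoulli upper bound, homogenised to avoid dividing by D.
  ^-taylor : ∀ k {D e} → 0ℚ ≤ D → 0ℚ ≤ D + e → ι k * e ≤ D →
             D * D * (D + e) ^ k ≤ D ^ k * (D * D + ι k * (D * e) + ι k * ι k * (e * e))
  ^-taylor zero {D} {e} _ _ _ = ≤-reflexive (trans (eq D e) (cong (λ t → 1ℚ * (D * D + t * (D * e) + t * t * (e * e))) (sym (ι≡# 0))))
    where
    eq : ∀ D e → D * D * 1ℚ ≡ 1ℚ * (D * D + 0ℚ * (D * e) + 0ℚ * 0ℚ * (e * e))
    eq = solve-∀ ℚ-ring
  ^-taylor (suc k) {D} {e} 0≤D 0≤D+e le = ≤-trans
    (≤-trans (≤-reflexive (eq₁ D (D + e) ((D + e) ^ k))) (*-monoˡ-≤ 0≤D+e (^-taylor k 0≤D 0≤D+e le')))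
    (slack-≤ (D ^ k * (e * e * (D + K * (D - K * e))))
      (0≤* (0≤^ k 0≤D) (0≤* (0≤² e) (0≤+ 0≤D (0≤* (0≤ι k) (0≤- le')))))
      (trans (cong (λ t → D * D ^ k * (D * D + t * (D * e) + t * t * (e * e))) (ι-suc k)) (eq₂ D e K (D ^ k))))
    where
    K = ι k
    le' : K * e ≤ D
    le' = ι-pred-* k {e} 0≤D le
    eq₁ : ∀ D s p → D * D * (s * p) ≡ s * (D * D * p)
    eq₁ = solve-∀ ℚ-ring
    eq₂ : ∀ D e K p → D * p * (D * D + (1ℚ + K) * (D * e) + (1ℚ + K) * (1ℚ + K) * (e * e))
          ≡ (D + e) * (p * (D * D + K * (D * e) + K * K * (e * e))) + p * (e * e * (D + K * (D - K * e)))
    eq₂ = solve-∀ ℚ-ring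

  -- One test of the potential: D moves by s + ω − 2 η, with s the first-order term.
  ^-step : ∀ r {D ζ ω s η} → let q = ι (suc r) in
           ζ ≤ D → 0ℚ ≤ ω → 0ℚ ≤ η → s * s ≡ # 4 * (ζ * ω) → # 180 ≤ D →
           q * q * ω ≤ 1ℚ → # 8 * (q * η) ≤ D → 0ℚ ≤ D + (s + ω - # 2 * η) →
           (D + (s + ω - # 2 * η)) ^ suc r ≤ D ^ r * (D + q * (s + # 10 * q * ω - η))
  ^-step r {D} {ζ} {ω} {s} {η} ζ≤D 0≤ω 0≤η s² 180≤D q²ω≤1 8qη≤D 0≤D' =
    -- After `^-taylor` it remains to show q e'² ≤ D c. Of the drift 2 η, one η is spent here as
    -- part of c against the square of the step, and the other survives in the conclusion. The 8 q ω
    -- in c absorbs s² = 4 ζ ω ≤ 4 D ω.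
    *-cancelˡ-≤ (0<* 0<D 0<D) (≤-trans (^-taylor (suc r) 0≤D 0≤D' qe≤D)
      (slack-≤ (D ^ r * (D * (q * (D * (# 2 * ((q - 1ℚ) * ω)) + (D * c - q * (e' * e'))))))
        (0≤* (0≤^ r 0≤D) (0≤* 0≤D (0≤* 0≤q (0≤+ (0≤* 0≤D (0≤* (0≤# 2) (0≤* (0≤- 1≤q) 0≤ω))) (0≤- qe²≤Dc)))))
        (eq D (D ^ r) q s ω η)))
    where
    q = ι (suc r)
    e' = s + ω - # 2 * η
    c = ω + η + # 8 * q * ω
    0<D = <-≤-trans (0<# 180) 180≤D
    0≤D = <⇒≤ 0<D
    0≤q = 0≤ι (suc r)
    1≤q : 1ℚ ≤ q
    1≤q = #≤ι (ℕ.s≤s ℕ.z≤n)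
    qω≤1 : q * ω ≤ 1ℚ
    qω≤1 = ≤-trans (slack-≤ ((q - 1ℚ) * (q * ω)) (0≤* (0≤- 1≤q) (0≤* 0≤q 0≤ω)) (eq₀ q ω)) q²ω≤1
      where
      eq₀ : ∀ q ω → q * q * ω ≡ q * ω + (q - 1ℚ) * (q * ω)
      eq₀ = solve-∀ ℚ-ring
    2qs≤D : # 2 * (q * s) ≤ D
    2qs≤D = ²-cancel-≤ 0≤D (≤-trans (≤-reflexive (trans (eq₁ q s) (cong (λ t → # 4 * (q * q * t)) s²)))
      (slack-≤ (# 16 * (q * q * ω) * (D - ζ) + # 16 * D * (1ℚ - q * q * ω) + D * (D - # 180) + # 164 * D)
        (0≤+ (0≤+ (0≤+ (0≤* (0≤* (0≤# 16) (0≤* (0≤* 0≤q 0≤q) 0≤ω)) (0≤- ζ≤D)) (0≤* (0≤* (0≤# 16) 0≤D) (0≤- q²ω≤1)))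
          (0≤* 0≤D (0≤- 180≤D))) (0≤* (0≤# 164) 0≤D))
        (eq₂ D q ζ ω)))
      where
      eq₁ : ∀ q s → # 2 * (q * s) * (# 2 * (q * s)) ≡ # 4 * (q * q * (s * s))
      eq₁ = solve-∀ ℚ-ring
      eq₂ : ∀ D q ζ ω → D * D ≡ # 4 * (q * q * (# 4 * (ζ * ω))) +
        (# 16 * (q * q * ω) * (D - ζ) + # 16 * D * (1ℚ - q * q * ω) + D * (D - # 180) + # 164 * D)
      eq₂ = solve-∀ ℚ-ring
    qe≤D : q * e' ≤ D
    qe≤D = *-cancelˡ-≤ (0<# 2) (slack-≤
      ((D - # 2 * (q * s)) + # 2 * (1ℚ - q * ω) + # 4 * (q * η) + (D - # 180) + # 178)
      (0≤+ (0≤+ (0≤+ (0≤+ (0≤- 2qs≤D) (0≤* (0≤# 2) (0≤- qω≤1))) (0≤* (0≤# 4) (0≤* 0≤q 0≤η))) (0≤- 180≤D)) (0≤# 178))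
      (eq₃ D q s ω η))
      where
      eq₃ : ∀ D q s ω η → # 2 * D ≡ # 2 * (q * (s + ω - # 2 * η)) +
        ((D - # 2 * (q * s)) + # 2 * (1ℚ - q * ω) + # 4 * (q * η) + (D - # 180) + # 178)
      eq₃ = solve-∀ ℚ-ring
    -- e'² ≤ 2 s² + 2 ω² + 8 η²
    qe²≤Dc : q * (e' * e') ≤ D * c
    qe²≤Dc = slack-≤
      (q * ((s - (ω - # 2 * η)) * (s - (ω - # 2 * η))) + # 8 * (q * (ω * η)) + η * (D - # 8 * (q * η))
        + # 2 * (ω * (1ℚ - q * ω)) + ω * (D - # 180) + # 178 * ω + # 8 * (q * ω * (D - ζ)))
      (0≤+ (0≤+ (0≤+ (0≤+ (0≤+ (0≤+ (0≤* 0≤q (0≤² (s - (ω - # 2 * η)))) (0≤* (0≤# 8) (0≤* 0≤q (0≤* 0≤ω 0≤η))))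
        (0≤* 0≤η (0≤- 8qη≤D))) (0≤* (0≤# 2) (0≤* 0≤ω (0≤- qω≤1)))) (0≤* 0≤ω (0≤- 180≤D))) (0≤* (0≤# 178) 0≤ω))
        (0≤* (0≤# 8) (0≤* (0≤* 0≤q 0≤ω) (0≤- ζ≤D))))
      (trans (eq₄ D q s ω η ζ) (trans (cong (λ t → LHS + (# 2 * (q * (# 4 * (ζ * ω))) - # 2 * (q * t))) s²)
        (eq₅ LHS (# 2 * (q * (# 4 * (ζ * ω)))))))
      where
      LHS = q * (e' * e') + (q * ((s - (ω - # 2 * η)) * (s - (ω - # 2 * η))) + # 8 * (q * (ω * η)) + η * (D - # 8 * (q * η))
        + # 2 * (ω * (1ℚ - q * ω)) + ω * (D - # 180) + # 178 * ω + # 8 * (q * ω * (D - ζ)))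
      eq₄ : ∀ D q s ω η ζ → D * (ω + η + # 8 * q * ω) ≡
        q * ((s + ω - # 2 * η) * (s + ω - # 2 * η)) + (q * ((s - (ω - # 2 * η)) * (s - (ω - # 2 * η))) + # 8 * (q * (ω * η)) + η * (D - # 8 * (q * η))
        + # 2 * (ω * (1ℚ - q * ω)) + ω * (D - # 180) + # 178 * ω + # 8 * (q * ω * (D - ζ)))
        + (# 2 * (q * (# 4 * (ζ * ω))) - # 2 * (q * (s * s)))
      eq₄ = solve-∀ ℚ-ring
      eq₅ : ∀ a b → a + (b - b) ≡ a
      eq₅ = solve-∀ ℚ-ring
    eq : ∀ D p q s ω η → D * D * (p * (D + q * (s + # 10 * q * ω - η))) ≡
      D * p * (D * D + q * (D * (s + ω - # 2 * η)) + q * q * ((s + ω - # 2 * η) * (s + ω - # 2 * η)))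
      + p * (D * (q * (D * (# 2 * ((q - 1ℚ) * ω)) + (D * (ω + η + # 8 * q * ω) - q * ((s + ω - # 2 * η) * (s + ω - # 2 * η))))))
    eq = solve-∀ ℚ-ring

  -- Choosing a direction for the walk

  Indicator : ∀ {n} → V n → Set
  Indicator χ = ∀ v → χ v ≡ 0ℚ ⊎ χ v ≡ 1ℚ

  01*-≤ : ∀ {c a} → c ≡ 0ℚ ⊎ c ≡ 1ℚ → 0ℚ ≤ a → c * a ≤ a
  01*-≤ {a = a} (inj₁ refl) p = subst (_≤ a) (sym (*-zeroˡ a)) p
  01*-≤ {a = a} (inj₂ refl) p = ≤-reflexive (*-identityˡ a)

  01-nonzero : ∀ {c} → c ≡ 0ℚ ⊎ c ≡ 1ℚ → c ≢ 0ℚ → c ≡ 1ℚ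
  01-nonzero (inj₁ z) nz = contradiction z nz
  01-nonzero (inj₂ o) nz = o

  mask : ∀ {n} → V n → V n → V n
  mask χ c v = χ v * c v

  mask-supp : ∀ {n} {χ : V n} → Indicator χ → ∀ c → Supp χ (mask χ c)
  mask-supp {χ = χ} i c = supp λ v → eq v (i v)
    where
    eq : ∀ v → χ v ≡ 0ℚ ⊎ χ v ≡ 1ℚ → χ v * (χ v * c v) ≡ χ v * c v
    eq v (inj₁ p) rewrite p = trans (*-zeroˡ (0ℚ * c v)) (sym (*-zeroˡ (c v)))
    eq v (inj₂ p) rewrite p = *-identityˡ (1ℚ * c v)

  opaque
    unfolding _·_

    ·-mask : ∀ {n} {χ u : V n} → Supp χ u → ∀ c → u · mask χ c ≡ u · c
    ·-mask {χ = χ} {u} s c = sum-cong λ v → trans (eq (u v) (χ v) (c v)) (cong (_* c v) (Supp.at s v))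
      where
      eq : ∀ u x c → u * (x * c) ≡ x * u * c
      eq = solve-∀ ℚ-ring

    -- By self-adjointness, b · res (e v) is the v-th coordinate of res b.
    sum-res : ∀ {n} (b : V n) {bs} → Orth bs →
              sum (λ v → (b · res (e v) bs) * (b · res (e v) bs)) ≡ res b bs · res b bs
    sum-res b {bs} o = sum-cong λ v → cong (λ t → t * t) (coord v)
      where
      coord : ∀ v → b · res (e v) bs ≡ res b bs v
      coord v = trans (res-sym b (e v) o) (trans (·-comm (e v) (res b bs)) (·-e (res b bs) v))

  perp-unmask : ∀ {n} {χ u : V n} → Supp χ u → ∀ cs → Perp u (map (mask χ) cs) → Perp u cs
  perp-unmask s []       []       = []
  perp-unmask s (c ∷ cs) (p ∷ ps) = trans (sym (·-mask s c)) p ∷ perp-unmask s cs ps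

  -- `weight` is 1/τ_F. The potential follows the row `f`, but on moves orthogonal to G that row
  -- acts like the short vector `b`, and all size estimates go through `b`.
  record Test {n} (G : List (V n)) : Set where
    field
      f       : V n
      weight  : ℚ
      b       : V n
      0≤w     : 0ℚ ≤ weight
      norm    : weight * b · b ≤ 1ℚ
      reduces : ∀ {y} → Perp y G → f · y ≡ b · y

  e-supp : ∀ {n} {χ : V n} v → χ v ≡ 1ℚ → Supp χ (e v)
  e-supp {χ = χ} v p = supp (go χ v p)
    where
    go : ∀ {n} (χ : V n) v → χ v ≡ 1ℚ → ∀ w → χ w * e v w ≡ e v w
    go χ zero    p zero    = trans (*-identityʳ (χ zero)) p
    go χ zero    p (suc w) = *-zeroʳ (χ (suc w))
    go χ (suc v) p zero    = *-zeroʳ (χ zero)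
    go χ (suc v) p (suc w) = go (χ ∘ suc) v p w

  record Direction {n m} (χ x : V n) (G : List (V n)) (T : Fin m → Test G) (N : ℕ) (p : Fin m → ℚ) : Set where
    open Test
    field
      u        : V n
      u-supp   : Supp χ u
      u-⊥x     : u · x ≡ 0ℚ
      u-⊥G     : Perp u G
      u²≤1     : u · u ≤ 1ℚ
      1≤9u²    : 1ℚ ≤ # 9 * u · u
      energy   : ι N * sum (λ k → p k * (weight (T k) * (f (T k) · u * f (T k) · u))) ≤ # 9 * (sum p * u · u)

  -- Average over the projections U v of the alive unit vectors to the complement of x and G. With Q
  -- v the weighted energy of U v, the sum of N Q v + P over alive v is at most 2 N P by `sum-res`.
  -- The sum of U v v = |U v|² is at least N/4 by `trace`, so 9 P |U v|² sums to at least 9 N P / 4,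
  -- which is more. Some alive v therefore satisfies N Q v + P < 9 P |U v|², and this single
  -- inequality yields both the energy bound and the lower bound on |u|².
  direction : ∀ {n m} (χ x : V n) (G : List (V n)) (T : Fin m → Test G) (N : ℕ) (p : Fin m → ℚ) →
    Indicator χ → 0ℚ < ι N → sum χ ≤ ι N → ι N ≤ # 4 * (sum χ - ι (suc (length G))) →
    (∀ k → 0ℚ ≤ p k) → 0ℚ < sum p → Direction χ x G T N p
  direction {n} {m} χ x G T N p ind 0<N |χ|≤N N≤ 0≤p 0<P = record
    { u = U v ; u-supp = Uv-supp ; u-⊥x = All.head U⊥cs ; u-⊥G = All.tail U⊥cs
    ; u²≤1 = ≤-trans (res-norm (e v) orth) (≤-reflexive (trans (·-e (e v) v) (e-self v)))
    ; 1≤9u² = *-cancelˡ-≤ 0<P (≤-trans (≤-reflexive (*-identityʳ P)) (≤-trans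
        (slack-≤ (ι N * Q v + (# 9 * (P * U v · U v) - (ι N * Q v + P)))
           (0≤+ (0≤* (<⇒≤ 0<N) (0≤Q v)) (0≤- (<⇒≤ small)))
           (eq₁ P (ι N * Q v) (# 9 * (P * U v · U v)))) (≤-reflexive (eq₂ (# 9) P (U v · U v)))))
    ; energy = subst (λ t → ι N * t ≤ # 9 * (P * U v · U v)) (sum-cong λ k → trans (*-assoc (p k) (weight (T k)) (b (T k) · U v * b (T k) · U v))
          (cong (λ t → p k * (weight (T k) * (t * t))) (sym (reduces (T k) (All.tail U⊥cs)))))
        (≤-trans (slack-≤ P (<⇒≤ 0<P) refl) (<⇒≤ small))
    }
    where
    open Test
    P = sum p
    cs = x ∷ G
    -- The constraints are cut down to the alive coordinates first: then the projection of an alive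
    -- unit vector stays supported there, and for supported vectors the cut constraints are
    -- equivalent to the original ones.
    open Orthogonalised (gram-schmidt (map (mask χ) cs))
    all-supp : ∀ cs → All (Supp χ) (map (mask χ) cs)
    all-supp []       = []
    all-supp (c ∷ cs) = mask-supp ind c ∷ all-supp cs
    U : Fin n → V n
    U v = res (e v) basis
    w : Fin m → ℚ
    w k = p k * weight (T k)
    0≤w' : ∀ k → 0ℚ ≤ w k
    0≤w' k = 0≤* (0≤p k) (0≤w (T k))
    Q : Fin n → ℚ
    Q v = sum (λ k → w k * (b (T k) · U v * b (T k) · U v))
    0≤Q : ∀ v → 0ℚ ≤ Q v
    0≤Q v = 0≤sum (λ k → 0≤* (0≤w' k) (0≤² (b (T k) · U v)))
    ΣQ≤P : sum Q ≤ P
    ΣQ≤P = ≤-trans (≤-reflexive (sum-swap (λ v k → w k * (b (T k) · U v * b (T k) · U v)))) (sum-mono-≤ λ k →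
      ≤-trans (≤-reflexive (trans (sum-* (w k) (λ v → b (T k) · U v * b (T k) · U v)) (cong (w k *_) (sum-res (b (T k)) orth))))
        (≤-trans (*-monoˡ-≤ (0≤w' k) (res-norm (b (T k)) orth))
          (≤-trans (≤-reflexive (*-assoc (p k) (weight (T k)) (b (T k) · b (T k))))
            (≤-trans (*-monoˡ-≤ (0≤p k) (norm (T k))) (≤-reflexive (*-identityʳ (p k)))))))
    χQ≤Q : ∀ v → χ v * Q v ≤ Q v
    χQ≤Q v = 01*-≤ (ind v) (0≤Q v)
    -- Negative exactly at a coordinate of the wanted kind; at dead coordinates the factor χ v makes
    -- it 0, so the negative one found below is alive.
    term : Fin n → ℚ
    term v = (ι N * (χ v * Q v) + P * χ v) + (- (# 9 * P)) * (χ v * U v v)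
    L = ι (length basis)
    Σterm : sum term ≡ (ι N * sum (λ v → χ v * Q v) + P * sum χ) + (- (# 9 * P)) * (sum χ - L)
    Σterm = trans (sum-+ (λ v → ι N * (χ v * Q v) + P * χ v) (λ v → (- (# 9 * P)) * (χ v * U v v))) (cong₂ _+_
      (trans (sum-+ (λ v → ι N * (χ v * Q v)) (λ v → P * χ v)) (cong₂ _+_ (sum-* (ι N) (λ v → χ v * Q v)) (sum-* P χ)))
      (trans (sum-* (- (# 9 * P)) (λ v → χ v * U v v)) (cong (- (# 9 * P) *_) (trace χ orth (supported (all-supp cs))))))
    L≤ : L ≤ ι (suc (length G))
    L≤ = ι-mono-≤ (subst (length basis ℕ.≤_) (length-map (mask χ) cs) size)
    Σterm<0 : sum term < 0ℚ
    Σterm<0 = *-cancelˡ-<-nonNeg (# 4) (slack-< excess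
      (<-≤-trans (0<* 0<P 0<N) (slack-≤ _ (0≤+ (0≤+ (0≤+
          (0≤* (0≤# 4) (0≤* (<⇒≤ 0<N) (0≤- (≤-trans (sum-mono-≤ χQ≤Q) ΣQ≤P))))
          (0≤* (0≤# 4) (0≤* (<⇒≤ 0<P) (0≤- |χ|≤N))))
          (0≤* (0≤# 9) (0≤* (<⇒≤ 0<P) (0≤- N≤))))
          (0≤* (0≤# 36) (0≤* (<⇒≤ 0<P) (0≤- L≤)))) (+-comm _ (P * ι N))))
      (trans (eq₃ P (ι N) (sum (λ v → χ v * Q v)) (sum χ) M L) (cong (λ t → # 4 * t + excess) (sym Σterm))))
      where
      M = ι (suc (length G))
      excess = # 4 * (ι N * (P - sum (λ v → χ v * Q v))) + # 4 * (P * (ι N - sum χ)) + # 9 * (P * (# 4 * (sum χ - M) - ι N)) + # 36 * (P * (M - L)) + P * ι N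
      eq₃ : ∀ P N S X M L → # 4 * 0ℚ ≡ # 4 * ((N * S + P * X) + (- (# 9 * P)) * (X - L)) +
        (# 4 * (N * (P - S)) + # 4 * (P * (N - X)) + # 9 * (P * (# 4 * (X - M) - N)) + # 36 * (P * (M - L)) + P * N)
      eq₃ = solve-∀ ℚ-ring
    found = sum<0⇒term<0 term Σterm<0
    v = proj₁ found
    χv≡1 : χ v ≡ 1ℚ
    χv≡1 = 01-nonzero (ind v) λ z → <-irrefl (trans (cong (λ t → (ι N * (t * Q v) + P * t) + (- (# 9 * P)) * (t * U v v)) z)
                     (eq₄ (ι N) (Q v) P (U v v))) (proj₂ found)
      where
      eq₄ : ∀ N Q P u → (N * (0ℚ * Q) + P * 0ℚ) + (- (# 9 * P)) * (0ℚ * u) ≡ 0ℚ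
      eq₄ = solve-∀ ℚ-ring
    U² : U v · U v ≡ U v v
    U² = trans (res-self (e v) orth) (trans (·-comm (e v) (U v)) (·-e (U v) v))
    small : ι N * Q v + P < # 9 * (P * U v · U v)
    small = slack-< (- term v) (neg-antimono-< (proj₂ found)) (trans (eq₅ (ι N * Q v) P (U v · U v)) (cong (λ t → ι N * Q v + P + - t)
      (trans (cong (λ t → ι N * Q v + P + (- (# 9 * P)) * t) U²) (trans (eq₆ (ι N) (Q v) P (U v v)) (cong (λ t → (ι N * (t * Q v) + P * t) + (- (# 9 * P)) * (t * U v v)) (sym χv≡1))))))
      where
      eq₅ : ∀ a P u → # 9 * (P * u) ≡ a + P + - (a + P + (- (# 9 * P)) * u)
      eq₅ = solve-∀ ℚ-ring
      eq₆ : ∀ N Q P u → N * Q + P + (- (# 9 * P)) * u ≡ (N * (1ℚ * Q) + P * 1ℚ) + (- (# 9 * P)) * (1ℚ * u)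
      eq₆ = solve-∀ ℚ-ring
    Uv-supp : Supp χ (U v)
    Uv-supp = Supp-res (e-supp v χv≡1) (supported (all-supp cs))
    U⊥cs : Perp (U v) cs
    U⊥cs = perp-unmask Uv-supp cs (perp (res-perp (e v) orth))
    eq₁ : ∀ P a c → c ≡ P + (a + (c - (a + P)))
    eq₁ = solve-∀ ℚ-ring
    eq₂ : ∀ c P u → c * (P * u) ≡ P * (c * u)
    eq₂ = solve-∀ ℚ-ring

  -- The walk

  Box : ℚ → Set
  Box c = - 1ℚ ≤ c × c ≤ 1ℚ

  Frozen : ℚ → Set
  Frozen c = c ≡ 1ℚ ⊎ c ≡ - 1ℚ

  box-sq : ∀ {c} → Box c → c * c ≤ 1ℚ
  box-sq {c} (p , q) = slack-≤ ((1ℚ - c) * (c - - 1ℚ)) (0≤* (0≤- q) (0≤- p)) (eq c)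
    where
    eq : ∀ c → 1ℚ ≡ c * c + (1ℚ - c) * (c - - 1ℚ)
    eq = solve-∀ ℚ-ring

  between : ∀ {x t t' u} → 0ℚ ≤ t' → t' ≤ t → 0ℚ ≤ u → x ≤ x + t' * u × x + t' * u ≤ x + t * u
  between {x} {t} {t'} {u} p q r = slack-≤ (t' * u) (0≤* p r) refl , +-monoʳ-≤ x (*-monoʳ-≤ r q)

  flip-neg : ∀ x t u → - x + t * (- u) ≡ - (x + t * u)
  flip-neg = solve-∀ ℚ-ring

  box-neg : ∀ {c} → Box c → Box (- c)
  box-neg {c} (p , q) = neg-antimono-≤ q , subst (- c ≤_) (eq 1ℚ) (neg-antimono-≤ p)
    where
    eq : ∀ a → - - a ≡ a
    eq = solve-∀ ℚ-ring

  box-convex : ∀ {x t t' u} → 0ℚ ≤ t' → t' ≤ t → Box x → Box (x + t * u) → Box (x + t' * u)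
  box-convex {x} {t} {t'} {u} p q bx bt with ≤-total 0ℚ u
  ... | inj₁ 0≤u = ≤-trans (proj₁ bx) (proj₁ (between {x} p q 0≤u)) , ≤-trans (proj₂ (between {x} p q 0≤u)) (proj₂ bt)
  ... | inj₂ u≤0 = subst Box (trans (cong -_ (flip-neg x t' u)) (neg-neg (x + t' * u))) (box-neg
      (≤-trans (proj₁ (box-neg bx)) (proj₁ (between {(- x)} p q (neg-antimono-≤ u≤0)))
      , ≤-trans (proj₂ (between {(- x)} p q (neg-antimono-≤ u≤0))) (subst (_≤ 1ℚ) (sym (flip-neg x t u)) (proj₂ (box-neg bt)))))
    where
    neg-neg : ∀ a → - - a ≡ a
    neg-neg = solve-∀ ℚ-ring

  hit-top : ∀ {x t u} → x ≤ 1ℚ → 0ℚ ≤ t → 1ℚ < x + t * u → ∃ λ t' → 0ℚ ≤ t' × t' ≤ t × u ≢ 0ℚ × x + t' * u ≡ 1ℚ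
  hit-top {x} {t} {u} x≤1 0≤t lt = t' , 0≤* (0≤- x≤1) (0≤inv 0<u) , t'≤t , u≢0 , hit
    where
    u≰0 : ¬ u ≤ 0ℚ
    u≰0 u≤0 = <-irrefl refl (<-≤-trans lt (≤-trans
      (+-monoʳ-≤ x (subst (t * u ≤_) (*-zeroʳ t) (*-monoˡ-≤ 0≤t u≤0))) (≤-trans (≤-reflexive (+-identityʳ x)) x≤1)))
    0<u = ≰⇒> u≰0
    u≢0 : u ≢ 0ℚ
    u≢0 p = u≰0 (≤-reflexive p)
    t' = (1ℚ - x) * inv u
    eq : ∀ x u i → x + (1ℚ - x) * i * u ≡ x + (1ℚ - x) * (u * i)
    eq = solve-∀ ℚ-ring
    eq₂ : ∀ x → x + (1ℚ - x) * 1ℚ ≡ 1ℚ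
    eq₂ = solve-∀ ℚ-ring
    hit : x + t' * u ≡ 1ℚ
    hit = trans (eq x u (inv u)) (trans (cong (λ z → x + (1ℚ - x) * z) (*-inv u≢0)) (eq₂ x))
    t'≤t : t' ≤ t
    t'≤t = ≮⇒≥ λ t<t' → <-irrefl refl (<-≤-trans lt (≤-trans (+-monoʳ-≤ x (*-monoʳ-≤ (<⇒≤ 0<u) (<⇒≤ t<t'))) (≤-reflexive hit)))

  line-search : ∀ {n} (x u : V n) {δ} → 0ℚ ≤ δ → (∀ v → Box (x v)) →
    ∃ λ t → 0ℚ ≤ t × t ≤ δ × (∀ v → Box (x v + t * u v)) ×
            (t ≡ δ ⊎ ∃ λ v → u v ≢ 0ℚ × Frozen (x v + t * u v))
  line-search {zero}  x u {δ} 0≤δ bx = δ , 0≤δ , ≤-refl , (λ ()) , inj₁ refl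
  line-search {suc n} x u {δ} 0≤δ bx with line-search (x ∘ suc) (u ∘ suc) 0≤δ (bx ∘ suc)
  ... | t , 0≤t , t≤δ , bt , ev with (x zero + t * u zero) ≤? 1ℚ | (- x zero + t * (- u zero)) ≤? 1ℚ
  ... | yes p | yes q = t , 0≤t , t≤δ , (λ { zero → below , p ; (suc v) → bt v }) , move ev
    where
    eq : ∀ a t u → - (- a + t * (- u)) ≡ a + t * u
    eq = solve-∀ ℚ-ring
    below = subst (- 1ℚ ≤_) (eq (x zero) t (u zero)) (neg-antimono-≤ q)
    move : t ≡ δ ⊎ (∃ λ v → u (suc v) ≢ 0ℚ × Frozen (x (suc v) + t * u (suc v))) →
           t ≡ δ ⊎ (∃ λ v → u v ≢ 0ℚ × Frozen (x v + t * u v))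
    move (inj₁ p)       = inj₁ p
    move (inj₂ (v , p)) = inj₂ (suc v , p)
  ... | no p | _ =
    let t' , 0≤t' , t'≤t , u≢0 , hit = hit-top {x zero} {t} {u zero} (proj₂ (bx zero)) 0≤t (≰⇒> p) in
    t' , 0≤t' , ≤-trans t'≤t t≤δ ,
    (λ { zero → (subst (- 1ℚ ≤_) (sym hit) (-1≤1)) , ≤-reflexive hit
       ; (suc v) → box-convex 0≤t' t'≤t (bx (suc v)) (bt v) }) , inj₂ (zero , u≢0 , inj₁ hit)
    where
    -1≤1 : - 1ℚ ≤ 1ℚ
    -1≤1 = <⇒≤ (<-trans (negative⁻¹ (- 1ℚ)) (positive⁻¹ 1ℚ))
  ... | yes _ | no q =
    let t' , 0≤t' , t'≤t , u≢0 , hit = hit-top {(- x zero)} {t} {(- u zero)} (proj₂ (box-neg (bx zero))) 0≤t (≰⇒> q)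
        hit' = trans (eq (x zero) t' (u zero)) (cong -_ hit) in
    t' , 0≤t' , ≤-trans t'≤t t≤δ ,
    (λ { zero → ≤-reflexive (sym hit') , (subst (_≤ 1ℚ) (sym hit') (-1≤1))
       ; (suc v) → box-convex 0≤t' t'≤t (bx (suc v)) (bt v) }) , inj₂ (zero , (λ z → u≢0 (cong -_ z)) , inj₂ hit')
    where
    eq : ∀ a t u → a + t * u ≡ - (- a + t * (- u))
    eq = solve-∀ ℚ-ring
    -1≤1 : - 1ℚ ≤ 1ℚ
    -1≤1 = <⇒≤ (<-trans (negative⁻¹ (- 1ℚ)) (positive⁻¹ 1ℚ))

  χ : ∀ {n} → Subset n → V n
  χ A v = if lookup A v then 1ℚ else 0ℚ

  χ-indicator : ∀ {n} (A : Subset n) → Indicator (χ A)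
  χ-indicator A v with lookup A v
  ... | true  = inj₂ refl
  ... | false = inj₁ refl

  χ-∈ : ∀ {n} {A : Subset n} {v} → v ∈ A → χ A v ≡ 1ℚ
  χ-∈ p = cong (if_then 1ℚ else 0ℚ) ([]=⇒lookup p)

  χ-∉ : ∀ {n} {A : Subset n} {v} → v ∉ A → χ A v ≡ 0ℚ
  χ-∉ {A = A} {v} p = go (lookup A v) refl
    where
    go : ∀ b → lookup A v ≡ b → χ A v ≡ 0ℚ
    go true  eq = contradiction (lookup⇒[]= v A eq) p
    go false eq = cong (if_then 1ℚ else 0ℚ) eq

  sum-χ : ∀ {n} (A : Subset n) → sum (χ A) ≡ ι ∣ A ∣
  sum-χ []          = sym (ι≡# 0)
  sum-χ (true ∷ A)  = trans (cong (1ℚ +_) (sum-χ A)) (sym (ι-suc ∣ A ∣))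
  sum-χ (false ∷ A) = trans (+-identityˡ (sum (χ A))) (sum-χ A)

  module Potential {n m : ℕ} (r N : ℕ) (4≤N : 4 ℕ.≤ N) (x₀ : V n) (G : List (V n)) (T : Fin m → Test G) where
    open Test

    -- 90 = 10 · 9, with 10 from the second-order term of `^-step` and 9 from the energy bound of
    -- `direction`. Since E stays at most N, the drift 2 H E never exceeds 180 q; starting at 360 q
    -- therefore keeps D at least 180 q, as `^-step` requires.
    q ν H a : ℚ
    q = ι (suc r)
    ν = inv (ι N)
    H = # 90 * q * ν
    a = # 360 * q

    E : V n → ℚ
    E x = x · x - x₀ · x₀

    dev : Fin m → V n → ℚ
    dev k x = f (T k) · (x ⊕ - 1ℚ ⋆ x₀)

    D : V n → Fin m → ℚ
    D x k = a - # 2 * (H * E x) + weight (T k) * (dev k x * dev k x)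

    p : V n → Fin m → ℚ
    p x k = D x k ^ r

    Φ : V n → ℚ
    Φ x = sum (λ k → D x k ^ suc r)

    -- The derivative of Φ in direction u, up to a positive factor.
    slope : V n → V n → ℚ
    slope x u = sum (λ k → p x k * (weight (T k) * (dev k x * f (T k) · u)))

    0<N : 0ℚ < ι N
    0<N = <-≤-trans (0<# 4) (#≤ι 4≤N)
    Nν≡1 : ι N * ν ≡ 1ℚ
    Nν≡1 = *-inv (λ z → <-irrefl (sym z) 0<N)
    0≤ν : 0ℚ ≤ ν
    0≤ν = 0≤inv 0<N
    0≤q : 0ℚ ≤ q
    0≤q = 0≤ι (suc r)
    1≤q : 1ℚ ≤ q
    1≤q = #≤ι (ℕ.s≤s ℕ.z≤n)
    0≤H : 0ℚ ≤ H
    0≤H = 0≤* (0≤* (0≤# 90) 0≤q) 0≤ν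

    ζ≤D-180q : ∀ {x} k → E x ≤ ι N → weight (T k) * (dev k x * dev k x) + # 180 * q ≤ D x k
    ζ≤D-180q {x} k E≤N = slack-≤ (# 180 * (q * ν * (ι N - E x))) (0≤* (0≤# 180) (0≤* (0≤* 0≤q 0≤ν) (0≤- E≤N)))
      (trans (eq₀ (D x k) q) (trans (cong (λ t → D x k + # 180 * (q * (t - 1ℚ))) (sym Nν≡1)) (eq (ι N) ν q (E x) z)))
      where
      z = weight (T k) * (dev k x * dev k x)
      eq : ∀ N ν q E z → # 360 * q - # 2 * (# 90 * q * ν * E) + z + # 180 * (q * (N * ν - 1ℚ)) ≡ z + # 180 * q + # 180 * (q * ν * (N - E))
      eq = solve-∀ ℚ-ring
      eq₀ : ∀ d q → d ≡ d + # 180 * (q * (1ℚ - 1ℚ))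
      eq₀ = solve-∀ ℚ-ring

    -- Orthogonality of u to x removes the cross term, so every move increases E whatever its sign.
    E-step : ∀ x u c → u · x ≡ 0ℚ → E (x ⊕ c ⋆ u) ≡ E x + c * c * u · u
    E-step x u c u⊥x = trans (cong (_- x₀ · x₀) (begin
        (x ⊕ c ⋆ u) · (x ⊕ c ⋆ u)                  ≡⟨ ·-linˡ x c u (x ⊕ c ⋆ u) ⟩
        x · (x ⊕ c ⋆ u) + c * u · (x ⊕ c ⋆ u)      ≡⟨ cong₂ (λ s t → s + c * t) (·-linʳ x x c u) (·-linʳ u x c u) ⟩
        x · x + c * x · u + c * (u · x + c * u · u) ≡⟨ cong₂ (λ s t → x · x + c * s + c * (t + c * u · u)) (trans (·-comm x u) u⊥x) u⊥x ⟩
        x · x + c * 0ℚ + c * (0ℚ + c * u · u)      ∎)) (eq (x · x) c (u · u) (x₀ · x₀))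
      where
      open ≡-Reasoning
      eq : ∀ a c u z → a + c * 0ℚ + c * (0ℚ + c * u) - z ≡ a - z + c * c * u
      eq = solve-∀ ℚ-ring

    dev-step : ∀ k x u c → dev k (x ⊕ c ⋆ u) ≡ dev k x + c * f (T k) · u
    dev-step k x u c = trans (·-linʳ F (x ⊕ c ⋆ u) (- 1ℚ) x₀) (trans (cong (λ t → t + - 1ℚ * F · x₀) (·-linʳ F x c u))
      (trans (eq (F · x) (c * F · u) (F · x₀)) (cong (_+ c * F · u) (sym (·-linʳ F x (- 1ℚ) x₀)))))
      where
      F = f (T k)
      eq : ∀ a b d → a + b + - 1ℚ * d ≡ a + - 1ℚ * d + b
      eq = solve-∀ ℚ-ring

    -- Summing `^-step` over the tests leaves three terms. The first-order one is 2 c times the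
    -- slope, made nonpositive by the sign of c. The second-order one is at most 10 q · 9 ε P / N by
    -- the energy bound, which is precisely the drift η P.
    Φ-step : ∀ x u c → Perp u G → u · x ≡ 0ℚ → E x ≤ ι N → E (x ⊕ c ⋆ u) ≤ ι N →
      q * q * (c * c * u · u) ≤ 1ℚ → c * slope x u ≤ 0ℚ →
      ι N * sum (λ k → p x k * (weight (T k) * (f (T k) · u * f (T k) · u))) ≤ # 9 * (sum (p x) * u · u) →
      Φ (x ⊕ c ⋆ u) ≤ Φ x
    Φ-step x u c u⊥G u⊥x E≤N E'≤N q²ε≤1 down energy = ≤-trans (sum-mono-≤ each) (≤-trans (≤-reflexive total)
      (slack-≤ _ (0≤* 0≤q (0≤+ (0≤* (0≤# 2) (0≤- down))
         (0≤* (0≤* (0≤* (0≤# 10) 0≤q) (0≤² c)) (0≤* 0≤ν (0≤- energy))))) final))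
      where
      x' = x ⊕ c ⋆ u
      ε = c * c * u · u
      0≤ε = 0≤* (0≤² c) (0≤·self u)
      η = H * ε
      g : Fin m → ℚ
      g k = f (T k) · u
      w : Fin m → ℚ
      w k = weight (T k)
      ω s : Fin m → ℚ
      ω k = w k * (c * g k * (c * g k))
      s k = # 2 * (w k * (dev k x * (c * g k)))
      0≤ω : ∀ k → 0ℚ ≤ ω k
      0≤ω k = 0≤* (0≤w (T k)) (0≤² (c * g k))
      ω≤ε : ∀ k → ω k ≤ ε
      ω≤ε k = ≤-trans (≤-trans (≤-reflexive (trans (cong (λ t → w k * (c * t * (c * t))) (reduces (T k) u⊥G)) (eq₁ (w k) c (B · u))))
        (*-monoˡ-≤ (0≤² c) (*-monoˡ-≤ (0≤w (T k)) (cauchy-schwarz B u))))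
        (≤-trans (≤-reflexive (eq₂ (c * c) (w k) (B · B) (u · u))) (≤-trans (*-monoʳ-≤ 0≤ε (norm (T k))) (≤-reflexive (*-identityˡ ε))))
        where
        B = b (T k)
        eq₁ : ∀ w c t → w * (c * t * (c * t)) ≡ c * c * (w * (t * t))
        eq₁ = solve-∀ ℚ-ring
        eq₂ : ∀ c w b u → c * (w * (b * u)) ≡ w * b * (c * u)
        eq₂ = solve-∀ ℚ-ring
      D' : ∀ k → D x' k ≡ D x k + (s k + ω k - # 2 * η)
      D' k = trans (cong₂ (λ t z → a - # 2 * (H * t) + w k * (z * z)) (E-step x u c u⊥x) (dev-step k x u c))
        (eq a H (E x) ε (w k) (dev k x) (c * g k))
        where
        eq : ∀ a H E ε w z g → a - # 2 * (H * (E + ε)) + w * ((z + g) * (z + g)) ≡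
             a - # 2 * (H * E) + w * (z * z) + (# 2 * (w * (z * g)) + w * (g * g) - # 2 * (H * ε))
        eq = solve-∀ ℚ-ring
      180≤180q : # 180 ≤ # 180 * q
      180≤180q = ≤-trans (≤-reflexive (sym (*-identityʳ (# 180)))) (*-monoˡ-≤ (0≤# 180) 1≤q)
      0≤ζ : ∀ x k → 0ℚ ≤ w k * (dev k x * dev k x)
      0≤ζ x k = 0≤* (0≤w (T k)) (0≤² (dev k x))
      180≤D : ∀ {x} k → E x ≤ ι N → # 180 ≤ D x k
      180≤D {x} k le = ≤-trans 180≤180q (≤-trans (slack-≤ _ (0≤ζ x k) (+-comm _ (# 180 * q))) (ζ≤D-180q k le))
      -- This is where N ≥ 4 enters: 8 q η = 720 q² ε / N, and the hypothesis of `^-step` needs it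
      -- below 180.
      4ν≤1 : # 4 * ν ≤ 1ℚ
      4ν≤1 = ≤-trans (*-monoʳ-≤ 0≤ν (#≤ι 4≤N)) (≤-reflexive Nν≡1)
      8qη≤180 : # 8 * (q * η) ≤ # 180
      8qη≤180 = slack-≤ (# 720 * (ν * (1ℚ - q * q * ε)) + # 180 * (1ℚ - # 4 * ν))
        (0≤+ (0≤* (0≤# 720) (0≤* 0≤ν (0≤- q²ε≤1))) (0≤* (0≤# 180) (0≤- 4ν≤1))) (eq q ν ε)
        where
        eq : ∀ q ν ε → # 180 ≡ # 8 * (q * (# 90 * q * ν * ε)) + (# 720 * (ν * (1ℚ - q * q * ε)) + # 180 * (1ℚ - # 4 * ν))
        eq = solve-∀ ℚ-ring
      bound : Fin m → ℚ
      bound k = p x k * (D x k + q * (s k + # 10 * q * ω k - η))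
      each : ∀ k → D x' k ^ suc r ≤ bound k
      each k = subst (λ t → t ^ suc r ≤ bound k) (sym (D' k))
        (^-step r {D x k} {w k * (dev k x * dev k x)} {ω k} {s k} {η}
          (≤-trans (slack-≤ (# 180 * q) (0≤* (0≤# 180) 0≤q) refl) (ζ≤D-180q k E≤N)) (0≤ω k) (0≤* 0≤H 0≤ε)
          (eq (w k) (dev k x) (c * g k)) (180≤D k E≤N)
          (≤-trans (*-monoˡ-≤ (0≤* 0≤q 0≤q) (ω≤ε k)) q²ε≤1) (≤-trans 8qη≤180 (180≤D k E≤N))
          (subst (0ℚ ≤_) (D' k) (≤-trans (0≤# 180) (180≤D k E'≤N))))
        where
        eq : ∀ w z g → # 2 * (w * (z * g)) * (# 2 * (w * (z * g))) ≡ # 4 * (w * (z * z) * (w * (g * g)))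
        eq = solve-∀ ℚ-ring
      P = sum (p x)
      S = slope x u
      R = sum (λ k → p x k * (w k * (g k * g k)))
      t₁ t₂ t₃ : Fin m → ℚ
      t₁ k = p x k * (w k * (dev k x * g k))
      t₂ k = p x k * (w k * (g k * g k))
      t₃ k = D x k ^ suc r
      total : sum bound ≡ (Φ x + (q * (# 2 * c)) * S) + ((q * (# 10 * q * (c * c))) * R + (- (q * η)) * P)
      total = begin
        sum bound ≡⟨ sum-cong (λ k → eq (D x k) (p x k) q (w k) (dev k x) c (g k) η) ⟩
        sum (λ k → (t₃ k + (q * (# 2 * c)) * t₁ k) + ((q * (# 10 * q * (c * c))) * t₂ k + (- (q * η)) * p x k))
          ≡⟨ sum-+ (λ k → t₃ k + (q * (# 2 * c)) * t₁ k) (λ k → (q * (# 10 * q * (c * c))) * t₂ k + (- (q * η)) * p x k) ⟩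
        sum (λ k → t₃ k + (q * (# 2 * c)) * t₁ k) + sum (λ k → (q * (# 10 * q * (c * c))) * t₂ k + (- (q * η)) * p x k)
          ≡⟨ cong₂ _+_ (trans (sum-+ t₃ (λ k → (q * (# 2 * c)) * t₁ k)) (cong (Φ x +_) (sum-* (q * (# 2 * c)) t₁)))
              (trans (sum-+ (λ k → (q * (# 10 * q * (c * c))) * t₂ k) (λ k → (- (q * η)) * p x k))
                (cong₂ _+_ (sum-* (q * (# 10 * q * (c * c))) t₂) (sum-* (- (q * η)) (p x)))) ⟩
        (Φ x + (q * (# 2 * c)) * S) + ((q * (# 10 * q * (c * c))) * R + (- (q * η)) * P) ∎
        where
        open ≡-Reasoning
        eq : ∀ D p q w z c g η → p * (D + q * (# 2 * (w * (z * (c * g))) + # 10 * q * (w * (c * g * (c * g))) - η)) ≡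
          (D * p + (q * (# 2 * c)) * (p * (w * (z * g)))) + ((q * (# 10 * q * (c * c))) * (p * (w * (g * g))) + (- (q * η)) * p)
        eq = solve-∀ ℚ-ring
      final : Φ x ≡ (Φ x + (q * (# 2 * c)) * S) + ((q * (# 10 * q * (c * c))) * R + (- (q * η)) * P) +
        q * (# 2 * (0ℚ - c * S) + # 10 * q * (c * c) * (ν * (# 9 * (P * u · u) - ι N * R)))
      final = trans (eq₀ (Φ x) (# 10 * (q * q * (c * c) * R))) (trans (cong (λ t → Φ x + # 10 * (q * q * (c * c) * R) * (1ℚ - t)) (sym Nν≡1))
        (eq (Φ x) q c S R P (u · u) (ι N) ν))
        where
        eq₀ : ∀ a b → a ≡ a + b * (1ℚ - 1ℚ)
        eq₀ = solve-∀ ℚ-ring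
        eq : ∀ Φ q c S R P u N ν → Φ + # 10 * (q * q * (c * c) * R) * (1ℚ - N * ν) ≡
          (Φ + (q * (# 2 * c)) * S) + ((q * (# 10 * q * (c * c))) * R + (- (q * (# 90 * q * ν * (c * c * u)))) * P) +
          q * (# 2 * (0ℚ - c * S) + # 10 * q * (c * c) * (ν * (# 9 * (P * u) - N * R)))
        eq = solve-∀ ℚ-ring

  opaque
    unfolding _·_

    -- Bounds E by N along the whole walk, however many steps it takes: each coordinate of A
    -- contributes at most 1 and the others have not moved.
    ·-bound-off : ∀ {n} (A : Subset n) (x x₀ : V n) → (∀ v → Box (x v)) → (∀ v → v ∉ A → x v ≡ x₀ v) →
                  x · x - x₀ · x₀ ≤ ι ∣ A ∣
    ·-bound-off A x x₀ box off = ≤-trans (+-monoˡ-≤ (- (x₀ · x₀)) (≤-trans (sum-mono-≤ pointwise)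
        (≤-reflexive (trans (sum-+ (λ v → x₀ v * x₀ v) (χ A)) (cong (x₀ · x₀ +_) (sum-χ A))))))
      (≤-reflexive (eq (x₀ · x₀) (ι ∣ A ∣)))
      where
      eq : ∀ a b → a + b - a ≡ b
      eq = solve-∀ ℚ-ring
      pointwise : ∀ v → x v * x v ≤ x₀ v * x₀ v + χ A v
      pointwise v with v ∈? A
      ... | yes p = ≤-trans (box-sq (box v)) (slack-≤ (x₀ v * x₀ v) (0≤² (x₀ v)) (trans (cong (x₀ v * x₀ v +_) (χ-∈ p)) (+-comm (x₀ v * x₀ v) 1ℚ)))
      ... | no  p = ≤-reflexive (trans (cong (λ t → t * t) (off v p)) (sym (trans (cong (x₀ v * x₀ v +_) (χ-∉ p)) (+-identityʳ (x₀ v * x₀ v)))))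

  decide : ∀ {P R : Set} → Dec P → (P → R) → (¬ P → R) → R
  decide (yes p) f g = f p
  decide (no ¬p) f g = g ¬p

  sign-for : ∀ s → ∃ λ σ → σ * σ ≡ 1ℚ × σ * s ≤ 0ℚ
  sign-for s with ≤-total s 0ℚ
  ... | inj₁ p = 1ℚ , refl , ≤-trans (≤-reflexive (*-identityˡ s)) p
  ... | inj₂ p = - 1ℚ , refl , ≤-trans (≤-reflexive (eq s)) (neg-antimono-≤ p)
    where
    eq : ∀ s → - 1ℚ * s ≡ - s
    eq = solve-∀ ℚ-ring

  perp-update : ∀ {n} {x y u : V n} {G} c → Perp (x ⊕ - 1ℚ ⋆ y) G → Perp u G → Perp ((x ⊕ c ⋆ u) ⊕ - 1ℚ ⋆ y) G
  perp-update c [] [] = []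
  perp-update {x = x} {y} {u} {g ∷ G} c (p ∷ ps) (q ∷ qs) = trans (·-linˡ (x ⊕ c ⋆ u) (- 1ℚ) y g)
    (trans (cong (λ t → t + - 1ℚ * y · g) (·-linˡ x c u g))
    (trans (eq (x · g) (c * u · g) (- 1ℚ * y · g))
    (trans (a+c0≡a (x · g + - 1ℚ * y · g) c q) (trans (sym (·-linˡ x (- 1ℚ) y g)) p)))) ∷ perp-update {x = x} {y} {u} c ps qs
    where
    eq : ∀ a b d → a + b + d ≡ a + d + b
    eq = solve-∀ ℚ-ring

  module Walk {n m : ℕ} (r : ℕ) (A₀ : Subset n) (4≤N : 4 ℕ.≤ ∣ A₀ ∣) (x₀ : V n) (G : List (V n))
              (8G≤N : 8 ℕ.* length G ℕ.≤ ∣ A₀ ∣) (T : Fin (suc m) → Test G) where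
    N : ℕ
    N = ∣ A₀ ∣
    open Potential r N 4≤N x₀ G T
    open Test

    record State (A : Subset n) (x : V n) : Set where
      field
        sub    : A ⊆ A₀
        box    : ∀ v → Box (x v)
        off    : ∀ v → v ∉ A₀ → x v ≡ x₀ v
        frozen : ∀ v → v ∈ A₀ → v ∉ A → Frozen (x v)
        perpG  : Perp (x ⊕ - 1ℚ ⋆ x₀) G
        pot    : Φ x ≤ ι (suc m) * a ^ suc r
        |A|≤N  : ∣ A ∣ ℕ.≤ N

      E≤N : E x ≤ ι N
      E≤N = ·-bound-off A₀ x x₀ box off

    -- `gain` is the termination measure. A step either freezes a coordinate, lowering |A|, or has
    -- full length 1/q, and then E grows by |u|²/q² ≥ 1/(9 q²).
    record Step (A : Subset n) (x : V n) : Set where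
      field
        {A′}   : Subset n
        {x′}   : V n
        state  : State A′ x′
        gain   : # 9 * (q * q) * (ι N - E x′) + ι ∣ A′ ∣ + 1ℚ ≤ # 9 * (q * q) * (ι N - E x) + ι ∣ A ∣

    step : ∀ {A x} → State A x → N ℕ.< 2 ℕ.* ∣ A ∣ → Step A x
    step {A} {x} st N<2A = finish search
      where
      open State st
      0<180q : 0ℚ < # 180 * q
      0<180q = 0<* {# 180} {q} (0<# 180) (0<ι (suc r))
      0<D : ∀ k → 0ℚ < D x k
      0<D k = <-≤-trans {0ℚ} {# 180 * q} {D x k} 0<180q (≤-trans {# 180 * q} {ζ + # 180 * q} {D x k}
        (slack-≤ {# 180 * q} {ζ + # 180 * q} ζ (0≤* (0≤w (T k)) (0≤² (dev k x))) (+-comm ζ (# 180 * q))) (ζ≤D-180q {x} k E≤N))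
        where ζ = weight (T k) * (dev k x * dev k x)
      -- More than N/2 coordinates are alive, at most N/8 dimensions go to G and one to x; N ≥ 4
      -- makes up for that one.
      room : ι N ≤ # 4 * (sum (χ A) - ι (suc (length G)))
      room = subst₂ (λ s t → ι N ≤ # 4 * (s - t)) (sym (sum-χ A)) (sym (ι-suc (length G))) (*-cancelˡ-≤ (0<# 2) (slack-≤
        (# 4 * (# 2 * ι ∣ A ∣ - (1ℚ + ι N)) + (ι N - # 8 * ι (length G)) + (ι N - # 4))
        (0≤+ (0≤+ (0≤* (0≤# 4) (0≤- (subst₂ _≤_ (ι-suc N) (ι-#* 2 ∣ A ∣) (ι-mono-≤ N<2A))))
          (0≤- (≤-trans (≤-reflexive (sym (ι-#* 8 (length G)))) (ι-mono-≤ 8G≤N)))) (0≤- (#≤ι 4≤N)))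
        (eq (ι N) (ι ∣ A ∣) (ι (length G)))))
        where
        eq : ∀ N a g → # 2 * (# 4 * (a - (1ℚ + g))) ≡ # 2 * N + (# 4 * (# 2 * a - (1ℚ + N)) + (N - # 8 * g) + (N - # 4))
        eq = solve-∀ ℚ-ring
      open Direction (direction (χ A) x G T N (p x) (χ-indicator A) 0<N
        (≤-trans (≤-reflexive (sum-χ A)) (ι-mono-≤ |A|≤N)) room (λ k → 0≤^ r (<⇒≤ (0<D k)))
        (<-≤-trans (0<^ r (0<D zero)) (term≤sum (λ k → 0≤^ r (<⇒≤ (0<D k))) zero)))
      sgn = sign-for (slope x u)
      σ = proj₁ sgn
      -- The longest step for which |u|² ≤ 1 guarantees q² ε ≤ 1, the step-size condition of
      -- `Φ-step`.
      δ = inv q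
      0≤δ = 0≤inv (0<ι (suc r))
      qδ≡1 : q * δ ≡ 1ℚ
      qδ≡1 = *-inv (λ z → <-irrefl (sym z) (0<ι (suc r)))
      u≡0 : ∀ v → v ∉ A → u v ≡ 0ℚ
      u≡0 v p = trans (sym (Supp.at u-supp v)) (trans (cong (_* u v) (χ-∉ p)) (*-zeroˡ (u v)))
      search = line-search x (λ v → σ * u v) 0≤δ box
      finish : (∃ λ t → 0ℚ ≤ t × t ≤ δ × (∀ v → Box (x v + t * (σ * u v))) ×
            (t ≡ δ ⊎ ∃ λ v → σ * u v ≢ 0ℚ × Frozen (x v + t * (σ * u v)))) → Step A x
      finish (t , 0≤t , t≤δ , box' , ev) = outcome ev
        where
        c = t * σ
        x' = x ⊕ c ⋆ u
        assoc : ∀ v → x v + t * (σ * u v) ≡ x' v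
        assoc v = cong (x v +_) (sym (*-assoc t σ (u v)))
        box″ : ∀ v → Box (x' v)
        box″ v = subst Box (assoc v) (box' v)
        stay : ∀ v → v ∉ A → x' v ≡ x v
        stay v p = trans (cong (λ z → x v + c * z) (u≡0 v p)) (trans (cong (x v +_) (*-zeroʳ c)) (+-identityʳ (x v)))
        off' : ∀ v → v ∉ A₀ → x' v ≡ x₀ v
        off' v p = trans (stay v (p ∘ sub)) (off v p)
        E'≤N : E x' ≤ ι N
        E'≤N = ·-bound-off A₀ x' x₀ box″ off'
        c² : c * c ≡ t * t
        c² = trans (eq t σ) (trans (cong (t * t *_) (proj₁ (proj₂ sgn))) (*-identityʳ (t * t)))
          where
          eq : ∀ t s → t * s * (t * s) ≡ t * t * (s * s)
          eq = solve-∀ ℚ-ring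
        qt≤1 : q * t ≤ 1ℚ
        qt≤1 = ≤-trans (*-monoˡ-≤ 0≤q t≤δ) (≤-reflexive qδ≡1)
        q²ε≤1 : q * q * (c * c * u · u) ≤ 1ℚ
        q²ε≤1 = ≤-trans (≤-reflexive (trans (cong (λ z → q * q * (z * u · u)) c²) (eq q t (u · u))))
          (*-mono-≤ (0≤² (q * t)) (<⇒≤ (positive⁻¹ 1ℚ)) (*-mono-≤ (0≤* 0≤q 0≤t) (<⇒≤ (positive⁻¹ 1ℚ)) qt≤1 qt≤1) u²≤1)
          where
          eq : ∀ q t u → q * q * (t * t * u) ≡ q * t * (q * t) * u
          eq = solve-∀ ℚ-ring
        down : c * slope x u ≤ 0ℚ
        down = ≤-trans (≤-reflexive (*-assoc t σ (slope x u))) (≤-trans (*-monoˡ-≤ 0≤t (proj₂ (proj₂ sgn))) (≤-reflexive (*-zeroʳ t)))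
        base : ∀ {A'} → A' ⊆ A → ∣ A' ∣ ℕ.≤ ∣ A ∣ → (∀ v → v ∈ A → v ∉ A' → Frozen (x' v)) → State A' x'
        base {A'} A'⊆A le fr = record
          { sub = sub ∘ A'⊆A ; box = box″ ; off = off' ; frozen = frozen'
          ; perpG = perp-update {x = x} {x₀} {u} c perpG u-⊥G
          ; pot = ≤-trans (Φ-step x u c u-⊥G u-⊥x E≤N E'≤N q²ε≤1 down energy) pot
          ; |A|≤N = ℕ.≤-trans le |A|≤N }
          where
          frozen' : ∀ v → v ∈ A₀ → v ∉ A' → Frozen (x' v)
          frozen' v v∈A₀ v∉A' = decide (v ∈? A) (λ v∈A → fr v v∈A v∉A')
            (λ v∉A → subst Frozen (sym (stay v v∉A)) (frozen v v∈A₀ v∉A))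
        E' : E x' ≡ E x + c * c * u · u
        E' = E-step x u c u-⊥x
        0≤9q² = 0≤* (0≤# 9) (0≤* 0≤q 0≤q)
        outcome : (t ≡ δ ⊎ ∃ λ v → σ * u v ≢ 0ℚ × Frozen (x v + t * (σ * u v))) → Step A x
        outcome (inj₁ t≡δ) = record
          { state = base {A} (λ z → z) ℕ.≤-refl (λ v v∈A v∉A → contradiction v∈A v∉A)
          ; gain = slack-≤ (# 9 * u · u - 1ℚ) (0≤- 1≤9u²) (trans (eq₀ (# 9 * (q * q) * (ι N - E x) + ι ∣ A ∣))
              (trans (cong (λ z → # 9 * (q * q) * (ι N - E x) + ι ∣ A ∣ + # 9 * u · u * (1ℚ - z)) (sym qt²))
              (trans (eq (q * q) (ι N) (E x) (ι ∣ A ∣) (u · u) (t * t)) (cong (λ z → # 9 * (q * q) * (ι N - z) + ι ∣ A ∣ + 1ℚ + (# 9 * u · u - 1ℚ))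
                (trans (cong (λ z → E x + z * u · u) (sym c²)) (sym E')))))) }
          where
          eq₀ : ∀ a → a ≡ a + # 9 * u · u * (1ℚ - 1ℚ)
          eq₀ a = trans (eq₁ a (u · u)) refl
            where
            eq₁ : ∀ a b → a ≡ a + # 9 * b * (1ℚ - 1ℚ)
            eq₁ = solve-∀ ℚ-ring
          qt² : q * q * (t * t) ≡ 1ℚ
          qt² = trans (eq₂ q t) (cong₂ _*_ qt≡1 qt≡1)
            where
            eq₂ : ∀ q t → q * q * (t * t) ≡ q * t * (q * t)
            eq₂ = solve-∀ ℚ-ring
            qt≡1 = trans (cong (q *_) t≡δ) qδ≡1
          eq : ∀ q N E A u t → # 9 * q * (N - E) + A + # 9 * u * (1ℚ - q * t) ≡ # 9 * q * (N - (E + t * u)) + A + 1ℚ + (# 9 * u - 1ℚ)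
          eq = solve-∀ ℚ-ring
        outcome (inj₂ (v , σu≢0 , fr)) = record
          { state = base {A ∖ v} (p─q⊆p A _) (ℕ.<⇒≤ less) fr'
          ; gain = slack-≤ (# 9 * (q * q) * (c * c * u · u) + (ι ∣ A ∣ - (1ℚ + ι ∣ A ∖ v ∣)))
              (0≤+ (0≤* 0≤9q² (0≤* (0≤² c) (0≤·self u))) (0≤- (subst (_≤ ι ∣ A ∣) (ι-suc ∣ A ∖ v ∣) (ι-mono-≤ less))))
              (trans (eq (# 9 * (q * q)) (ι N) (E x) (ι ∣ A ∣) (ι ∣ A ∖ v ∣) (c * c * u · u))
                (cong (λ z → # 9 * (q * q) * (ι N - z) + ι ∣ A ∖ v ∣ + 1ℚ + (# 9 * (q * q) * (c * c * u · u) + (ι ∣ A ∣ - (1ℚ + ι ∣ A ∖ v ∣)))) (sym E'))) }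
          where
          v∈A : v ∈ A
          v∈A = decide (v ∈? A) (λ p → p) (λ p → contradiction (trans (cong (σ *_) (u≡0 v p)) (*-zeroʳ σ)) σu≢0)
          less = x∈p⇒∣p-x∣<∣p∣ v∈A
          fr' : ∀ w → w ∈ A → w ∉ A ∖ v → Frozen (x' w)
          fr' w w∈A w∉ = decide (w Fin.≟ v) (λ w≡v → subst (λ z → Frozen (x' z)) (sym w≡v) (subst Frozen (assoc v) fr))
            (λ w≢v → contradiction (x∈p∧x≢y⇒x∈p-y w∈A w≢v) w∉)
          eq : ∀ q N E A A' ε → q * (N - E) + A ≡ q * (N - (E + ε)) + A' + 1ℚ + (q * ε + (A - (1ℚ + A')))
          eq = solve-∀ ℚ-ring

    walk : ∀ fuel {A x} → State A x → # 9 * (q * q) * (ι N - E x) + ι ∣ A ∣ ≤ ι fuel →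
           ∃ λ A′ → ∃ λ x′ → State A′ x′ × 2 ℕ.* ∣ A′ ∣ ℕ.≤ N
    continue : ∀ fuel {A x} → State A x → # 9 * (q * q) * (ι N - E x) + ι ∣ A ∣ ≤ ι fuel → Dec (2 ℕ.* ∣ A ∣ ℕ.≤ N) →
           ∃ λ A′ → ∃ λ x′ → State A′ x′ × 2 ℕ.* ∣ A′ ∣ ℕ.≤ N
    walk fuel {A} st le = continue fuel st le (2 ℕ.* ∣ A ∣ ℕ.≤? N)
    continue fuel {A} {x} st le (yes p) = A , x , st , p
    -- The measure is at least |A|, so without fuel nothing is alive, and the alive set has
    -- certainly been halved.
    continue zero {A} {x} st le (no ¬p) = contradiction (ℕ.≤-trans (ℕ.≤-reflexive (trans (cong (2 ℕ.*_) |A|≡0) refl)) ℕ.z≤n) ¬p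
      where
      |A|≡0 : ∣ A ∣ ≡ 0
      |A|≡0 = ℕ.n≤0⇒n≡0 (ι-cancel-≤ {∣ A ∣} {0} (≤-trans (slack-≤ (# 9 * (q * q) * (ι N - E x))
        (0≤* (0≤* (0≤# 9) (0≤* 0≤q 0≤q)) (0≤- (State.E≤N st))) (+-comm _ (ι ∣ A ∣))) le))
    continue (suc fuel) {A} {x} st le (no ¬p) = walk fuel state (+-cancel (≤-trans gain (≤-trans le (≤-reflexive (trans (ι-suc fuel) (+-comm 1ℚ (ι fuel)))))))
      where
      open Step (step st (ℕ.≰⇒> ¬p))
      +-cancel : ∀ {a b} → a + 1ℚ ≤ b + 1ℚ → a ≤ b
      +-cancel {a} {b} le = subst₂ _≤_ (eq a) (eq b) (+-monoˡ-≤ (- 1ℚ) le)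
        where
        eq : ∀ a → a + 1ℚ + - 1ℚ ≡ a
        eq = solve-∀ ℚ-ring

    record PartialColouring : Set where
      field
        A′     : Subset n
        x′     : V n
        sub    : A′ ⊆ A₀
        half   : 2 ℕ.* ∣ A′ ∣ ℕ.≤ N
        box    : ∀ v → Box (x′ v)
        off    : ∀ v → v ∉ A₀ → x′ v ≡ x₀ v
        frozen : ∀ v → v ∈ A₀ → v ∉ A′ → Frozen (x′ v)
        perpG  : Perp (x′ ⊕ - 1ℚ ⋆ x₀) G
        small  : ∀ k → weight (T k) * (dev k x′ * dev k x′) ≤ # 720 * q

    start : (∀ v → Box (x₀ v)) → State A₀ x₀
    start box₀ = record
      { sub = λ z → z ; box = box₀ ; off = λ _ _ → refl ; frozen = λ v p ¬p → contradiction p ¬p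
      ; perpG = ⊥G G ; pot = ≤-reflexive (trans (sum-cong (λ k → cong (_^ suc r) (D₀ k))) (sum-const (suc m) (a ^ suc r)))
      ; |A|≤N = ℕ.≤-refl }
      where
      eq : ∀ c → c + - 1ℚ * c ≡ 0ℚ
      eq = solve-∀ ℚ-ring
      ⊥G : ∀ G → Perp (x₀ ⊕ - 1ℚ ⋆ x₀) G
      ⊥G []      = []
      ⊥G (g ∷ G) = trans (·-linˡ x₀ (- 1ℚ) x₀ g) (eq (x₀ · g)) ∷ ⊥G G
      D₀ : ∀ k → D x₀ k ≡ a
      D₀ k = trans (cong (λ t → a - # 2 * (H * E x₀) + weight (T k) * (t * t))
          (trans (·-linʳ (f (T k)) x₀ (- 1ℚ) x₀) (eq (f (T k) · x₀))))
        (eq₂ a H (x₀ · x₀) (weight (T k)))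
        where
        eq₂ : ∀ a H E w → a - # 2 * (H * (E - E)) + w * (0ℚ * 0ℚ) ≡ a
        eq₂ = solve-∀ ℚ-ring

    -- The potential starts at (m + 1) a^q ≤ (2 a)^q and never increases, so each D is at most 2 a =
    -- 720 q at the end.
    partial-colouring : (∀ v → Box (x₀ v)) → suc m ℕ.≤ 2 ℕ.^ suc r → PartialColouring
    partial-colouring box₀ m<2^q = conclude (walk fuel (start box₀) enough)
      where
      fuel = 9 ℕ.* (suc r ℕ.* suc r) ℕ.* N ℕ.+ N
      enough : # 9 * (q * q) * (ι N - E x₀) + ι N ≤ ι fuel
      enough = ≤-reflexive (trans (cong (λ t → # 9 * (q * q) * t + ι N) (eq (ι N) (x₀ · x₀))) (sym
        (trans (ι-+ (9 ℕ.* (suc r ℕ.* suc r) ℕ.* N) N) (cong (_+ ι N) (trans (ι-* (9 ℕ.* (suc r ℕ.* suc r)) N)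
          (cong (_* ι N) (trans (ι-#* 9 (suc r ℕ.* suc r)) (cong (# 9 *_) (ι-* (suc r) (suc r))))))))))
        where
        eq : ∀ N z → N - (z - z) ≡ N
        eq = solve-∀ ℚ-ring
      0≤a = 0≤* (0≤# 360) 0≤q
      conclude : (∃ λ A′ → ∃ λ x′ → State A′ x′ × 2 ℕ.* ∣ A′ ∣ ℕ.≤ N) → PartialColouring
      conclude (A′ , x′ , st , half) = record
        { A′ = A′ ; x′ = x′ ; sub = S.sub ; half = half ; box = S.box ; off = S.off ; frozen = S.frozen ; perpG = S.perpG ; small = small }
        where
        module S = State st
        0≤ζ : ∀ k → 0ℚ ≤ weight (T k) * (dev k x′ * dev k x′)
        0≤ζ k = 0≤* (0≤w (T k)) (0≤² (dev k x′))
        ζ≤D : ∀ k → weight (T k) * (dev k x′ * dev k x′) ≤ D x′ k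
        ζ≤D k = ≤-trans (slack-≤ (# 180 * q) (0≤* (0≤# 180) 0≤q) refl) (ζ≤D-180q {x′} k S.E≤N)
        D≤ : ∀ k → D x′ k ^ suc r ≤ (# 2 * a) ^ suc r
        D≤ k = ≤-trans (term≤sum (λ k → 0≤^ (suc r) (≤-trans (0≤ζ k) (ζ≤D k))) k)
          (≤-trans S.pot (≤-trans (*-monoʳ-≤ (0≤^ (suc r) 0≤a) (ι-mono-≤ m<2^q))
            (≤-reflexive (trans (cong (_* a ^ suc r) (trans (ι-^ 2 (suc r)) (cong (_^ suc r) (ι≡# 2)))) (sym (^-distrib-* (# 2) a (suc r)))))))
        small : ∀ k → weight (T k) * (dev k x′ * dev k x′) ≤ # 720 * q
        small k = ≤-trans (ζ≤D k) (≤-trans (^-cancel-≤ r (0≤* (0≤# 2) 0≤a) (D≤ k)) (≤-reflexive (eq q)))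
          where
          eq : ∀ q → # 2 * (# 360 * q) ≡ # 720 * q
          eq = solve-∀ ℚ-ring

  -- Rounding

  ∈-allVecs : ∀ {A : Set} (xs : List A) → (∀ a → a ∈ₗ xs) → ∀ {n} (v : Vec A n) → v ∈ₗ allVecs xs n
  ∈-allVecs xs all []      = here refl
  ∈-allVecs xs all (a ∷ v) = ∈-cartesianProductWith⁺ _∷_ (all a) (∈-allVecs xs all v)

  ∈-subsets : ∀ {n} (J : Subset n) → J ∈ₗ subsets n
  ∈-subsets = ∈-allVecs _ (λ { true → here refl ; false → there (here refl) })

  ∈-colourings : ∀ {n} (x : Colouring n) → x ∈ₗ colourings n
  ∈-colourings = ∈-allVecs _ (λ { Sign.+ → here refl ; Sign.- → there (here refl) })

  herdisc-colouring : ∀ {n} (𝓕 : SetSystem n) (J : Subset n) →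
    ∃ λ (x : Colouring n) → ∀ {F} → F ∈ₗ 𝓕 → ℤ.∣ colourSum x (F ∩ J) ∣ ℕ.≤ herdisc 𝓕
  herdisc-colouring {n} 𝓕 J = x , λ {F} F∈𝓕 → ℕ.≤-trans
      (All.lookup (xs≤max 0 (map value (map (_∩ J) 𝓕))) (∈-map⁺ value (∈-map⁺ (_∩ J) F∈𝓕)))
      (ℕ.≤-trans (ℕ.≤-reflexive (sym eq))
        (All.lookup (xs≤max 0 (map (λ J → disc (𝓕 Defs.∣ J)) (subsets n))) (∈-map⁺ (λ J → disc (𝓕 Defs.∣ J)) (∈-subsets J))))
    where
    attained : ∃ λ x → disc (𝓕 Defs.∣ J) ≡ discOf (𝓕 Defs.∣ J) x
    attained with argmin-sel id (discOf (𝓕 Defs.∣ J) (replicate n Sign.+)) (map (discOf (𝓕 Defs.∣ J)) (colourings n))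
    ... | inj₁ p = replicate n Sign.+ , p
    ... | inj₂ p = let y , _ , q = ∈-map⁻ (discOf (𝓕 Defs.∣ J)) p in y , q
    x  = proj₁ attained
    eq = proj₂ attained
    value : Subset n → ℕ
    value F = ℤ.∣ colourSum x F ∣

  herdisc-≤ : ∀ {n} (𝓕 : SetSystem n) {B} →
    (∀ J → ∃ λ (x : Colouring n) → ∀ {F} → F ∈ₗ 𝓕 → ℤ.∣ colourSum x (F ∩ J) ∣ ℕ.≤ B) → herdisc 𝓕 ℕ.≤ B
  herdisc-≤ {n} 𝓕 {B} good = max≤v⁺ ℕ.z≤n (All.map⁺ {xs = subsets n} (All.tabulate λ {J} _ → bound J))
    where
    bound : ∀ J → disc (𝓕 Defs.∣ J) ℕ.≤ B
    bound J = let x , ok = good J in ℕ.≤-trans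
      (All.lookup (min≤xs _ (map (discOf (𝓕 Defs.∣ J)) (colourings n))) (∈-map⁺ (discOf (𝓕 Defs.∣ J)) (∈-colourings x)))
      (max≤v⁺ ℕ.z≤n (All.map⁺ (All.map⁺ (All.tabulate ok))))

  opaque
    unfolding ι

    j : ℤ → ℚ
    j z = mkℚ z 0 (Coprime.sym (Coprime.1-coprimeTo ℤ.∣ z ∣))

    j-ι : ∀ n → j (ℤ.+ n) ≡ ι n
    j-ι n = refl

    j-+ : ∀ a b → j (a ℤ.+ b) ≡ j a + j b
    j-+ a b = toℚᵘ-injective (ℚᵘ.≃-trans (ℚᵘ.*≡* (cong (ℤ._* ℤ.+ 1) (sym (cong₂ ℤ._+_ (ℤ.*-identityʳ a) (ℤ.*-identityʳ b)))))
      (ℚᵘ.≃-sym (toℚᵘ-homo-+ (j a) (j b))))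

    j-* : ∀ a b → j (a ℤ.* b) ≡ j a * j b
    j-* a b = toℚᵘ-injective (ℚᵘ.≃-trans (ℚᵘ.*≡* refl) (ℚᵘ.≃-sym (toℚᵘ-homo-* (j a) (j b))))

    j-neg : ∀ a → j (ℤ.- a) ≡ - j a
    j-neg a = toℚᵘ-injective (ℚᵘ.≃-trans (ℚᵘ.*≡* refl) (ℚᵘ.≃-sym (toℚᵘ-homo‿- (j a))))

    j-cancel-< : ∀ {a b} → j a < j b → a ℤ.< b
    j-cancel-< {a} {b} (*<* p) = subst₂ ℤ._<_ (ℤ.*-identityʳ a) (ℤ.*-identityʳ b) p

    j-mono-≤ : ∀ {a b} → a ℤ.≤ b → j a ≤ j b
    j-mono-≤ {a} {b} p = *≤* (subst₂ ℤ._≤_ (sym (ℤ.*-identityʳ a)) (sym (ℤ.*-identityʳ b)) p)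

    j-0 : j ℤ.0ℤ ≡ 0ℚ
    j-0 = refl

    j-↥ : ∀ p → p * ι (↧ₙ p) ≡ j (↥ p)
    j-↥ p@(mkℚ z d-1 _) = toℚᵘ-injective (ℚᵘ.≃-trans (toℚᵘ-homo-* p (ι (suc d-1))) (ℚᵘ.*≡* eq))
      where
      eq : z ℤ.* ℤ.+ suc d-1 ℤ.* ℤ.+ 1 ≡ z ℤ.* ℤ.+ (suc d-1 ℕ.* 1)
      eq = trans (ℤ.*-identityʳ (z ℤ.* ℤ.+ suc d-1)) (cong (λ t → z ℤ.* ℤ.+ t) (sym (ℕ.*-identityʳ (suc d-1))))

    j-injective : ∀ {a b} → j a ≡ j b → a ≡ b
    j-injective refl = refl

  ⌊_⌋ᶻ : ∀ y → ∃ λ a → j a ≤ y × y < j a + 1ℚ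
  ⌊ y ⌋ᶻ = a , *-cancelʳ-≤-pos d {{positive 0<d}} (slack-≤ (ι r) (0≤ι r) eq₁) ,
    *-cancelʳ-<-nonNeg d {{nonNegative (<⇒≤ 0<d)}} (slack-< (d - ι r) (0<- (ι-mono-< (ℤ.n%ℕd<d (↥ y) (↧ₙ y)))) (trans (eq₂ (j a) d (ι r)) (cong (_+ (d - ι r)) (sym eq))))
    where
    a = ↥ y ℤ./ℕ ↧ₙ y
    r = ↥ y ℤ.%ℕ ↧ₙ y
    d = ι (↧ₙ y)
    0<d : 0ℚ < d
    0<d = 0<ι (↧ₙ y)
    eq : y * d ≡ ι r + j a * d
    eq = trans (j-↥ y) (trans (cong j (ℤ.a≡a%ℕn+[a/ℕn]*n (↥ y) (↧ₙ y))) (trans (j-+ (ℤ.+ r) (a ℤ.* ↧ y))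
      (cong₂ _+_ (j-ι r) (trans (j-* a (↧ y)) (cong (j a *_) (j-ι (↧ₙ y)))))))
    eq₁ : y * d ≡ j a * d + ι r
    eq₁ = trans eq (+-comm (ι r) (j a * d))
    eq₂ : ∀ a d r → (a + 1ℚ) * d ≡ r + a * d + (d - r)
    eq₂ = solve-∀ ℚ-ring

  j-small : ∀ {a} → - 1ℚ < j a → j a < 1ℚ → a ≡ ℤ.0ℤ
  j-small {a} lo hi = squeezed a (j-cancel-< (subst (_< j a) (sym (trans (j-neg (ℤ.+ 1)) (cong -_ j-1))) lo)) (j-cancel-< (subst (j a <_) (sym j-1) hi))
    where
    j-1 : j (ℤ.+ 1) ≡ 1ℚ
    j-1 = trans (j-ι 1) (ι≡# 1)
    squeezed : ∀ a → ℤ.-1ℤ ℤ.< a → a ℤ.< ℤ.1ℤ → a ≡ ℤ.0ℤ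
    squeezed (ℤ.+ 0)           _                _              = refl
    squeezed (ℤ.+ suc n)       _                (ℤ.+<+ (ℕ.s≤s ()))
    squeezed (ℤ.-[1+ n ])      (ℤ.-<- ())       _

  Within : ℚ → ℚ → Set
  Within B X = - B ≤ X × X ≤ B

  within-+ : ∀ {A B X Y} → Within A X → Within B Y → Within (A + B) (X + Y)
  within-+ {A} {B} {X} {Y} (p , q) (p' , q') = ≤-trans (≤-reflexive (eq A B)) (+-mono-≤ p p') , +-mono-≤ q q'
    where
    eq : ∀ A B → - (A + B) ≡ - A + - B
    eq = solve-∀ ℚ-ring

  within-* : ∀ {c B X} → 0ℚ ≤ c → Within B X → Within (c * B) (c * X)
  within-* {c} {B} 0≤c (p , q) = ≤-trans (≤-reflexive (eq c B)) (*-monoˡ-≤ 0≤c p) , *-monoˡ-≤ 0≤c q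
    where
    eq : ∀ c B → - (c * B) ≡ c * - B
    eq = solve-∀ ℚ-ring

  within-mono : ∀ {A B X} → A ≤ B → Within A X → Within B X
  within-mono A≤B (p , q) = ≤-trans (neg-antimono-≤ A≤B) p , ≤-trans q A≤B

  within-neg : ∀ {B X} → Within B X → Within B (- X)
  within-neg {B} (p , q) = neg-antimono-≤ q , ≤-trans (neg-antimono-≤ p) (≤-reflexive (eq B))
    where
    eq : ∀ B → - - B ≡ B
    eq = solve-∀ ℚ-ring

  within-cancel : ∀ {c B X} → 0ℚ < c → Within (c * B) (c * X) → Within B X
  within-cancel {c} {B} 0<c (p , q) = *-cancelˡ-≤ 0<c (≤-trans (≤-reflexive (eq c B)) p) , *-cancelˡ-≤ 0<c q
    where
    eq : ∀ c B → c * - B ≡ - (c * B)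
    eq = solve-∀ ℚ-ring

  within-j : ∀ {h} z → ℤ.∣ z ∣ ℕ.≤ h → Within (ι h) (j z)
  within-j {h} z le = subst (_≤ j z) (trans (j-neg (ℤ.+ h)) (cong -_ (j-ι h))) (j-mono-≤ (lower z le)) ,
    subst (j z ≤_) (j-ι h) (j-mono-≤ (upper z le))
    where
    lower : ∀ z → ℤ.∣ z ∣ ℕ.≤ h → ℤ.- (ℤ.+ h) ℤ.≤ z
    lower (ℤ.+ n)      le = ℤ.≤-trans (ℤ.neg-mono-≤ (ℤ.+≤+ ℕ.z≤n)) (ℤ.+≤+ ℕ.z≤n)
    lower (ℤ.-[1+ n ]) le = ℤ.neg-mono-≤ (ℤ.+≤+ le)
    upper : ∀ z → ℤ.∣ z ∣ ℕ.≤ h → z ℤ.≤ ℤ.+ h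
    upper (ℤ.+ n)      le = ℤ.+≤+ le
    upper (ℤ.-[1+ n ]) le = ℤ.-≤+

  jv : ∀ {n} → (Fin n → ℤ) → V n
  jv z v = j (z v)

  odd : ℤ → Bool
  odd a = 0 ℕ.<ᵇ (a ℤ.%ℕ 2)

  -- The colour of an odd coordinate decides whether its half is rounded up or down; even
  -- coordinates are halved exactly.
  carry digit : ℤ → Sign → ℤ
  carry a s = if odd a then up s else ℤ.0ℤ
    where
    up : Sign → ℤ
    up Sign.+ = ℤ.1ℤ
    up Sign.- = ℤ.0ℤ
  digit a s = if odd a then s ◃ 1 else ℤ.0ℤ

  halve : ℤ → Sign → ℤ
  halve a s = a ℤ./ℕ 2 ℤ.+ carry a s

  halve-digit : ∀ a s → a ≡ halve a s ℤ.+ halve a s ℤ.- digit a s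
  halve-digit a s = trans (ℤ.a≡a%ℕn+[a/ℕn]*n a 2) (go (a ℤ.%ℕ 2) refl (ℤ.n%ℕd<d a 2) s)
    where
    c = a ℤ./ℕ 2
    carry-odd : ∀ s {m} → a ℤ.%ℕ 2 ≡ suc m → ∃ λ t → carry a s ≡ t × (ℤ.+ 1 ≡ t ℤ.+ t ℤ.- digit a s)
    carry-odd Sign.+ eq rewrite eq = ℤ.1ℤ , refl , refl
    carry-odd Sign.- eq rewrite eq = ℤ.0ℤ , refl , refl
    carry-even : ∀ s → a ℤ.%ℕ 2 ≡ 0 → carry a s ≡ ℤ.0ℤ × digit a s ≡ ℤ.0ℤ
    carry-even s eq rewrite eq = refl , refl
    eq₁ : ∀ t d c → t ℤ.+ t ℤ.- d ℤ.+ c ℤ.* ℤ.+ 2 ≡ (c ℤ.+ t) ℤ.+ (c ℤ.+ t) ℤ.- d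
    eq₁ = solve-∀ℤ
    eq₂ : ∀ c → ℤ.+ 0 ℤ.+ c ℤ.* ℤ.+ 2 ≡ (c ℤ.+ ℤ.0ℤ) ℤ.+ (c ℤ.+ ℤ.0ℤ) ℤ.- ℤ.0ℤ
    eq₂ = solve-∀ℤ
    go : ∀ r → a ℤ.%ℕ 2 ≡ r → r ℕ.< 2 → ∀ s → ℤ.+ (a ℤ.%ℕ 2) ℤ.+ c ℤ.* ℤ.+ 2 ≡ halve a s ℤ.+ halve a s ℤ.- digit a s
    go 0 eq _ s = let ce , de = carry-even s eq in trans (cong (λ r → ℤ.+ r ℤ.+ c ℤ.* ℤ.+ 2) eq) (trans (eq₂ c)
      (cong₂ (λ x y → (c ℤ.+ x) ℤ.+ (c ℤ.+ x) ℤ.- y) (sym ce) (sym de)))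
    go 1 eq _ s = let t , ct , one = carry-odd s eq in trans (cong (λ r → ℤ.+ r ℤ.+ c ℤ.* ℤ.+ 2) eq)
      (trans (cong (λ o → o ℤ.+ c ℤ.* ℤ.+ 2) one) (trans (eq₁ t (digit a s) c) (cong (λ x → (c ℤ.+ x) ℤ.+ (c ℤ.+ x) ℤ.- digit a s) (sym ct))))
    go (suc (suc r)) eq (ℕ.s≤s (ℕ.s≤s ())) s

  j-foldr : ∀ {n} (t : Fin n → ℤ) → j (Vector.foldr ℤ._+_ ℤ.0ℤ t) ≡ sum (λ v → j (t v))
  j-foldr {zero}  t = j-0
  j-foldr {suc n} t = trans (j-+ (t zero) _) (cong (j (t zero) +_) (j-foldr (t ∘ suc)))

  opaque
    unfolding _·_

    j-colourSum : ∀ {n} (F : Subset n) (o : Fin n → Bool) (x : Colouring n) →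
      j (colourSum x (F ∩ tabulate o)) ≡ χ F · jv (λ v → if o v then lookup x v ◃ 1 else ℤ.0ℤ)
    j-colourSum F o x = trans (j-foldr (λ v → if lookup (F ∩ tabulate o) v then lookup x v ◃ 1 else ℤ.0ℤ)) (sum-cong λ v → trans
      (cong (λ b → j (if b then lookup x v ◃ 1 else ℤ.0ℤ)) (trans (lookup-zipWith _∧_ v F (tabulate o)) (cong (lookup F v ∧_) (lookup∘tabulate o v))))
      (go (lookup F v) (o v) (lookup x v ◃ 1)))
      where
      go : ∀ f b z → j (if f ∧ b then z else ℤ.0ℤ) ≡ (if f then 1ℚ else 0ℚ) * j (if b then z else ℤ.0ℤ)
      go true  b z = sym (*-identityˡ (j (if b then z else ℤ.0ℤ)))
      go false b z = trans j-0 (sym (*-zeroˡ (j (if b then z else ℤ.0ℤ))))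

    ·-0≤ : ∀ {n} (F : Subset n) {y : V n} → (∀ v → 0ℚ ≤ y v) → 0ℚ ≤ χ F · y
    ·-0≤ F {y} p = 0≤sum λ v → go (χ-indicator F v) (p v)
      where
      go : ∀ {c a} → c ≡ 0ℚ ⊎ c ≡ 1ℚ → 0ℚ ≤ a → 0ℚ ≤ c * a
      go {a = a} (inj₁ refl) p = ≤-reflexive (sym (*-zeroˡ a))
      go {a = a} (inj₂ refl) p = ≤-trans p (≤-reflexive (sym (*-identityˡ a)))

    ·-≤n : ∀ {n} (F : Subset n) {y : V n} → (∀ v → 0ℚ ≤ y v × y v ≤ 1ℚ) → χ F · y ≤ ι n
    ·-≤n {n} F {y} p = ≤-trans (sum-mono-≤ λ v → ≤-trans (01*-≤ (χ-indicator F v) (proj₁ (p v))) (proj₂ (p v)))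
      (≤-reflexive (trans (sum-const n 1ℚ) (*-identityʳ (ι n))))

  ·-halve : ∀ {n} (f : V n) (a b s : Fin n → ℤ) → (∀ v → a v ≡ b v ℤ.+ b v ℤ.- s v) →
            f · jv a ≡ # 2 * f · jv b - f · jv s
  ·-halve f a b s eq = trans (·-cong (λ _ → refl) pointwise) (trans (·-linʳ f (jv b ⊕ 1ℚ ⋆ jv b) (- 1ℚ) (jv s))
      (trans (cong (_+ - 1ℚ * f · jv s) (·-linʳ f (jv b) 1ℚ (jv b))) (eq₂ (f · jv b) (f · jv s))))
    where
    eq₂ : ∀ b s → b + 1ℚ * b + - 1ℚ * s ≡ # 2 * b - s
    eq₂ = solve-∀ ℚ-ring
    eq₁ : ∀ b s → b + b - s ≡ b + 1ℚ * b + - 1ℚ * s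
    eq₁ = solve-∀ ℚ-ring
    pointwise : ∀ v → j (a v) ≡ j (b v) + 1ℚ * j (b v) + - 1ℚ * j (s v)
    pointwise v = trans (cong j (eq v)) (trans (j-+ (b v ℤ.+ b v) (ℤ.- s v)) (trans (cong₂ _+_ (j-+ (b v) (b v)) (j-neg (s v))) (eq₁ (j (b v)) (j (s v)))))

  -- Rounding away the last binary digit of a costs one colouring of the odd coordinates.
  round-bits : ∀ {n} (𝓕 : SetSystem n) d (a : Fin n → ℤ) →
    ∃ λ (z : Fin n → ℤ) → (∀ v → a v ≡ ℤ.0ℤ → z v ≡ ℤ.0ℤ) ×
      (∀ {F} → F ∈ₗ 𝓕 → Within ((ι (2 ℕ.^ d) - 1ℚ) * ι (herdisc 𝓕)) (χ F · jv a - ι (2 ℕ.^ d) * χ F · jv z))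
  round-bits 𝓕 zero a = a , (λ _ p → p) , λ {F} _ → subst₂ (λ k X → Within ((k - 1ℚ) * h) X) (sym (ι≡# 1))
      (trans (eq₂ (χ F · jv a)) (cong (λ t → χ F · jv a - t * χ F · jv a) (sym (ι≡# 1))))
      (≤-reflexive (eq₃ h) , ≤-reflexive (sym (eq₄ h)))
    where
    h = ι (herdisc 𝓕)
    eq₂ : ∀ x → 0ℚ ≡ x - 1ℚ * x
    eq₂ = solve-∀ ℚ-ring
    eq₃ : ∀ h → - ((1ℚ - 1ℚ) * h) ≡ 0ℚ
    eq₃ = solve-∀ ℚ-ring
    eq₄ : ∀ h → (1ℚ - 1ℚ) * h ≡ 0ℚ
    eq₄ = solve-∀ ℚ-ring
  round-bits {n} 𝓕 (suc d) a = conclude (herdisc-colouring 𝓕 (tabulate (λ v → odd (a v))))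
    where
    h = ι (herdisc 𝓕)
    P = ι (2 ℕ.^ d)
    conclude : (∃ λ x → ∀ {F} → F ∈ₗ 𝓕 → ℤ.∣ colourSum x (F ∩ tabulate (λ v → odd (a v))) ∣ ℕ.≤ herdisc 𝓕) → _
    conclude (x , ok) = rest (round-bits 𝓕 d b)
      where
      b s : Fin n → ℤ
      b v = halve (a v) (lookup x v)
      s v = digit (a v) (lookup x v)
      b-zero : ∀ v → a v ≡ ℤ.0ℤ → b v ≡ ℤ.0ℤ
      b-zero v p = trans (cong (λ t → halve t (lookup x v)) p) refl
      eq : ∀ A B S P Z → A ≡ # 2 * B - S → A - # 2 * P * Z ≡ # 2 * (B - P * Z) + - S
      eq A B S P Z refl = eq' B S P Z
        where
        eq' : ∀ B S P Z → # 2 * B - S - # 2 * P * Z ≡ # 2 * (B - P * Z) + - S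
        eq' = solve-∀ ℚ-ring
      eq₂ : ∀ P h → # 2 * ((P - 1ℚ) * h) + h ≡ (# 2 * P - 1ℚ) * h
      eq₂ = solve-∀ ℚ-ring
      rest : _ → _
      -- The error of the remaining digits doubles and the colouring adds one h: 2 (2^d - 1) + 1 =
      -- 2^(d+1) - 1.
      rest (z , z-zero , close) = z , (λ v → z-zero v ∘ b-zero v) , λ {F} F∈𝓕 →
        subst₂ Within (trans (eq₂ P h) (cong (λ t → (t - 1ℚ) * h) (sym (ι-#* 2 (2 ℕ.^ d)))))
          (trans (sym (eq (χ F · jv a) (χ F · jv b) (χ F · jv s) P (χ F · jv z) (·-halve (χ F) a b s (λ v → halve-digit (a v) (lookup x v)))))
            (cong (λ t → χ F · jv a - t * χ F · jv z) (sym (ι-#* 2 (2 ℕ.^ d)))))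
          (within-+ (within-* (0≤# 2) (close F∈𝓕)) (within-neg (subst (Within h) (j-colourSum F (λ v → odd (a v)) x) (within-j _ (ok F∈𝓕)))))

  n≤2^n : ∀ n → n ℕ.≤ 2 ℕ.^ n
  n≤2^n zero    = ℕ.z≤n
  n≤2^n (suc n) = ℕ.≤-trans (ℕ.+-mono-≤ (ℕ.m^n>0 2 n) (n≤2^n n)) (ℕ.+-monoʳ-≤ (2 ℕ.^ n) (ℕ.m≤m+n (2 ℕ.^ n) 0))

  -- Keeping n binary digits suffices: in units of 2^(-n), cutting off the others changes a set's
  -- sum by at most n ≤ 2^n, hence by at most 1 in total, which is the `suc`. Zero coordinates stay
  -- zero, so the integer point keeps the support of y.
  round-to-ℤ : ∀ {n} (𝓕 : SetSystem n) (y : V n) →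
    ∃ λ (z : Fin n → ℤ) → (∀ v → y v ≡ 0ℚ → z v ≡ ℤ.0ℤ) ×
      (∀ {F} → F ∈ₗ 𝓕 → Within (ι (suc (herdisc 𝓕))) (χ F · (y ⊕ - 1ℚ ⋆ jv z)))
  round-to-ℤ {n} 𝓕 y = conclude (round-bits 𝓕 n a)
    where
    h = ι (herdisc 𝓕)
    P = ι (2 ℕ.^ n)
    1≤2^n = ℕ.m^n>0 2 n
    0<P : 0ℚ < P
    0<P = <-≤-trans (0<# 1) (#≤ι 1≤2^n)
    a : Fin n → ℤ
    a v = proj₁ ⌊ P * y v ⌋ᶻ
    ρ : V n
    ρ v = P * y v + - 1ℚ * j (a v)
    zv : V n
    zv _ = 0ℚ
    a-zero : ∀ v → y v ≡ 0ℚ → a v ≡ ℤ.0ℤ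
    a-zero v p = j-small
      (+-cancel (subst (_< j (a v) + 1ℚ) Py≡0 (proj₂ (proj₂ ⌊ P * y v ⌋ᶻ))))
      (≤-<-trans (subst (j (a v) ≤_) Py≡0 (proj₁ (proj₂ ⌊ P * y v ⌋ᶻ))) (0<# 1))
      where
      Py≡0 = trans (cong (P *_) p) (*-zeroʳ P)
      +-cancel : ∀ {x} → 0ℚ < x + 1ℚ → - 1ℚ < x
      +-cancel {x} lt = slack-< (x + 1ℚ) lt (eq x)
        where
        eq : ∀ x → x ≡ - 1ℚ + (x + 1ℚ)
        eq = solve-∀ ℚ-ring
    ρ-range : ∀ v → 0ℚ ≤ ρ v × ρ v ≤ 1ℚ
    ρ-range v = subst (0ℚ ≤_) (eq (P * y v) (j (a v))) (0≤- (proj₁ (proj₂ ⌊ P * y v ⌋ᶻ))) ,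
      slack-≤ (j (a v) + 1ℚ - P * y v) (0≤- (<⇒≤ (proj₂ (proj₂ ⌊ P * y v ⌋ᶻ)))) (eq₂ (P * y v) (j (a v)))
      where
      eq : ∀ b a → b - a ≡ b + - 1ℚ * a
      eq = solve-∀ ℚ-ring
      eq₂ : ∀ b a → 1ℚ ≡ b + - 1ℚ * a + (a + 1ℚ - b)
      eq₂ = solve-∀ ℚ-ring
    conclude : (∃ λ (z : Fin n → ℤ) → (∀ v → a v ≡ ℤ.0ℤ → z v ≡ ℤ.0ℤ) ×
      (∀ {F} → F ∈ₗ 𝓕 → Within ((P - 1ℚ) * h) (χ F · jv a - P * χ F · jv z))) → _
    conclude (z , z-zero , close) = z , (λ v → z-zero v ∘ a-zero v) , λ {F} F∈𝓕 →
      within-cancel 0<P (subst (Within (P * ι (suc (herdisc 𝓕)))) (identity F) (within-mono wider (within-+ (close F∈𝓕) (rem F))))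
      where
      0≤P = <⇒≤ 0<P
      rem : ∀ F → Within P (χ F · ρ)
      rem F = ≤-trans (neg-antimono-≤ 0≤P) (·-0≤ F (λ v → proj₁ (ρ-range v))) ,
        ≤-trans (·-≤n F ρ-range) (ι-mono-≤ (n≤2^n n))
      identity : ∀ F → (χ F · jv a - P * χ F · jv z) + χ F · ρ ≡ P * χ F · (y ⊕ - 1ℚ ⋆ jv z)
      identity F = trans (cong ((χ F · jv a - P * χ F · jv z) +_) (trans (·-cong (λ _ → refl) (λ v → eq₀ (P * y v) (j (a v)))) (·-linʳ (χ F) (zv ⊕ P ⋆ y) (- 1ℚ) (jv a))))
        (trans (cong (λ t → (χ F · jv a - P * χ F · jv z) + (t + - 1ℚ * χ F · jv a)) (trans (·-linʳ (χ F) zv P y) (cong (_+ P * χ F · y) F·0)))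
        (trans (eq₁ (χ F · jv a) P (χ F · jv z) (χ F · y)) (cong (P *_) (sym (·-linʳ (χ F) y (- 1ℚ) (jv z))))))
        where
        F·0 : χ F · zv ≡ 0ℚ
        F·0 = trans (·-def (χ F) zv) (sum-zero (λ v → *-zeroʳ (χ F v)))
        eq₀ : ∀ b a → b + - 1ℚ * a ≡ 0ℚ + b + - 1ℚ * a
        eq₀ = solve-∀ ℚ-ring
        eq₁ : ∀ a P z y → (a - P * z) + (0ℚ + P * y + - 1ℚ * a) ≡ P * (y + - 1ℚ * z)
        eq₁ = solve-∀ ℚ-ring
      wider : (P - 1ℚ) * h + P ≤ P * ι (suc (herdisc 𝓕))
      wider = slack-≤ h (0≤ι (herdisc 𝓕)) (trans (cong (P *_) (ι-suc (herdisc 𝓕))) (eq P h))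
        where
        eq : ∀ P h → P * (1ℚ + h) ≡ (P - 1ℚ) * h + P + h
        eq = solve-∀ ℚ-ring

  -- Pivots

  -- bs ≼ cs: each vector of cs differs from the one of bs at the same place by a combination of later ones.
  infix 4 _≼_
  data _≼_ {n} : List (V n) → List (V n) → Set where
    []  : [] ≼ []
    _∷_ : ∀ {b c bs cs} → (∀ {y} → Perp y bs → b · y ≡ c · y) → bs ≼ cs → b ∷ bs ≼ c ∷ cs

  ≼-refl : ∀ {n} {bs : List (V n)} → bs ≼ bs
  ≼-refl {bs = []}    = []
  ≼-refl {bs = _ ∷ _} = (λ _ → refl) ∷ ≼-refl

  ≼-perp : ∀ {n} {bs cs : List (V n)} → bs ≼ cs → ∀ {y} → Perp y bs → Perp y cs
  ≼-perp []      _        = []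
  ≼-perp (_∷_ {b} {c} p q) {y} (r ∷ rs) = trans (·-comm y c) (trans (sym (p rs)) (trans (·-comm b y) r)) ∷ ≼-perp q rs

  ≼-perp⁻ : ∀ {n} {bs cs : List (V n)} → bs ≼ cs → ∀ {y} → Perp y cs → Perp y bs
  ≼-perp⁻ []      _        = []
  ≼-perp⁻ (_∷_ {b} {c} p q) {y} (r ∷ rs) = trans (·-comm y b) (trans (p (≼-perp⁻ q rs)) (trans (·-comm c y) r)) ∷ ≼-perp⁻ q rs

  ≼-trans : ∀ {n} {as bs cs : List (V n)} → as ≼ bs → bs ≼ cs → as ≼ cs
  ≼-trans []      []        = []
  ≼-trans (p ∷ ps) (q ∷ qs) = (λ ⊥as → trans (p ⊥as) (q (≼-perp ps ⊥as))) ∷ ≼-trans ps qs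

  data Insert {A : Set} (p : A) : List A → List A → Set where
    here  : ∀ {xs} → Insert p xs (p ∷ xs)
    there : ∀ {x xs ys} → Insert p xs ys → Insert p (x ∷ xs) (x ∷ ys)

  insert-all : ∀ {A : Set} {P : A → Set} {p xs ys} → Insert p xs ys → P p → All P xs → All P ys
  insert-all here      pp ps       = pp ∷ ps
  insert-all (there i) pp (q ∷ qs) = q ∷ insert-all i pp qs

  uninsert-all : ∀ {A : Set} {P : A → Set} {p xs ys} → Insert p xs ys → All P ys → P p × All P xs
  uninsert-all here      (pp ∷ ps) = pp , ps
  uninsert-all (there i) (q ∷ qs)  = let pp , ps = uninsert-all i qs in pp , q ∷ ps

  ∏ : List ℚ → ℚ
  ∏ []       = 1ℚ
  ∏ (x ∷ xs) = x * ∏ xs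

  ∏-insert : ∀ {p xs ys} → Insert p xs ys → ∏ ys ≡ p * ∏ xs
  ∏-insert here = refl
  ∏-insert {p} (there {x} {xs} i) = trans (cong (x *_) (∏-insert i)) (eq x p (∏ xs))
    where
    eq : ∀ x p q → x * (p * q) ≡ p * (x * q)
    eq = solve-∀ ℚ-ring

  insert-map : ∀ {A B : Set} (f : A → B) {p xs ys} → Insert p xs ys → Insert (f p) (map f xs) (map f ys)
  insert-map f here      = here
  insert-map f (there i) = there (insert-map f i)

  norms : ∀ {n} → List (V n) → ℚ
  norms bs = ∏ (map (λ b → b · b) bs)

  -- For an orthogonal list this is the leverage of coordinate v: the squared length of the
  -- projection of `e v` onto the span.
  lev : ∀ {n} → Fin n → List (V n) → ℚ
  lev v []       = 0ℚ
  lev v (b ∷ bs) = b v * b v * inv (b · b) + lev v bs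

  -- The last vector not vanishing at v is the pivot. Those before it are made to vanish at v by
  -- subtracting multiples of g, the element of the span of the vectors after them that represents
  -- evaluation at v; this keeps the family orthogonal.
  record Elim {n} (v : Fin n) (bs : List (V n)) : Set where
    field
      pivot : V n
      rest  : List (V n)
      all   : List (V n)
      g     : V n
      ins   : Insert pivot rest all
      shear : bs ≼ all
      orth  : Orth rest
      vanish : All (λ b → b v ≡ 0ℚ) rest
      span  : ∀ {y} → Perp y bs → Perp y rest × g · y ≡ 0ℚ
      ⊥g    : Perp g rest
      g·g   : g · g ≡ lev v bs
      gv    : g v ≡ lev v bs
      lev≢0 : lev v bs ≢ 0ℚ
      prod  : pivot v * pivot v * norms rest ≡ norms bs * lev v bs
      suppd : ∀ {χ} → All (Supp χ) bs → All (Supp χ) rest × Supp χ g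

  z₀ : ∀ {n} → V n
  z₀ _ = 0ℚ

  z₀·≡0 : ∀ {n} (y : V n) → z₀ · y ≡ 0ℚ
  z₀·≡0 y = trans (·-def z₀ y) (sum-zero (λ v → *-zeroˡ (y v)))

  ⋆· : ∀ {n} c (b y : V n) → (z₀ ⊕ c ⋆ b) · y ≡ c * b · y
  ⋆· c b y = trans (·-linˡ z₀ c b y) (trans (cong (_+ c * b · y) (z₀·≡0 y)) (+-identityˡ (c * b · y)))

  Perp-⋆ : ∀ {n} c {b : V n} {bs} → Perp b bs → Perp (z₀ ⊕ c ⋆ b) bs
  Perp-⋆ c [] = []
  Perp-⋆ c {b} {x ∷ _} (p ∷ ps) = trans (⋆· c b x) (trans (cong (c *_) p) (*-zeroʳ c)) ∷ Perp-⋆ c ps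

  Supp-z₀ : ∀ {n} {χ : V n} → Supp χ z₀
  Supp-z₀ {χ = χ} = supp λ v → *-zeroʳ (χ v)

  *≢0 : ∀ {a b} → a ≢ 0ℚ → b ≢ 0ℚ → a * b ≢ 0ℚ
  *≢0 {a} {b} p q r = q (begin
    b                  ≡⟨ sym (*-identityˡ b) ⟩
    1ℚ * b             ≡⟨ cong (_* b) (sym (*-inv p)) ⟩
    a * inv a * b      ≡⟨ eq a (inv a) b ⟩
    inv a * (a * b)    ≡⟨ cong (inv a *_) r ⟩
    inv a * 0ℚ         ≡⟨ *-zeroʳ (inv a) ⟩
    0ℚ                 ∎)
    where
    open ≡-Reasoning
    eq : ∀ a i b → a * i * b ≡ i * (a * b)
    eq = solve-∀ ℚ-ring

  inv≢0 : ∀ {a} → a ≢ 0ℚ → inv a ≢ 0ℚ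
  inv≢0 {a} p q = 1≢0 (trans (sym (*-inv p)) (trans (cong (a *_) q) (*-zeroʳ a)))

  0<self : ∀ {n} {b : V n} → b · b ≢ 0ℚ → 0ℚ < b · b
  0<self {b = b} p = ≰⇒> λ le → p (≤-antisym le (0≤·self b))

  0≤lev : ∀ {n} (v : Fin n) {bs} → Orth bs → 0ℚ ≤ lev v bs
  0≤lev v [] = ≤-refl
  0≤lev v {b ∷ _} ((_ , p) ∷ o) = 0≤+ (0≤* (0≤² (b v)) (0≤inv (0<self p))) (0≤lev v o)

  -- Everything after b vanishes at v, so evaluation at v on the span of b ∷ bs is represented by
  -- the multiple (b_v / |b|²) b alone.
  elim-first : ∀ {n} (v : Fin n) {b} {bs : List (V n)} → Orth (b ∷ bs) → All (λ b → b v ≡ 0ℚ) bs → lev v bs ≡ 0ℚ →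
               b v ≢ 0ℚ → Elim v (b ∷ bs)
  elim-first v {b} {bs} ((b⊥ , b≢0) ∷ o) van lev0 bv≢0 = record
    { pivot = b ; rest = bs ; all = b ∷ bs ; g = g ; ins = here ; shear = ≼-refl ; orth = o ; vanish = van
    ; span = λ { {y} (p ∷ ps) → ps , trans (⋆· c b y) (trans (cong (c *_) (trans (·-comm b y) p)) (*-zeroʳ c)) }
    ; ⊥g = Perp-⋆ c b⊥
    ; g·g = trans (⋆· c b g) (trans (cong (c *_) (trans (·-comm b g) (⋆· c b b))) (trans (eq₁ (b v) i (b · b))
             (trans (cong (b v * b v * i *_) (*-inv b≢0)) (trans (*-identityʳ (b v * b v * i)) lev-eq))))
    ; gv = trans (eq₂ (b v) i) lev-eq
    ; lev≢0 = λ p → *≢0 (*≢0 bv≢0 bv≢0) (inv≢0 b≢0) (trans lev-eq p)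
    ; prod = trans (trans (eq₄ (b v) (norms bs)) (cong (b v * b v * norms bs *_) (sym (*-inv b≢0))))
        (trans (eq₃ (b v) (norms bs) (b · b) i) (cong (b · b * norms bs *_) lev-eq))
    ; suppd = λ { (s ∷ ss) → ss , Supp-⊕ c Supp-z₀ s }
    }
    where
    i = inv (b · b)
    c = b v * i
    g = z₀ ⊕ c ⋆ b
    lev-eq : b v * b v * i ≡ lev v (b ∷ bs)
    lev-eq = sym (trans (cong (b v * b v * i +_) lev0) (+-identityʳ (b v * b v * i)))
    eq₁ : ∀ v i n → v * i * (v * i * n) ≡ v * v * i * (n * i)
    eq₁ = solve-∀ ℚ-ring
    eq₂ : ∀ v i → 0ℚ + v * i * v ≡ v * v * i
    eq₂ = solve-∀ ℚ-ring
    eq₃ : ∀ v m n i → v * v * m * (n * i) ≡ n * m * (v * v * i)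
    eq₃ = solve-∀ ℚ-ring
    eq₄ : ∀ v m → v * v * m ≡ v * v * m * 1ℚ
    eq₄ = solve-∀ ℚ-ring

  -- With S the leverage of the later vectors, g v = |g|² = S and g ⊥ b, so b′ = b - (b_v / S) g
  -- vanishes at v. Its length satisfies |b′|² S = |b|² (S + b_v² / |b|²) = |b|² S′, which carries
  -- the product formula from `bs` to b ∷ bs. The new representer g + (b_v / |b|²) b is orthogonal
  -- to b′ because the two cross terms are -b_v and b_v.
  elim-later : ∀ {n} (v : Fin n) {b} {bs : List (V n)} → Orth (b ∷ bs) → Elim v bs → Elim v (b ∷ bs)
  elim-later {n} v {b} {bs} ((b⊥ , b≢0) ∷ o) E = record
    { pivot = E.pivot ; rest = b′ ∷ E.rest ; all = b′ ∷ E.all ; g = g′ ; ins = there E.ins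
    ; shear = (λ {y} ⊥bs → sym (trans (·-linˡ b c E.g y) (a+c0≡a (b · y) c (proj₂ (E.span ⊥bs))))) ∷ E.shear
    ; orth = (Perp-⊕ c (proj₁ (E.span b⊥)) E.⊥g , b′≢0) ∷ E.orth
    ; vanish = trans (cong (λ t → b v + c * t) E.gv) (trans (eq₁ (b v) (inv S) S) (trans (cong (λ t → b v + - (b v * t)) SS) (eq₂ (b v)))) ∷ E.vanish
    ; span = λ { {y} (p ∷ ps) → Perp-b′ p ps ∷ proj₁ (E.span ps) , trans (·-linˡ E.g k b y) (trans (a+c0≡a (E.g · y) k (trans (·-comm b y) p)) (proj₂ (E.span ps))) }
    ; ⊥g = g′·b′ ∷ Perp-⊕ k E.⊥g (proj₁ (E.span b⊥))
    ; g·g = trans (·-linˡ E.g k b g′) (trans (cong₂ (λ s t → s + k * t) (trans (·-linʳ E.g E.g k b) (cong₂ (λ s t → s + k * t) E.g·g g·b))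
        (trans (·-linʳ b E.g k b) (cong (_+ k * b · b) (trans (·-comm b E.g) g·b)))) (trans (eq₃ S (b v) i (b · b)) (trans (cong (λ t → S + b v * b v * i * t) (*-inv b≢0)) (eq₄ S (b v * b v * i)))))
    ; gv = trans (cong (λ t → t + k * b v) E.gv) (eq₅ S (b v) i)
    ; lev≢0 = λ p → <-irrefl (sym p) 0<S′
    ; prod = trans (eq₆ (E.pivot v) (b′ · b′) (norms E.rest)) (trans (cong (b′ · b′ *_) E.prod) (trans (eq₇ (b′ · b′) (norms bs) S)
        (trans (cong (norms bs *_) b′-norm) (eq₈ (norms bs) (b · b) S′))))
    ; suppd = λ { (s ∷ ss) → Supp-⊕ c s (proj₂ (E.suppd ss)) ∷ proj₁ (E.suppd ss) , Supp-⊕ k (proj₂ (E.suppd ss)) s }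
    }
    where
    module E = Elim E
    S = lev v bs
    S′ = lev v (b ∷ bs)
    i = inv (b · b)
    c = - (b v * inv S)
    k = b v * i
    b′ = b ⊕ c ⋆ E.g
    g′ = E.g ⊕ k ⋆ b
    SS : S * inv S ≡ 1ℚ
    SS = *-inv E.lev≢0
    0<S : 0ℚ < S
    0<S = ≰⇒> λ le → E.lev≢0 (≤-antisym le (0≤lev v o))
    0<S′ : 0ℚ < S′
    0<S′ = <-≤-trans 0<S (slack-≤ (b v * b v * i) (0≤* (0≤² (b v)) (0≤inv (0<self b≢0))) (+-comm (b v * b v * i) S))
    g·b : E.g · b ≡ 0ℚ
    g·b = proj₂ (E.span b⊥)
    Perp-b′ : ∀ {y} → y · b ≡ 0ℚ → Perp y bs → y · b′ ≡ 0ℚ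
    Perp-b′ {y} p ps = trans (·-linʳ y b c E.g) (trans (a+c0≡a (y · b) c (trans (·-comm y E.g) (proj₂ (E.span ps)))) p)
    b′·b′ : b′ · b′ ≡ b · b + c * (c * S)
    b′·b′ = trans (·-linˡ b c E.g b′) (cong₂ (λ s t → s + c * t)
      (trans (·-linʳ b b c E.g) (a+c0≡a (b · b) c (trans (·-comm b E.g) g·b)))
      (trans (·-linʳ E.g b c E.g) (trans (cong₂ (λ s t → s + c * t) g·b E.g·g) (+-identityˡ (c * S)))))
    eq₁ : ∀ v i s → v + - (v * i) * s ≡ v + - (v * (s * i))
    eq₁ = solve-∀ ℚ-ring
    eq₂ : ∀ v → v + - (v * 1ℚ) ≡ 0ℚ
    eq₂ = solve-∀ ℚ-ring
    eq₃ : ∀ S v i n → S + v * i * 0ℚ + v * i * (0ℚ + v * i * n) ≡ S + v * v * i * (n * i)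
    eq₃ = solve-∀ ℚ-ring
    eq₄ : ∀ S a → S + a * 1ℚ ≡ a + S
    eq₄ = solve-∀ ℚ-ring
    eq₅ : ∀ S v i → S + v * i * v ≡ v * v * i + S
    eq₅ = solve-∀ ℚ-ring
    eq₆ : ∀ p b m → p * p * (b * m) ≡ b * (p * p * m)
    eq₆ = solve-∀ ℚ-ring
    eq₇ : ∀ b m s → b * (m * s) ≡ m * (b * s)
    eq₇ = solve-∀ ℚ-ring
    eq₈ : ∀ m b s → m * (b * s) ≡ b * m * s
    eq₈ = solve-∀ ℚ-ring
    b′-norm : b′ · b′ * S ≡ b · b * S′
    b′-norm = trans (cong (_* S) b′·b′) (trans (e₁ (b · b) (b v) (inv S) S) (trans (cong (λ t → b · b * S + b v * b v * (t * t)) SS)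
      (trans (e₂ (b · b) (b v) S) (trans (cong (λ t → b · b * S + b v * b v * t) (sym (*-inv b≢0))) (e₃ (b · b) (b v) S i)))))
      where
      e₁ : ∀ n v j s → (n + - (v * j) * (- (v * j) * s)) * s ≡ n * s + v * v * ((s * j) * (s * j))
      e₁ = solve-∀ ℚ-ring
      e₂ : ∀ n v s → n * s + v * v * (1ℚ * 1ℚ) ≡ n * s + v * v * 1ℚ
      e₂ = solve-∀ ℚ-ring
      e₃ : ∀ n v s i → n * s + v * v * (n * i) ≡ n * (v * v * i + s)
      e₃ = solve-∀ ℚ-ring
    b′≢0 : b′ · b′ ≢ 0ℚ
    b′≢0 p = *≢0 b≢0 (λ q → <-irrefl (sym q) 0<S′) (trans (sym b′-norm) (trans (cong (_* S) p) (*-zeroˡ S)))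
    g′·b′ : g′ · b′ ≡ 0ℚ
    g′·b′ = trans (·-linˡ E.g k b b′) (trans (cong₂ (λ s t → s + k * t)
        (trans (·-linʳ E.g b c E.g) (cong₂ (λ s t → s + c * t) g·b E.g·g))
        (trans (·-linʳ b b c E.g) (a+c0≡a (b · b) c (trans (·-comm b E.g) g·b))))
      (trans (e₁ (b v) (inv S) S i (b · b)) (trans (cong₂ (λ s t → - (b v * s) + b v * t) SS (*-inv b≢0)) (e₂ (b v)))))
      where
      e₁ : ∀ v j s i n → 0ℚ + - (v * j) * s + v * i * n ≡ - (v * (s * j)) + v * (n * i)
      e₁ = solve-∀ ℚ-ring
      e₂ : ∀ v → - (v * 1ℚ) + v * 1ℚ ≡ 0ℚ
      e₂ = solve-∀ ℚ-ring

  eliminate : ∀ {n} (v : Fin n) {bs : List (V n)} → Orth bs → (All (λ b → b v ≡ 0ℚ) bs × lev v bs ≡ 0ℚ) ⊎ Elim v bs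
  eliminate v [] = inj₁ ([] , refl)
  eliminate v {b ∷ bs} o@((b⊥ , b≢0) ∷ o′) = go (eliminate v o′) (b v ≟ 0ℚ)
    where
    eq : ∀ i → 0ℚ * 0ℚ * i + 0ℚ ≡ 0ℚ
    eq = solve-∀ ℚ-ring
    go : (All (λ b → b v ≡ 0ℚ) bs × lev v bs ≡ 0ℚ) ⊎ Elim v bs → Dec (b v ≡ 0ℚ) →
         (All (λ b → b v ≡ 0ℚ) (b ∷ bs) × lev v (b ∷ bs) ≡ 0ℚ) ⊎ Elim v (b ∷ bs)
    go (inj₁ (van , lev0)) (yes z) = inj₁ (z ∷ van , trans (cong₂ (λ s t → s * s * inv (b · b) + t) z lev0) (eq (inv (b · b))))
    go (inj₁ (van , lev0)) (no nz) = inj₂ (elim-first v o van lev0 nz)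
    go (inj₂ E)            _       = inj₂ (elim-later v o E)

  -- Triangular systems of pivots

  Entries : ℕ → Set
  Entries n = List (V n × Fin n)

  Avoids : ∀ {n} → Fin n → Entries n → Set
  Avoids w = All (λ e → w ≢ proj₂ e)

  Solves : ∀ {n} (y : V n) (rs : Entries n) → All (λ _ → ℚ) rs → Set
  Solves y []             []       = ⊤
  Solves y ((r , _) ∷ rs) (w ∷ ws) = r · y ≡ w × Solves y rs ws

  solves-insert : ∀ {n} {y : V n} {p v rs rs′} (i : Insert (p , v) rs rs′) (ws : All (λ _ → ℚ) rs′) →
    p · y ≡ proj₁ (uninsert-all i ws) → Solves y rs (proj₂ (uninsert-all i ws)) → Solves y rs′ ws
  solves-insert here      (w ∷ ws) p ps       = p , ps
  solves-insert (there i) (w ∷ ws) p (q , ps) = q , solves-insert i ws p ps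

  solves-cong : ∀ {n} {y y′ : V n} (rs : Entries n) {ws} → All (λ e → proj₁ e · y ≡ proj₁ e · y′) rs → Solves y rs ws → Solves y′ rs ws
  solves-cong []       {[]}    _        _        = tt
  solves-cong (_ ∷ rs) {_ ∷ _} (p ∷ ps) (q , qs) = trans (sym p) q , solves-cong rs ps qs

  Small : ∀ {n} → (Fin n → ℤ) → V n × Fin n → Set
  Small ζ (r , v) = r · jv ζ * r · jv ζ < r v * r v

  -- On the pivot columns the rows `rs` form a triangular matrix, up to order, with the pivots on
  -- its diagonal; hence `solve`, and hence `inj`, a substitute for saying that a fundamental cell
  -- of the lattice has side lengths |r v|. In `prod`, a stage with j vectors left finds a column of
  -- leverage at least j/(2N); these factors multiply to k!/(2N)^k.
  record Pivots {n} (N : ℕ) (bs : List (V n)) : Set where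
    field
      rs    : Entries n
      shear : bs ≼ map proj₁ rs
      solve : ∀ (ws : All (λ _ → ℚ) rs) → ∃ λ y → (∀ w → Avoids w rs → y w ≡ 0ℚ) × Solves y rs ws
      inj   : ∀ (ζ : Fin n → ℤ) → (∀ w → Avoids w rs → ζ w ≡ ℤ.0ℤ) → All (Small ζ) rs → ∀ w → ζ w ≡ ℤ.0ℤ
      prod  : norms bs * ι (length bs !) ≤ ∏ (map (λ e → proj₁ e (proj₂ e) * proj₁ e (proj₂ e)) rs) * (# 2 * ι N) ^ length bs

  insert-shear : ∀ {n} {p : V n} {v rest all} {rs : Entries n} → Insert p rest all → rest ≼ map proj₁ rs →
    ∃ λ rs′ → Insert (p , v) rs rs′ × all ≼ map proj₁ rs′
  insert-shear {p = p} {v} {rs = rs} here sh = (p , v) ∷ rs , here , (λ _ → refl) ∷ sh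
  insert-shear {rs = r ∷ rs} (there i) (q ∷ sh) = let rs′ , i′ , sh′ = insert-shear i sh in
    r ∷ rs′ , there i′ , (λ ⊥ys → q (proj₂ (uninsert-all i ⊥ys))) ∷ sh′

  ≼-length : ∀ {n} {bs cs : List (V n)} → bs ≼ cs → length bs ≡ length cs
  ≼-length []       = refl
  ≼-length (_ ∷ sh) = cong suc (≼-length sh)

  insert-length : ∀ {A : Set} {p : A} {xs ys} → Insert p xs ys → length ys ≡ suc (length xs)
  insert-length here      = refl
  insert-length (there i) = cong suc (insert-length i)

  norms≢0 : ∀ {n} {bs : List (V n)} → Orth bs → norms bs ≢ 0ℚ
  norms≢0 []              = 1≢0
  norms≢0 ((_ , p) ∷ o)   = *≢0 p (norms≢0 o)

  0≤norms : ∀ {n} (bs : List (V n)) → 0ℚ ≤ norms bs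
  0≤norms []       = 0≤# 1
  0≤norms (b ∷ bs) = 0≤* (0≤·self b) (0≤norms bs)

  sum-lev : ∀ {n} {bs : List (V n)} → Orth bs → sum (λ v → lev v bs) ≡ ι (length bs)
  sum-lev {n} [] = trans (sum-zero {n} (λ _ → refl)) (sym (ι≡# 0))
  sum-lev {bs = b ∷ bs} ((_ , b≢0) ∷ o) = trans (sum-+ (λ v → b v * b v * i) (λ v → lev v bs))
    (trans (cong₂ _+_ (trans (sum-cong (λ v → *-comm (b v * b v) i)) (trans (sum-* i (λ v → b v * b v))
      (trans (cong (i *_) (sym (·-def b b))) (trans (*-comm i (b · b)) (*-inv b≢0))))) (sum-lev o)) (sym (ι-suc (length bs))))
    where i = inv (b · b)

  lev-off : ∀ {n} {χ : V n} {v} → χ v ≡ 0ℚ → ∀ {bs} → All (Supp χ) bs → lev v bs ≡ 0ℚ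
  lev-off z [] = refl
  lev-off {χ = χ} {v} z {b ∷ _} (s ∷ ss) = trans (cong₂ (λ t l → t * t * inv (b · b) + l) bv≡0 (lev-off z ss)) (eq (inv (b · b)))
    where
    bv≡0 : b v ≡ 0ℚ
    bv≡0 = trans (sym (Supp.at s v)) (trans (cong (_* b v) z) (*-zeroˡ (b v)))
    eq : ∀ i → 0ℚ * 0ℚ * i + 0ℚ ≡ 0ℚ
    eq = solve-∀ ℚ-ring

  -- Leverages sum to the number k of vectors and vanish off A, so their average over A is k/N. The
  -- factor 2 makes the averaged inequality strict, as `sum<0⇒term<0` needs.
  heavy-coordinate : ∀ {n} (A : Subset n) {bs : List (V n)} → 0ℚ < ι ∣ A ∣ → Orth bs → All (Supp (χ A)) bs → 0ℚ < ι (length bs) →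
    ∃ λ v → ι (length bs) ≤ # 2 * ι ∣ A ∣ * lev v bs
  heavy-coordinate {n} A {bs} 0<N o ss 0<k = v , bound (χ-indicator A v)
    where
    k = ι (length bs)
    N = ι ∣ A ∣
    term : Fin n → ℚ
    term v = k * χ A v + - (# 2 * N) * lev v bs
    Σterm : sum term ≡ - (k * N)
    Σterm = trans (sum-+ (λ v → k * χ A v) (λ v → - (# 2 * N) * lev v bs)) (trans (cong₂ _+_
      (trans (sum-* k (χ A)) (cong (k *_) (sum-χ A))) (trans (sum-* (- (# 2 * N)) (λ v → lev v bs)) (cong (- (# 2 * N) *_) (sum-lev o)))) (eq k N))
      where
      eq : ∀ k N → k * N + - (# 2 * N) * k ≡ - (k * N)
      eq = solve-∀ ℚ-ring
    found = sum<0⇒term<0 term (subst (_< 0ℚ) (sym Σterm) (neg-antimono-< (0<* 0<k 0<N)))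
    v = proj₁ found
    eq₁ : ∀ k a → k * 0ℚ + a * 0ℚ ≡ 0ℚ
    eq₁ = solve-∀ ℚ-ring
    eq₂ : ∀ k N l → # 2 * N * l ≡ k + - (k * 1ℚ + - (# 2 * N) * l)
    eq₂ = solve-∀ ℚ-ring
    bound : χ A v ≡ 0ℚ ⊎ χ A v ≡ 1ℚ → k ≤ # 2 * N * lev v bs
    bound (inj₁ z) = contradiction (proj₂ found) (<-irrefl (trans (cong₂ (λ s t → k * s + - (# 2 * N) * t) z (lev-off z ss)) (eq₁ k (- (# 2 * N)))))
    bound (inj₂ o) = slack-≤ (- (k * 1ℚ + - (# 2 * N) * lev v bs))
      (neg-antimono-≤ (<⇒≤ (subst (λ s → k * s + - (# 2 * N) * lev v bs < 0ℚ) o (proj₂ found)))) (eq₂ k N (lev v bs))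

  e-other : ∀ {n} {v w : Fin n} → w ≢ v → e v w ≡ 0ℚ
  e-other {v = zero}  {zero}  p = contradiction refl p
  e-other {v = zero}  {suc w} p = refl
  e-other {v = suc v} {zero}  p = refl
  e-other {v = suc v} {suc w} p = e-other (p ∘ cong suc)

  perp-e : ∀ {n} {v : Fin n} {bs} → All (λ b → b v ≡ 0ℚ) bs → Perp (e v) bs
  perp-e [] = []
  perp-e {v = v} {b ∷ _} (p ∷ ps) = trans (·-comm (e v) b) (trans (·-e b v) p) ∷ perp-e ps

  entries-vanish : ∀ {n} {v : Fin n} (rs : Entries n) → Perp (e v) (map proj₁ rs) → All (λ en → proj₁ en v ≡ 0ℚ) rs
  entries-vanish []             []       = []
  entries-vanish {v = v} ((r , _) ∷ rs) (p ∷ ps) = trans (sym (·-e r v)) (trans (·-comm r (e v)) p) ∷ entries-vanish rs ps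

  zap : ∀ {n} → Fin n → (Fin n → ℤ) → Fin n → ℤ
  zap v ζ w = decide (w Fin.≟ v) (λ _ → ℤ.0ℤ) (λ _ → ζ w)

  zap-self : ∀ {n} (v : Fin n) ζ → zap v ζ v ≡ ℤ.0ℤ
  zap-self v ζ with v Fin.≟ v
  ... | yes _ = refl
  ... | no  p = contradiction refl p

  zap-other : ∀ {n} {v w : Fin n} ζ → w ≢ v → zap v ζ w ≡ ζ w
  zap-other {v = v} {w} ζ p with w Fin.≟ v
  ... | yes q = contradiction q p
  ... | no  _ = refl

  jv-zap : ∀ {n} (v : Fin n) ζ w → jv ζ w ≡ (jv (zap v ζ) ⊕ j (ζ v) ⋆ e v) w
  jv-zap v ζ w = decide (w Fin.≟ v)
    (λ { refl → sym (trans (cong₂ (λ s t → j s + j (ζ v) * t) (zap-self v ζ) (e-self v)) (trans (cong (_+ j (ζ v) * 1ℚ) j-0) (eq (j (ζ v))))) })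
    (λ p → sym (trans (cong₂ (λ s t → j s + j (ζ v) * t) (zap-other ζ p) (e-other p)) (trans (cong (j (ζ w) +_) (*-zeroʳ (j (ζ v)))) (+-identityʳ (j (ζ w))))))
    where
    eq : ∀ a → 0ℚ + a * 1ℚ ≡ a
    eq = solve-∀ ℚ-ring

  ·-zap : ∀ {n} (r : V n) v ζ → r · jv ζ ≡ r · jv (zap v ζ) + j (ζ v) * r v
  ·-zap r v ζ = trans (·-cong (λ _ → refl) (jv-zap v ζ)) (trans (·-linʳ r (jv (zap v ζ)) (j (ζ v)) (e v)) (cong (λ t → r · jv (zap v ζ) + j (ζ v) * t) (·-e r v)))

  ·-jv-zero : ∀ {n} (r : V n) {ζ} → (∀ w → ζ w ≡ ℤ.0ℤ) → r · jv ζ ≡ 0ℚ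
  ·-jv-zero r {ζ} p = trans (·-def r (jv ζ)) (sum-zero (λ w → trans (cong (λ t → r w * j t) (p w)) (trans (cong (r w *_) j-0) (*-zeroʳ (r w)))))

  sq<1⇒zero : ∀ {z} → j z * j z < 1ℚ → z ≡ ℤ.0ℤ
  sq<1⇒zero {z} lt = j-small (≰⇒> λ le → <-irrefl refl (<-≤-trans lt (1≤² (≤-trans (≤-reflexive (sym (eq₁ 1ℚ))) (neg-antimono-≤ le)) (eq₂ (j z)))))
    (≰⇒> λ le → <-irrefl refl (<-≤-trans lt (1≤² le refl)))
    where
    eq₁ : ∀ a → - - a ≡ a
    eq₁ = solve-∀ ℚ-ring
    eq₂ : ∀ a → - a * - a ≡ a * a
    eq₂ = solve-∀ ℚ-ring
    1≤² : ∀ {a b} → 1ℚ ≤ a → a * a ≡ b → 1ℚ ≤ b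
    1≤² {a} p refl = *-mono-≤ (0≤# 1) (≤-trans (0≤# 1) p) p p

  pivots : ∀ {n} (A : Subset n) → 0ℚ < ι ∣ A ∣ → ∀ k {bs : List (V n)} → length bs ≡ k → Orth bs → All (Supp (χ A)) bs → Pivots ∣ A ∣ bs
  pivots A 0<N zero {[]} _ _ _ = record
    { rs = [] ; shear = [] ; solve = λ { [] → z₀ , (λ _ _ → refl) , tt } ; inj = λ ζ s _ w → s w []
    ; prod = ≤-reflexive (cong (1ℚ *_) (ι≡# 1)) }
  pivots {n} A 0<N (suc k) {bs} len o ss = build (eliminate v o)
    where
    N = # 2 * ι ∣ A ∣
    heavy = heavy-coordinate A 0<N o ss (subst (λ t → 0ℚ < ι t) (sym len) (0<ι (suc k)))
    v = proj₁ heavy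
    build : (All (λ b → b v ≡ 0ℚ) bs × lev v bs ≡ 0ℚ) ⊎ Elim v bs → Pivots ∣ A ∣ bs
    build (inj₁ (_ , lev0)) = contradiction (<-≤-trans (0<ι (suc k)) (subst₂ (λ s t → ι s ≤ N * t) len lev0 (proj₂ heavy)))
      (<-irrefl (sym (*-zeroʳ N)))
    build (inj₂ E) = record
      { rs = rs′ ; shear = ≼-trans E.shear sh′ ; solve = solve′ ; inj = inj′ ; prod = prod′ }
      where
      module E = Elim E
      len-rest : length E.rest ≡ k
      len-rest = ℕ.suc-injective (trans (sym (insert-length E.ins)) (trans (sym (≼-length E.shear)) len))
      module R = Pivots (pivots A 0<N k len-rest E.orth (proj₁ (E.suppd ss)))
      inserted = insert-shear {v = v} E.ins R.shear
      rs′ = proj₁ inserted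
      ins′ = proj₁ (proj₂ inserted)
      sh′ = proj₂ (proj₂ inserted)
      p = E.pivot
      pv = p v
      -- The pivot rows found later span the same space as `E.rest`, all of which vanishes at v.
      van : All (λ en → proj₁ en v ≡ 0ℚ) R.rs
      van = entries-vanish R.rs (≼-perp R.shear (perp-e E.vanish))
      pv≢0 : pv ≢ 0ℚ
      pv≢0 z = *≢0 (norms≢0 o) E.lev≢0 (trans (sym E.prod) (trans (cong (λ t → t * t * norms E.rest) z) (trans (cong (_* norms E.rest) (*-zeroˡ 0ℚ)) (*-zeroˡ (norms E.rest)))))
      solve′ : ∀ (ws : All (λ _ → ℚ) rs′) → ∃ λ y → (∀ w → Avoids w rs′ → y w ≡ 0ℚ) × Solves y rs′ ws
      solve′ ws = y , off , solves-insert ins′ ws hit (solves-cong R.rs (All.map (λ {en} z → same (proj₁ en) z) van) (proj₂ (proj₂ sol)))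
        where
        w₀ = proj₁ (uninsert-all ins′ ws)
        sol = R.solve (proj₂ (uninsert-all ins′ ws))
        y′ = proj₁ sol
        -- Column v is invisible to the other rows, so changing y there corrects the pivot row and
        -- disturbs nothing else.
        c = (w₀ - p · y′) * inv pv
        y = y′ ⊕ c ⋆ e v
        off : ∀ w → Avoids w rs′ → y w ≡ 0ℚ
        off w av = trans (cong₂ (λ s t → s + c * t) (proj₁ (proj₂ sol) w (proj₂ (uninsert-all ins′ av))) (e-other (proj₁ (uninsert-all ins′ av))))
          (trans (+-identityˡ (c * 0ℚ)) (*-zeroʳ c))
        dot-y : ∀ r → r · y ≡ r · y′ + c * r v
        dot-y r = trans (·-linʳ r y′ c (e v)) (cong (λ t → r · y′ + c * t) (·-e r v))
        same : ∀ r → r v ≡ 0ℚ → r · y′ ≡ r · y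
        same r z = sym (trans (dot-y r) (a+c0≡a (r · y′) c z))
        hit : p · y ≡ w₀
        hit = trans (dot-y p) (trans (eq₁ (p · y′) w₀ pv (inv pv)) (trans (cong (λ t → p · y′ + (w₀ - p · y′) * t) (*-inv pv≢0)) (eq₂ (p · y′) w₀)))
          where
          eq₁ : ∀ a w p i → a + (w - a) * i * p ≡ a + (w - a) * (p * i)
          eq₁ = solve-∀ ℚ-ring
          eq₂ : ∀ a w → a + (w - a) * 1ℚ ≡ w
          eq₂ = solve-∀ ℚ-ring
      inj′ : ∀ (ζ : Fin n → ℤ) → (∀ w → Avoids w rs′ → ζ w ≡ ℤ.0ℤ) → All (Small ζ) rs′ → ∀ w → ζ w ≡ ℤ.0ℤ
      inj′ ζ off small w = decide (w Fin.≟ v) (λ w≡v → subst (λ t → ζ t ≡ ℤ.0ℤ) (sym w≡v) ζv≡0) (λ w≢v → trans (sym (zap-other ζ w≢v)) (ζ′≡0 w))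
        where
        ζ′ = zap v ζ
        off′ : ∀ w → Avoids w R.rs → ζ′ w ≡ ℤ.0ℤ
        off′ w av = decide (w Fin.≟ v) (λ w≡v → subst (λ t → ζ′ t ≡ ℤ.0ℤ) (sym w≡v) (zap-self v ζ)) (λ w≢v → trans (zap-other ζ w≢v) (off w (insert-all ins′ w≢v av)))
        small′ : ∀ rs → All (λ en → proj₁ en v ≡ 0ℚ) rs → All (Small ζ) rs → All (Small ζ′) rs
        small′ []             []       []       = []
        small′ ((r , u) ∷ rs) (z ∷ zs) (s ∷ s′) = subst (λ t → t * t < r u * r u) (trans (·-zap r v ζ) (a+c0≡a (r · jv ζ′) (j (ζ v)) z)) s ∷ small′ rs zs s′
        ζ′≡0 : ∀ w → ζ′ w ≡ ℤ.0ℤ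
        ζ′≡0 = R.inj ζ′ off′ (small′ R.rs van (proj₂ (uninsert-all ins′ small)))
        -- All other coordinates are already 0, so the pivot row gives p · ζ = ζ_v p_v, and
        -- smallness leaves |ζ_v| < 1.
        ζv≡0 : ζ v ≡ ℤ.0ℤ
        ζv≡0 = sq<1⇒zero (*-cancelʳ-<-nonNeg (pv * pv) {{nonNegative (0≤² pv)}} (subst₂ _<_
          (trans (cong (λ t → t * t) (trans (·-zap p v ζ) (cong (_+ j (ζ v) * pv) (·-jv-zero p ζ′≡0)))) (eq (j (ζ v)) pv)) (sym (*-identityˡ (pv * pv))) (proj₁ (uninsert-all ins′ small))))
          where
          eq : ∀ z p → (0ℚ + z * p) * (0ℚ + z * p) ≡ z * z * (p * p)
          eq = solve-∀ ℚ-ring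
      sq : V n × Fin n → ℚ
      sq en = proj₁ en (proj₂ en) * proj₁ en (proj₂ en)
      prod′ : norms bs * ι (length bs !) ≤ ∏ (map sq rs′) * N ^ length bs
      prod′ = subst₂ (λ l P → norms bs * ι (l !) ≤ P * N ^ l) (sym len) (sym (∏-insert (insert-map sq ins′))) (begin
        norms bs * ι (suc k ℕ.* (k !))                     ≡⟨ cong (norms bs *_) (ι-* (suc k) (k !)) ⟩
        norms bs * (ι (suc k) * ι (k !))                   ≤⟨ *-monoˡ-≤ (0≤norms bs) (*-monoʳ-≤ (0≤ι (k !)) (subst (λ t → ι t ≤ N * lev v bs) len (proj₂ heavy))) ⟩
        norms bs * (N * lev v bs * ι (k !))                ≡⟨ eq₁ (norms bs) N (lev v bs) (ι (k !)) ⟩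
        N * (norms bs * lev v bs * ι (k !))                ≡⟨ cong (λ t → N * (t * ι (k !))) (sym E.prod) ⟩
        N * (pv * pv * norms E.rest * ι (k !))             ≡⟨ eq₂ N (pv * pv) (norms E.rest) (ι (k !)) ⟩
        N * (pv * pv * (norms E.rest * ι (k !)))           ≤⟨ *-monoˡ-≤ 0≤N (*-monoˡ-≤ (0≤² pv) (subst (λ l → norms E.rest * ι (l !) ≤ ∏ (map sq R.rs) * N ^ l) len-rest R.prod)) ⟩
        N * (pv * pv * (∏ (map sq R.rs) * N ^ k))          ≡⟨ eq₃ N (pv * pv) (∏ (map sq R.rs)) (N ^ k) ⟩
        pv * pv * ∏ (map sq R.rs) * (N * N ^ k)            ∎)
        where
        open ≤-Reasoning
        0≤N : 0ℚ ≤ N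
        0≤N = 0≤* (0≤# 2) (<⇒≤ 0<N)
        eq₁ : ∀ b N l f → b * (N * l * f) ≡ N * (b * l * f)
        eq₁ = solve-∀ ℚ-ring
        eq₂ : ∀ N p b f → N * (p * b * f) ≡ N * (p * (b * f))
        eq₂ = solve-∀ ℚ-ring
        eq₃ : ∀ N p b f → N * (p * (b * f)) ≡ p * b * (N * f)
        eq₃ = solve-∀ ℚ-ring

  -- Counting

  IsInt : ℚ → Set
  IsInt x = ∃ λ z → x ≡ j z

  int-+ : ∀ {x y} → IsInt x → IsInt y → IsInt (x + y)
  int-+ (a , refl) (b , refl) = a ℤ.+ b , sym (j-+ a b)

  int-* : ∀ {x y} → IsInt x → IsInt y → IsInt (x * y)
  int-* (a , refl) (b , refl) = a ℤ.* b , sym (j-* a b)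

  int-neg : ∀ {x} → IsInt x → IsInt (- x)
  int-neg (a , refl) = ℤ.- a , sym (j-neg a)

  int-ι : ∀ n → IsInt (ι n)
  int-ι n = ℤ.+ n , sym (j-ι n)

  int-sum : ∀ {n} {f : Fin n → ℚ} → (∀ v → IsInt (f v)) → IsInt (sum f)
  int-sum {zero}  p = ℤ.0ℤ , sym j-0
  int-sum {suc n} p = int-+ (p zero) (int-sum (p ∘ suc))

  opaque
    unfolding j

    ↥-j : ∀ k → ↥ (j k) ≡ k
    ↥-j k = refl

  j-abs² : ∀ k → ι ℤ.∣ k ∣ * ι ℤ.∣ k ∣ ≡ j k * j k
  j-abs² k = trans (sym (cong₂ _*_ (j-ι ℤ.∣ k ∣) (j-ι ℤ.∣ k ∣))) (trans (sym (j-* (ℤ.+ ℤ.∣ k ∣) (ℤ.+ ℤ.∣ k ∣))) (trans (cong j (sq k)) (j-* k k)))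
    where
    sq : ∀ k → ℤ.+ ℤ.∣ k ∣ ℤ.* ℤ.+ ℤ.∣ k ∣ ≡ k ℤ.* k
    sq (ℤ.+ n)      = refl
    sq (ℤ.-[1+ n ]) = refl

  sq-lt : ∀ {a b s} → a ℕ.< s → b ℕ.< s → (ι a - ι b) * (ι a - ι b) < ι s * ι s
  sq-lt {a} {b} {s} a<s b<s = slack-< (((ι s - ι a) + ι b) * ((ι s - ι b) + ι a)) (0<* (gap a<s b) (gap b<s a)) (eq (ι a) (ι b) (ι s))
    where
    gap : ∀ {a} → a ℕ.< s → ∀ b → 0ℚ < (ι s - ι a) + ι b
    gap {a} lt b = <-≤-trans (0<- (ι-mono-< lt)) (slack-≤ (ι b) (0≤ι b) refl)
    eq : ∀ a b s → s * s ≡ (a - b) * (a - b) + ((s - a) + b) * ((s - b) + a)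
    eq = solve-∀ ℚ-ring

  Denominator : ∀ {n} → ℕ → V n → Set
  Denominator Q r = ∀ v → IsInt (ι Q * r v)

  denom-*ˡ : ∀ k Q {x} → IsInt (ι Q * x) → IsInt (ι (k ℕ.* Q) * x)
  denom-*ˡ k Q {x} p = subst IsInt (sym (trans (cong (_* x) (ι-* k Q)) (*-assoc (ι k) (ι Q) x))) (int-* (int-ι k) p)

  denom-*ʳ : ∀ k Q {x} → IsInt (ι Q * x) → IsInt (ι (Q ℕ.* k) * x)
  denom-*ʳ k Q {x} p = subst (λ t → IsInt (ι t * x)) (ℕ.*-comm k Q) (denom-*ˡ k Q p)

  denominator : ∀ {n} (r : V n) → ∃ λ Q → Denominator (suc Q) r
  denominator {zero}  r = 0 , λ ()
  denominator {suc n} r = let Q , q = denominator (r ∘ suc) ; p = r zero in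
    ℕ.pred (↧ₙ p ℕ.* suc Q) , subst (λ t → Denominator t r) (sym (ℕ.suc-pred (↧ₙ p ℕ.* suc Q) {{ℕ.m*n≢0 (↧ₙ p) (suc Q)}}))
      (λ { zero → denom-*ʳ (suc Q) (↧ₙ p) (↥ p , trans (*-comm (ι (↧ₙ p)) p) (j-↥ p)) ; (suc v) → denom-*ˡ (↧ₙ p) (suc Q) (q v) })

  common-denominator : ∀ {n} (rs : Entries n) → ∃ λ Q → All (λ e → Denominator (suc Q) (proj₁ e)) rs
  common-denominator []             = 0 , []
  common-denominator ((r , _) ∷ rs) = let Q₁ , q₁ = denominator r ; Q₂ , q₂ = common-denominator rs in
    -- The successor of this number is `suc Q₁ * suc Q₂` by definition.
    Q₂ ℕ.+ Q₁ ℕ.* suc Q₂ , (λ v → denom-*ʳ (suc Q₂) (suc Q₁) (q₁ v)) ∷ All.map (λ q v → denom-*ˡ (suc Q₁) (suc Q₂) (q v)) q₂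

  int-· : ∀ {n} Q {r : V n} → Denominator Q r → ∀ ζ → IsInt (ι Q * r · jv ζ)
  int-· Q {r} den ζ = subst IsInt (sym (trans (cong (ι Q *_) (·-def r (jv ζ))) (trans (sym (sum-* (ι Q) (λ v → r v * j (ζ v))))
    (sum-cong (λ v → sym (*-assoc (ι Q) (r v) (j (ζ v)))))))) (int-sum (λ v → int-* (den v) (ζ v , refl)))

  digit-of : ∀ {x} M → 0ℚ ≤ x → x ≤ ι M → ∃ λ (d : Fin (suc M)) → ι (toℕ d) ≤ x × x < ι (toℕ d) + 1ℚ
  digit-of {x} M 0≤x x≤M = go ⌊ x ⌋ᶻ
    where
    go : (∃ λ a → j a ≤ x × x < j a + 1ℚ) → ∃ λ (d : Fin (suc M)) → ι (toℕ d) ≤ x × x < ι (toℕ d) + 1ℚ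
    go (ℤ.+ d , lo , hi) = fromℕ< d<1+M , subst (λ t → ι t ≤ x) (sym (toℕ-fromℕ< d<1+M)) (subst (_≤ x) (j-ι d) lo) ,
        subst (λ t → x < ι t + 1ℚ) (sym (toℕ-fromℕ< d<1+M)) (subst (λ t → x < t + 1ℚ) (j-ι d) hi)
      where
      d<1+M : d ℕ.< suc M
      d<1+M = ℕ.s≤s (ι-cancel-≤ (≤-trans (subst (_≤ x) (j-ι d) lo) x≤M))
    go (ℤ.-[1+ d ] , lo , hi) = contradiction (≤-<-trans 0≤x hi) (λ lt → <-irrefl refl (<-≤-trans lt
      (≤-trans (+-monoˡ-≤ 1ℚ (j-mono-≤ {ℤ.-[1+ d ]} {ℤ.-1ℤ} (ℤ.-≤- ℕ.z≤n))) (≤-reflexive (trans (cong (_+ 1ℚ) (trans (j-neg (ℤ.+ 1)) (cong -_ (trans (j-ι 1) (ι≡# 1))))) (+-inverseˡ 1ℚ))))))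

  close-digits : ∀ {d x x′} → d ≤ x → x < d + 1ℚ → d ≤ x′ → x′ < d + 1ℚ → - 1ℚ < x - x′ × x - x′ < 1ℚ
  close-digits {d} {x} {x′} p q p′ q′ =
    slack-< ((d + 1ℚ - x′) + (x - d)) (subst (_< (d + 1ℚ - x′) + (x - d)) (+-identityˡ 0ℚ) (+-mono-<-≤ (0<- q′) (0≤- p))) (eq₁ d x x′) ,
    slack-< ((d + 1ℚ - x) + (x′ - d)) (subst (_< (d + 1ℚ - x) + (x′ - d)) (+-identityˡ 0ℚ) (+-mono-<-≤ (0<- q) (0≤- p′))) (eq₂ d x x′)
    where
    eq₁ : ∀ d x y → x - y ≡ - 1ℚ + ((d + 1ℚ - y) + (x - d))
    eq₁ = solve-∀ ℚ-ring
    eq₂ : ∀ d x y → 1ℚ ≡ x - y + ((d + 1ℚ - x) + (y - d))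
    eq₂ = solve-∀ ℚ-ring

  -- Mixed-radix numerals: tuples whose ranges vary from place to place are flattened into a single
  -- `Fin`, where the pigeonhole principle is available.
  module Codes {A : Set} (size : A → ℕ) where
    Code : List A → Set
    Code = All (λ x → Fin (size x))

    total : List A → ℕ
    total []       = 1
    total (x ∷ xs) = size x ℕ.* total xs

    decode : ∀ xs → Fin (total xs) → Code xs
    decode []       _ = []
    decode (x ∷ xs) i = proj₁ (remQuot {size x} (total xs) i) ∷ decode xs (proj₂ (remQuot {size x} (total xs) i))

    encode : ∀ xs → Code xs → Fin (total xs)
    encode []       []       = zero
    encode (x ∷ xs) (c ∷ cs) = combine c (encode xs cs)

    decode-injective : ∀ xs {i i′} → decode xs i ≡ decode xs i′ → i ≡ i′
    decode-injective []       {zero} {zero} _  = refl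
    decode-injective (x ∷ xs) {i}    {i′}   eq = trans (sym (combine-remQuot {size x} (total xs) i))
      (trans (cong₂ combine (cong All.head eq) (decode-injective xs (cong All.tail eq))) (combine-remQuot {size x} (total xs) i′))

    encode-injective : ∀ xs {c c′} → encode xs c ≡ encode xs c′ → c ≡ c′
    encode-injective []       {[]}     {[]}      _  = refl
    encode-injective (x ∷ xs) {c ∷ cs} {c′ ∷ cs′} eq = let p , q = combine-injective c (encode xs cs) c′ (encode xs cs′) eq in
      cong₂ _∷_ p (encode-injective xs q)

  codes-≤ : ∀ {A B : Set} {a : A → ℕ} {b : B → ℕ} {xs ys} (φ : Codes.Code a xs → Codes.Code b ys) →
            (∀ {c c′} → φ c ≡ φ c′ → c ≡ c′) → Codes.total a xs ℕ.≤ Codes.total b ys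
  codes-≤ {a = a} {b} {xs} {ys} φ inj = injective⇒≤ {f = λ i → Codes.encode b ys (φ (Codes.decode a xs i))}
    (λ eq → Codes.decode-injective a xs (inj (Codes.encode-injective b ys eq)))

  -- A class prescribes on every pivot row a multiple of 1/Q in [0, |r v|); y realises it, z is a
  -- nearby integer point, and u = y - z has values in [-H, H] on the sets. Cut that range into
  -- cells of length 1/Q. Two classes in the same cell agree: their difference δ is orthogonal to
  -- all rows, so the integer vector ζ = z - z′ accounts for the whole difference of the prescribed
  -- values, and `inj` makes it 0. Hence the product of the Q |r v| is at most (2 Q H + 1)^k.
  module Counting {n : ℕ} (𝓕 : SetSystem n) (fs : List (Subset n)) (fs⊆𝓕 : All (_∈ₗ 𝓕) fs)
    (rs : Entries n) (shear : map χ fs ≼ map proj₁ rs)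
    (solve : ∀ (ws : All (λ _ → ℚ) rs) → ∃ λ y → (∀ w → Avoids w rs → y w ≡ 0ℚ) × Solves y rs ws)
    (inj : ∀ (ζ : Fin n → ℤ) → (∀ w → Avoids w rs → ζ w ≡ ℤ.0ℤ) → All (Small ζ) rs → ∀ w → ζ w ≡ ℤ.0ℤ) where

    h H Q : ℕ
    h = herdisc 𝓕
    H = suc h
    Q = suc (proj₁ (common-denominator rs))

    denom : All (λ en → Denominator Q (proj₁ en)) rs
    denom = proj₂ (common-denominator rs)

    q i : ℚ
    q = ι Q
    i = inv q
    0<q : 0ℚ < q
    0<q = 0<ι Q
    qi≡1 : q * i ≡ 1ℚ
    qi≡1 = *-inv (λ z → <-irrefl (sym z) 0<q)

    -- Q is a common denominator, so Q r_v is an integer and equals its own numerator.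
    size : V n × Fin n → ℕ
    size (r , v) = ℤ.∣ ↥ (q * r v) ∣

    size² : ∀ r v → IsInt (q * r v) → ι (size (r , v)) * ι (size (r , v)) ≡ q * r v * (q * r v)
    size² r v (k , p) = trans (cong (λ a → ι a * ι a) (trans (cong (λ t → ℤ.∣ ↥ t ∣) p) (cong ℤ.∣_∣ (↥-j k)))) (trans (j-abs² k) (cong (λ t → t * t) (sym p)))

    Class : Set
    Class = Codes.Code size rs

    targets : ∀ {rs : Entries n} → Codes.Code size rs → All (λ _ → ℚ) rs
    targets []       = []
    targets (c ∷ cs) = ι (toℕ c) * i ∷ targets cs

    y : Class → V n
    y c = proj₁ (solve (targets c))

    z : Class → Fin n → ℤ
    z c = proj₁ (round-to-ℤ 𝓕 (y c))

    u : Class → V n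
    u c = y c ⊕ - 1ℚ ⋆ jv (z c)

    -- Shifted by H and scaled by Q, the values on a set fill [0, 2 Q H], and the integer part names
    -- the cell.
    M : ℕ
    M = 2 ℕ.* (Q ℕ.* H)

    position : Class → Subset n → ℚ
    position c F = q * (χ F · u c + ι H)

    position-range : ∀ c {F} → F ∈ₗ 𝓕 → 0ℚ ≤ position c F × position c F ≤ ι M
    position-range c {F} F∈ = 0≤* (<⇒≤ 0<q) (subst (0ℚ ≤_) (eq₁ (χ F · u c) (ι H)) (0≤- lo)) ,
      ≤-trans (*-monoˡ-≤ (<⇒≤ 0<q) (+-monoˡ-≤ (ι H) hi)) (≤-reflexive (sym (trans (ι-#* 2 (Q ℕ.* H)) (trans (cong (# 2 *_) (ι-* Q H)) (eq₂ q (ι H))))))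
      where
      close = proj₂ (proj₂ (round-to-ℤ 𝓕 (y c))) F∈
      lo = proj₁ close
      hi = proj₂ close
      eq₁ : ∀ a b → a - - b ≡ a + b
      eq₁ = solve-∀ ℚ-ring
      eq₂ : ∀ q H → # 2 * (q * H) ≡ q * (H + H)
      eq₂ = solve-∀ ℚ-ring

    code : Class → Codes.Code (λ _ → suc M) fs
    code c = All.map (λ F∈ → proj₁ (digit-of M (proj₁ (position-range c F∈)) (proj₂ (position-range c F∈)))) fs⊆𝓕

    module Injective {c c′ : Class} (same : code c ≡ code c′) where
      δ : V n
      δ = u c ⊕ - 1ℚ ⋆ u c′
      ζ : Fin n → ℤ
      ζ v = z c v ℤ.- z c′ v

      Near : Subset n → Set
      Near F = - 1ℚ < q * χ F · δ × q * χ F · δ < 1ℚ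

      near : ∀ {fs} (ps : All (_∈ₗ 𝓕) fs) →
        All.map (λ F∈ → proj₁ (digit-of M (proj₁ (position-range c F∈)) (proj₂ (position-range c F∈)))) ps ≡
        All.map (λ F∈ → proj₁ (digit-of M (proj₁ (position-range c′ F∈)) (proj₂ (position-range c′ F∈)))) ps → All Near fs
      near []                eq = []
      near {F ∷ _} (p ∷ ps)  eq = subst (λ t → - 1ℚ < t × t < 1ℚ) diff (close-digits {ι (toℕ (proj₁ D))} {position c F} {position c′ F} (proj₁ (proj₂ D)) (proj₂ (proj₂ D))
          (subst (λ d → ι (toℕ d) ≤ position c′ F) (sym (cong All.head eq)) (proj₁ (proj₂ D′)))
          (subst (λ d → position c′ F < ι (toℕ d) + 1ℚ) (sym (cong All.head eq)) (proj₂ (proj₂ D′)))) ∷ near ps (cong All.tail eq)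
        where
        D = digit-of M (proj₁ (position-range c p)) (proj₂ (position-range c p))
        D′ = digit-of M (proj₁ (position-range c′ p)) (proj₂ (position-range c′ p))
        eq₁ : ∀ q a b H → q * (a + H) - q * (b + H) ≡ q * (a + - 1ℚ * b)
        eq₁ = solve-∀ ℚ-ring
        diff : position c F - position c′ F ≡ q * χ F · δ
        diff = trans (eq₁ q (χ F · u c) (χ F · u c′) (ι H)) (cong (q *_) (sym (·-linʳ (χ F) (u c) (- 1ℚ) (u c′))))

      ·δ : ∀ r → r · δ ≡ r · y c - r · y c′ - (r · jv (z c) - r · jv (z c′))
      ·δ r = trans (·-linʳ r (u c) (- 1ℚ) (u c′)) (trans (cong₂ (λ s t → s + - 1ℚ * t) (·-linʳ r (y c) (- 1ℚ) (jv (z c))) (·-linʳ r (y c′) (- 1ℚ) (jv (z c′))))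
        (eq (r · y c) (r · y c′) (r · jv (z c)) (r · jv (z c′))))
        where
        eq : ∀ a b c d → a + - 1ℚ * c + - 1ℚ * (b + - 1ℚ * d) ≡ a - b - (c - d)
        eq = solve-∀ ℚ-ring

      ·ζ : ∀ r → r · jv ζ ≡ r · jv (z c) - r · jv (z c′)
      ·ζ r = trans (·-cong (λ _ → refl) pointwise) (trans (·-linʳ r (jv (z c)) (- 1ℚ) (jv (z c′))) (eq (r · jv (z c)) (r · jv (z c′))))
        where
        eq : ∀ a b → a + - 1ℚ * b ≡ a - b
        eq = solve-∀ ℚ-ring
        pointwise : ∀ v → j (ζ v) ≡ j (z c v) + - 1ℚ * j (z c′ v)
        pointwise v = trans (j-+ (z c v) (ℤ.- z c′ v)) (trans (cong (j (z c v) +_) (j-neg (z c′ v))) (sym (eq (j (z c v)) (j (z c′ v)))))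

      q*w : ∀ k → q * (ι k * i) ≡ ι k
      q*w k = trans (eq q (ι k) i) (trans (cong (ι k *_) qi≡1) (*-identityʳ (ι k)))
        where
        eq : ∀ q k i → q * (k * i) ≡ k * (q * i)
        eq = solve-∀ ℚ-ring

      integral : ∀ {rs : Entries n} → All (λ en → Denominator Q (proj₁ en)) rs → (d d′ : Codes.Code size rs) →
        Solves (y c) rs (targets d) → Solves (y c′) rs (targets d′) → All (λ en → IsInt (q * proj₁ en · δ)) rs
      integral []         []       []         _        _          = []
      integral {(r , _) ∷ _} (dn ∷ dns) (d ∷ ds) (d′ ∷ ds′) (e , es) (e′ , es′) = subst IsInt
        (sym (trans (cong (q *_) (·δ r)) (trans (eq q (r · y c) (r · y c′) (r · jv (z c)) (r · jv (z c′))) (cong₂ (λ s t → s - t - (q * r · jv (z c) - q * r · jv (z c′)))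
          (trans (cong (q *_) e) (q*w (toℕ d))) (trans (cong (q *_) e′) (q*w (toℕ d′)))))))
        (int-+ (int-+ (int-ι (toℕ d)) (int-neg (int-ι (toℕ d′)))) (int-neg (int-+ (int-· Q dn (z c)) (int-neg (int-· Q dn (z c′))))))
        ∷ integral dns ds ds′ es es′
        where
        eq : ∀ q a b c d → q * (a - b - (c - d)) ≡ q * a - q * b - (q * c - q * d)
        eq = solve-∀ ℚ-ring

      -- Closeness is known for the sets and integrality for the rows. Working from the end of the
      -- list, δ is already orthogonal to the later rows, so F and r agree on it; then Q (r · δ) is
      -- an integer strictly between -1 and 1.
      orthogonal : ∀ {fs : List (Subset n)} {rs : Entries n} → map χ fs ≼ map proj₁ rs → All (λ en → IsInt (q * proj₁ en · δ)) rs → All Near fs → Perp δ (map proj₁ rs)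
      orthogonal {[]}     {[]}           _          _        _        = []
      orthogonal {F ∷ fs} {(r , _) ∷ rs} (F~r ∷ sh) ((k , int) ∷ ints) (nr ∷ nrs) =
        trans (·-comm δ r) (trans (sym (*-identityˡ (r · δ))) (trans (cong (_* r · δ) (sym (trans (*-comm i q) qi≡1))) (trans (*-assoc i q (r · δ))
          (trans (cong (i *_) (trans int (trans (cong j k≡0) j-0))) (*-zeroʳ i))))) ∷ tail
        where
        tail = orthogonal sh ints nrs
        F≡r : q * χ F · δ ≡ j k
        F≡r = trans (cong (q *_) (F~r (≼-perp⁻ sh tail))) int
        k≡0 : k ≡ ℤ.0ℤ
        k≡0 = j-small (subst (- 1ℚ <_) F≡r (proj₁ nr)) (subst (_< 1ℚ) F≡r (proj₂ nr))

      δ⊥ : Perp δ (map proj₁ rs)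
      δ⊥ = orthogonal shear (integral denom c c′ (proj₂ (proj₂ (solve (targets c)))) (proj₂ (proj₂ (solve (targets c′))))) (near fs⊆𝓕 same)

      r·ζ : ∀ r → δ · r ≡ 0ℚ → ∀ {k k′} → r · y c ≡ ι k * i → r · y c′ ≡ ι k′ * i → q * r · jv ζ ≡ ι k - ι k′
      r·ζ r r⊥ {k} {k′} e e′ = trans (cong (q *_) (·ζ r)) (trans (eq q (r · y c) (r · y c′) (r · jv (z c) - r · jv (z c′)))
        (trans (cong (λ t → q * r · y c - q * r · y c′ - q * t) (trans (sym (·δ r)) (trans (·-comm r δ) r⊥)))
        (trans (cong₂ (λ s t → s - t - q * 0ℚ) (trans (cong (q *_) e) (q*w k)) (trans (cong (q *_) e′) (q*w k′))) (eq₂ (ι k) (ι k′) q))))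
        where
        eq : ∀ q a b t → q * t ≡ q * a - q * b - q * (a - b - t)
        eq = solve-∀ ℚ-ring
        eq₂ : ∀ a b q → a - b - q * 0ℚ ≡ a - b
        eq₂ = solve-∀ ℚ-ring

      -- Since r · δ = 0, r · ζ is the difference of two prescribed values, that is (d - d′)/Q with
      -- both digits below Q |r v|.
      small : ∀ {rs : Entries n} → All (λ en → Denominator Q (proj₁ en)) rs → Perp δ (map proj₁ rs) → (d d′ : Codes.Code size rs) →
        Solves (y c) rs (targets d) → Solves (y c′) rs (targets d′) → All (Small ζ) rs
      small [] [] [] [] _ _ = []
      small {(r , v) ∷ _} (dn ∷ dns) (r⊥ ∷ ⊥) (d ∷ ds) (d′ ∷ ds′) (e , es) (e′ , es′) =
        *-cancelʳ-<-nonNeg (q * q) {{nonNegative (0≤² q)}} (subst₂ _<_ (trans (cong (λ t → t * t) (sym (r·ζ r r⊥ {toℕ d} {toℕ d′} e e′))) (eq q (r · jv ζ)))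
          (trans (size² r v (dn v)) (eq q (r v))) (sq-lt (toℕ<n d) (toℕ<n d′))) ∷ small dns ⊥ ds ds′ es es′
        where
        eq : ∀ q a → q * a * (q * a) ≡ a * a * (q * q)
        eq = solve-∀ ℚ-ring

      -- Relies on the rounding keeping zero coordinates at zero; this confines ζ to the pivot
      -- columns.
      ζ-off : ∀ w → Avoids w rs → ζ w ≡ ℤ.0ℤ
      ζ-off w av = cong₂ ℤ._-_ (z≡0 c) (z≡0 c′)
        where
        z≡0 : ∀ c → z c w ≡ ℤ.0ℤ
        z≡0 c = proj₁ (proj₂ (round-to-ℤ 𝓕 (y c))) w (proj₁ (proj₂ (solve (targets c))) w av)

      ζ≡0 : ∀ w → ζ w ≡ ℤ.0ℤ
      ζ≡0 = inj ζ ζ-off (small denom δ⊥ c c′ (proj₂ (proj₂ (solve (targets c)))) (proj₂ (proj₂ (solve (targets c′)))))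

      equal : ∀ {rs : Entries n} → Perp δ (map proj₁ rs) → (d d′ : Codes.Code size rs) →
        Solves (y c) rs (targets d) → Solves (y c′) rs (targets d′) → d ≡ d′
      equal [] [] [] _ _ = refl
      equal {(r , _) ∷ _} (r⊥ ∷ ⊥) (d ∷ ds) (d′ ∷ ds′) (e , es) (e′ , es′) = cong₂ _∷_ (toℕ-injective (ι-injective (ι-eq
        (trans (sym (r·ζ r r⊥ {toℕ d} {toℕ d′} e e′)) (trans (cong (q *_) (·-jv-zero r ζ≡0)) (*-zeroʳ q)))))) (equal ⊥ ds ds′ es es′)
        where
        ι-eq : ∀ {a b} → a - b ≡ 0ℚ → a ≡ b
        ι-eq {a} {b} p = trans (eq a b) (trans (cong (_+ b) p) (+-identityˡ b))
          where
          eq : ∀ a b → a ≡ a - b + b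
          eq = solve-∀ ℚ-ring
        ι-injective : ∀ {a b} → ι a ≡ ι b → a ≡ b
        ι-injective p = ℕ.≤-antisym (ι-cancel-≤ (≤-reflexive p)) (ι-cancel-≤ (≤-reflexive (sym p)))

      same⇒equal : c ≡ c′
      same⇒equal = equal δ⊥ c c′ (proj₂ (proj₂ (solve (targets c)))) (proj₂ (proj₂ (solve (targets c′))))

    count : Codes.total size rs ℕ.≤ Codes.total (λ _ → suc M) fs
    count = codes-≤ code (λ {c} {c′} same → Injective.same⇒equal {c} {c′} same)

    sq : V n × Fin n → ℚ
    sq en = proj₁ en (proj₂ en) * proj₁ en (proj₂ en)

    total² : ∀ {rs : Entries n} → All (λ en → Denominator Q (proj₁ en)) rs →
      ι (Codes.total size rs) * ι (Codes.total size rs) ≡ (q * q) ^ length rs * ∏ (map sq rs)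
    total² [] = trans (cong₂ _*_ (ι≡# 1) (ι≡# 1)) refl
    total² {(r , v) ∷ rs} (dn ∷ dns) = trans (cong (λ t → t * t) (ι-* (size (r , v)) (Codes.total size rs)))
      (trans (eq₁ (ι (size (r , v))) (ι (Codes.total size rs))) (trans (cong₂ _*_ (size² r v (dn v)) (total² dns)) (eq₂ q (r v) ((q * q) ^ length rs) (∏ (map sq rs)))))
      where
      eq₁ : ∀ a b → a * b * (a * b) ≡ a * a * (b * b)
      eq₁ = solve-∀ ℚ-ring
      eq₂ : ∀ q r p s → q * r * (q * r) * (p * s) ≡ q * q * p * (r * r * s)
      eq₂ = solve-∀ ℚ-ring

    total-const : ∀ (fs : List (Subset n)) → Codes.total (λ _ → suc M) fs ≡ suc M ℕ.^ length fs
    total-const []       = refl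
    total-const (_ ∷ fs) = cong (suc M ℕ.*_) (total-const fs)

    same-length : length rs ≡ length fs
    same-length = trans (sym (length-map proj₁ rs)) (trans (sym (≼-length shear)) (length-map χ fs))

    -- From M + 1 = 2 Q (h + 1) + 1 ≤ Q (2 h + 3), so that the powers of Q cancel from the count.
    K : ℚ
    K = # 2 * ι h + # 3

    M≤ : ι (suc M) ≤ q * K
    M≤ = slack-≤ (q - 1ℚ) (0≤- (#≤ι (ℕ.s≤s ℕ.z≤n))) (trans (eq q (ι h)) (cong (_+ (q - 1ℚ)) (sym (trans (ι-suc M) (cong (1ℚ +_)
      (trans (ι-#* 2 (Q ℕ.* H)) (cong (# 2 *_) (trans (ι-* Q H) (cong (q *_) (ι-suc h))))))))))
      where
      eq : ∀ q h → q * (# 2 * h + # 3) ≡ 1ℚ + # 2 * (q * (1ℚ + h)) + (q - 1ℚ)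
      eq = solve-∀ ℚ-ring

    pivots-bounded : ∏ (map sq rs) ≤ (K * K) ^ length fs
    pivots-bounded = *-cancelˡ-≤ (0<^ l (0<* 0<q 0<q)) (begin
      (q * q) ^ l * ∏ (map sq rs)                        ≡⟨ cong (λ t → (q * q) ^ t * ∏ (map sq rs)) same-length ⟨
      (q * q) ^ length rs * ∏ (map sq rs)                ≡⟨ total² denom ⟨
      ι (Codes.total size rs) * ι (Codes.total size rs)  ≤⟨ *-mono-≤ (0≤ι _) (0≤^ l 0≤qK) total≤ total≤ ⟩
      (q * K) ^ l * (q * K) ^ l                          ≡⟨ ^-distrib-* (q * K) (q * K) l ⟨
      (q * K * (q * K)) ^ l                              ≡⟨ cong (_^ l) (eq q K) ⟩
      (q * q * (K * K)) ^ l                              ≡⟨ ^-distrib-* (q * q) (K * K) l ⟩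
      (q * q) ^ l * (K * K) ^ l                          ∎)
      where
      open ≤-Reasoning
      l = length fs
      eq : ∀ q K → q * K * (q * K) ≡ q * q * (K * K)
      eq = solve-∀ ℚ-ring
      0≤qK : 0ℚ ≤ q * K
      0≤qK = 0≤* (<⇒≤ 0<q) (0≤+ (0≤* (0≤# 2) (0≤ι h)) (0≤# 3))
      total≤ : ι (Codes.total size rs) ≤ (q * K) ^ l
      total≤ = ≤-trans (ι-mono-≤ (ℕ.≤-trans count (ℕ.≤-reflexive (total-const fs)))) (≤-trans (≤-reflexive (ι-^ (suc M) l)) (^-mono-≤ l (0≤ι (suc M)) M≤))

  -- Few rows span a system up to short residues

  herdisc-restrict : ∀ {n} (𝓕 : SetSystem n) A → herdisc (𝓕 Defs.∣ A) ℕ.≤ herdisc 𝓕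
  herdisc-restrict 𝓕 A = herdisc-≤ (𝓕 Defs.∣ A) λ J → let x , ok = herdisc-colouring 𝓕 (A ∩ J) in x , λ F∈ →
    let F , F∈𝓕 , eq = ∈-map⁻ (_∩ A) F∈ in
    subst (λ G → ℤ.∣ colourSum x G ∣ ℕ.≤ herdisc 𝓕) (trans (sym (∩-assoc F A J)) (cong (_∩ J) (sym eq))) (ok F∈𝓕)

  χ-∩ : ∀ {n} (F A : Subset n) v → χ (F ∩ A) v ≡ χ F v * χ A v
  χ-∩ F A v = trans (cong (if_then 1ℚ else 0ℚ) (lookup-zipWith _∧_ v F A)) (go (lookup F v) (lookup A v))
    where
    go : ∀ f a → (if f ∧ a then 1ℚ else 0ℚ) ≡ (if f then 1ℚ else 0ℚ) * (if a then 1ℚ else 0ℚ)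
    go true  a = sym (*-identityˡ (if a then 1ℚ else 0ℚ))
    go false a = sym (*-zeroˡ (if a then 1ℚ else 0ℚ))

  χ-∩-supp : ∀ {n} (F A : Subset n) → Supp (χ A) (χ (F ∩ A))
  χ-∩-supp F A = supp λ v → trans (cong (χ A v *_) (χ-∩ F A v)) (trans (go {χ F v} (χ-indicator A v)) (sym (χ-∩ F A v)))
    where
    go : ∀ {f a} → a ≡ 0ℚ ⊎ a ≡ 1ℚ → a * (f * a) ≡ f * a
    go {f} (inj₁ refl) = trans (*-zeroˡ (f * 0ℚ)) (sym (*-zeroʳ f))
    go {f} (inj₂ refl) = *-identityˡ (f * 1ℚ)

  -- Induction with (k + 1)^k ≤ 3 k^k, which is `^-taylor` at D = k and e = 1: its three terms are
  -- all equal.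
  n^n≤3^n*n! : ∀ k → ι k ^ k ≤ (# 3) ^ k * ι (k !)
  n^n≤3^n*n! zero    = ≤-reflexive (cong (1ℚ *_) (sym (ι≡# 1)))
  n^n≤3^n*n! (suc k) = begin
    ι (suc k) * ι (suc k) ^ k                    ≤⟨ *-monoˡ-≤ (0≤ι (suc k)) (growth k) ⟩
    ι (suc k) * (# 3 * ι k ^ k)                  ≤⟨ *-monoˡ-≤ (0≤ι (suc k)) (*-monoˡ-≤ (0≤# 3) (n^n≤3^n*n! k)) ⟩
    ι (suc k) * (# 3 * ((# 3) ^ k * ι (k !)))    ≡⟨ eq (ι (suc k)) ((# 3) ^ k) (ι (k !)) ⟩
    # 3 * (# 3) ^ k * (ι (suc k) * ι (k !))      ≡⟨ cong (# 3 * (# 3) ^ k *_) (ι-* (suc k) (k !)) ⟨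
    # 3 * (# 3) ^ k * ι (suc k ℕ.* (k !))        ∎
    where
    open ≤-Reasoning
    eq : ∀ s p f → s * (# 3 * (p * f)) ≡ # 3 * p * (s * f)
    eq = solve-∀ ℚ-ring
    growth : ∀ k → ι (suc k) ^ k ≤ # 3 * ι k ^ k
    growth zero      = ℕ→ℚ-mono-≤ {1} {3} (ℕ.s≤s ℕ.z≤n)
    growth k@(suc _) = *-cancelˡ-≤ (0<* (0<ι k) (0<ι k)) (subst₂ _≤_
      (cong (λ t → ι k * ι k * t ^ k) (trans (+-comm (ι k) 1ℚ) (sym (ι-suc k))))
      (eq₂ (ι k) (ι k ^ k))
      (^-taylor k {ι k} {1ℚ} (0≤ι k) (0≤+ (0≤ι k) (0≤# 1)) (≤-reflexive (*-identityʳ (ι k)))))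
      where
      eq₂ : ∀ k p → p * (k * k + k * (k * 1ℚ) + k * k * (1ℚ * 1ℚ)) ≡ k * k * (# 3 * p)
      eq₂ = solve-∀ ℚ-ring

  norms-large : ∀ {n} {C k} {bs : List (V n)} → 0ℚ ≤ C → All (λ b → C < k * b · b) bs → C ^ length bs ≤ k ^ length bs * norms bs
  norms-large _ [] = ≤-reflexive refl
  norms-large {C = C} {k} {b ∷ bs} 0≤C (p ∷ ps) = ≤-trans (*-mono-≤ 0≤C (≤-trans (0≤^ (length bs) 0≤C) IH) (<⇒≤ p) IH)
    (≤-reflexive (eq k (b · b) (k ^ length bs) (norms bs)))
    where
    IH = norms-large {C = C} {k} 0≤C ps
    eq : ∀ k b p m → k * b * (p * m) ≡ k * p * (b * m)
    eq = solve-∀ ℚ-ring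

  module Residual {n : ℕ} (𝓕 : SetSystem n) (A : Subset n) (0<N : 0 ℕ.< ∣ A ∣) (0<h : 0 ℕ.< herdisc 𝓕) (k-1 : ℕ) where
    k : ℕ
    k = suc k-1
    𝓖 : SetSystem n
    𝓖 = 𝓕 Defs.∣ A
    N h C : ℚ
    N = ι ∣ A ∣
    h = ι (herdisc 𝓕)
    C = # 151 * (h * h * N)

    0<N′ : 0ℚ < N
    0<N′ = subst (_< N) (ι≡# 0) (ι-mono-< 0<N)
    0<h′ : 0ℚ < h
    0<h′ = subst (_< h) (ι≡# 0) (ι-mono-< 0<h)
    0<hhN : 0ℚ < h * h * N
    0<hhN = 0<* (0<* 0<h′ 0<h′) 0<N′
    0≤C : 0ℚ ≤ C
    0≤C = 0≤* (0≤# 151) (<⇒≤ 0<hhN)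

    record Chain : Set where
      field
        fs    : List (Subset n)
        fs⊆𝓖  : All (_∈ₗ 𝓖) fs
        bs    : List (V n)
        shear : map χ fs ≼ bs
        orth  : Orth bs
        supps : All (Supp (χ A)) bs
        large : All (λ b → C < ι k * b · b) bs

    -- A chain of length k would give C^k ≤ k^k times the product of the |b|², and this is at most
    -- (150 h² N)^k, where 150 = 3 · 25 · 2: 3 from k^k ≤ 3^k k!, 25 from (2 h + 3)² ≤ (5 h)², and 2
    -- from the 2 N in the pivot product. The 151 in C makes this a contradiction.
    short : (c : Chain) → length (Chain.fs c) ≢ k
    short c len = <-irrefl refl (<-≤-trans (^-mono-< {# 150 * (h * h * N)} {C} k-1 (0≤* (0≤# 150) (<⇒≤ 0<hhN))
        (slack-< (h * h * N) 0<hhN (eq₀ (h * h * N)))) (begin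
      C ^ k                                            ≤⟨ subst (λ l → C ^ l ≤ ι k ^ l * norms bs) len-bs (norms-large {k = ι k} 0≤C large) ⟩
      ι k ^ k * norms bs                               ≤⟨ *-monoʳ-≤ (0≤norms bs) (n^n≤3^n*n! k) ⟩
      (# 3) ^ k * ι (k !) * norms bs                   ≡⟨ eq₁ ((# 3) ^ k) (ι (k !)) (norms bs) ⟩
      (# 3) ^ k * (norms bs * ι (k !))                 ≤⟨ *-monoˡ-≤ (0≤^ k (0≤# 3)) (≤-trans (subst (λ l → norms bs * ι (l !) ≤ ∏ (map Cnt.sq P.rs) * (# 2 * N) ^ l) len-bs P.prod)
          (*-monoʳ-≤ (0≤^ k 0≤2N) (≤-trans (subst (λ l → ∏ (map Cnt.sq P.rs) ≤ (Cnt.K * Cnt.K) ^ l) len Cnt.pivots-bounded) (^-mono-≤ k (0≤* 0≤K 0≤K) K²≤)))) ⟩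
      (# 3) ^ k * ((# 25 * (h * h)) ^ k * (# 2 * N) ^ k) ≡⟨ cong ((# 3) ^ k *_) (^-distrib-* (# 25 * (h * h)) (# 2 * N) k) ⟨
      (# 3) ^ k * (# 25 * (h * h) * (# 2 * N)) ^ k     ≡⟨ ^-distrib-* (# 3) (# 25 * (h * h) * (# 2 * N)) k ⟨
      (# 3 * (# 25 * (h * h) * (# 2 * N))) ^ k         ≡⟨ cong (_^ k) (eq₂ (h * h) N) ⟩
      (# 150 * (h * h * N)) ^ k                        ∎))
      where
      open Chain c
      open ≤-Reasoning
      len-bs : length bs ≡ k
      len-bs = trans (sym (≼-length shear)) (trans (length-map χ fs) len)
      module P = Pivots (pivots A 0<N′ k len-bs orth supps)
      module Cnt = Counting 𝓖 fs fs⊆𝓖 P.rs (≼-trans shear P.shear) P.solve P.inj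
      0≤2N : 0ℚ ≤ # 2 * N
      0≤2N = 0≤* (0≤# 2) (<⇒≤ 0<N′)
      0≤K : 0ℚ ≤ Cnt.K
      0≤K = 0≤+ (0≤* (0≤# 2) (0≤ι (herdisc 𝓖))) (0≤# 3)
      K≤5h : Cnt.K ≤ # 5 * h
      K≤5h = slack-≤ (# 2 * (h - ι (herdisc 𝓖)) + # 3 * (h - 1ℚ))
        (0≤+ (0≤* (0≤# 2) (0≤- (ι-mono-≤ (herdisc-restrict 𝓕 A)))) (0≤* (0≤# 3) (0≤- (#≤ι 0<h)))) (eq h (ι (herdisc 𝓖)))
        where
        eq : ∀ h g → # 5 * h ≡ # 2 * g + # 3 + (# 2 * (h - g) + # 3 * (h - 1ℚ))
        eq = solve-∀ ℚ-ring
      K²≤ : Cnt.K * Cnt.K ≤ # 25 * (h * h)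
      K²≤ = ≤-trans (*-mono-≤ 0≤K (≤-trans 0≤K K≤5h) K≤5h K≤5h) (≤-reflexive (eq h))
        where
        eq : ∀ h → # 5 * h * (# 5 * h) ≡ # 25 * (h * h)
        eq = solve-∀ ℚ-ring
      eq₀ : ∀ a → # 151 * a ≡ # 150 * a + a
      eq₀ = solve-∀ ℚ-ring
      eq₁ : ∀ a b c → a * b * c ≡ a * (c * b)
      eq₁ = solve-∀ ℚ-ring
      eq₂ : ∀ a N → # 3 * (# 25 * a * (# 2 * N)) ≡ # 150 * (a * N)
      eq₂ = solve-∀ ℚ-ring

    record Killed : Set where
      field
        I       : List (V n)
        size    : length I ℕ.≤ k
        residue : ∀ {F} → F ∈ₗ 𝓖 → ∃ λ b → (∀ {y} → Perp y I → χ F · y ≡ b · y) × ι k * b · b ≤ C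

    scan : ∀ bs (𝓗 : SetSystem n) → All (λ F → ι k * res (χ F) bs · res (χ F) bs ≤ C) 𝓗 ⊎ Any (λ F → C < ι k * res (χ F) bs · res (χ F) bs) 𝓗
    scan bs []      = inj₁ []
    scan bs (F ∷ 𝓗) = go (ι k * res (χ F) bs · res (χ F) bs ≤? C) (scan bs 𝓗)
      where
      go : Dec (ι k * res (χ F) bs · res (χ F) bs ≤ C) → _ → _
      go (no p)  _         = inj₂ (here (≰⇒> p))
      go (yes p) (inj₁ ps) = inj₁ (p ∷ ps)
      go (yes p) (inj₂ q)  = inj₂ (there q)

    -- Greedy: any set with a long residue extends the chain. d is the room left, and the search
    -- stops before it is used up because `short` excludes length k.
    search : ∀ d (c : Chain) → length (Chain.fs c) ℕ.+ d ≡ k → Killed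
    search zero    c len = contradiction (trans (sym (ℕ.+-identityʳ _)) len) (short c)
    search (suc d) c len = go (scan bs 𝓖)
      where
      open Chain c
      go : All (λ F → ι k * res (χ F) bs · res (χ F) bs ≤ C) 𝓖 ⊎ Any (λ F → C < ι k * res (χ F) bs · res (χ F) bs) 𝓖 → Killed
      go (inj₁ ok) = record
        { I = map χ fs
        ; size = subst (ℕ._≤ k) (sym (length-map χ fs)) (ℕ.≤-trans (ℕ.m≤m+n (length fs) (suc d)) (ℕ.≤-reflexive len))
        ; residue = λ {F} F∈ → res (χ F) bs , (λ ⊥I → sym (res-· (χ F) (≼-perp shear ⊥I))) , All.lookup ok F∈ }
      go (inj₂ bad) = let F , F∈ , big = find bad ; F′ , _ , eq = ∈-map⁻ (_∩ A) F∈ in search d (record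
        { fs = F ∷ fs ; fs⊆𝓖 = F∈ ∷ fs⊆𝓖 ; bs = res (χ F) bs ∷ bs
        ; shear = (λ ⊥fs → sym (res-· (χ F) (≼-perp shear ⊥fs))) ∷ shear
        ; orth = (res-perp (χ F) orth , (λ z → <-irrefl refl (≤-<-trans 0≤C (subst (C <_) (trans (cong (ι k *_) z) (*-zeroʳ (ι k))) big)))) ∷ orth
        ; supps = Supp-res (subst (λ G → Supp (χ A) (χ G)) (sym eq) (χ-∩-supp F′ A)) supps ∷ supps
        ; large = big ∷ large }) (trans (sym (ℕ.+-suc (length fs) d)) len)

    killed : Killed
    killed = search k (record { fs = [] ; fs⊆𝓖 = [] ; bs = [] ; shear = [] ; orth = [] ; supps = [] ; large = [] }) refl

  -- Phases

  Σℕ : ∀ {t} → (Fin t → ℕ) → ℕ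
  Σℕ {zero}  f = 0
  Σℕ {suc t} f = f zero ℕ.+ Σℕ (f ∘ suc)

  term≤Σℕ : ∀ {t} (f : Fin t → ℕ) i → f i ℕ.≤ Σℕ f
  term≤Σℕ f zero    = ℕ.m≤m+n (f zero) _
  term≤Σℕ f (suc i) = ℕ.≤-trans (term≤Σℕ (f ∘ suc) i) (ℕ.m≤n+m _ (f zero))

  Σℕ-*-≤ : ∀ {t} (f g : Fin t → ℕ) c d → (∀ i → f i ℕ.* c ℕ.≤ d ℕ.* g i) → Σℕ f ℕ.* c ℕ.≤ d ℕ.* Σℕ g
  Σℕ-*-≤ {zero}  f g c d p = ℕ.z≤n
  Σℕ-*-≤ {suc t} f g c d p = subst₂ ℕ._≤_ (sym (ℕ.*-distribʳ-+ c (f zero) (Σℕ (f ∘ suc)))) (sym (ℕ.*-distribˡ-+ d (g zero) (Σℕ (g ∘ suc))))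
    (ℕ.+-mono-≤ (p zero) (Σℕ-*-≤ (f ∘ suc) (g ∘ suc) c d (p ∘ suc)))

  gather : ∀ {B : Set} {t} → (Fin t → List B) → List B
  gather {t = zero}  I = []
  gather {t = suc t} I = I zero ++ gather (I ∘ suc)

  gather-length : ∀ {B : Set} {t} (I : Fin t → List B) → length (gather I) ≡ Σℕ (length ∘ I)
  gather-length {t = zero}  I = refl
  gather-length {t = suc t} I = trans (length-++ (I zero)) (cong (length (I zero) ℕ.+_) (gather-length (I ∘ suc)))

  gather-all : ∀ {B : Set} {P : B → Set} {t} (I : Fin t → List B) → All P (gather I) → ∀ i → All P (I i)
  gather-all I p zero    = ++⁻ˡ (I zero) p
  gather-all I p (suc i) = gather-all (I ∘ suc) (++⁻ʳ (I zero) p) i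

  opaque
    unfolding _·_

    χ-norm : ∀ {n} (F A : Subset n) → χ (F ∩ A) · χ (F ∩ A) ≤ ι ∣ A ∣
    χ-norm F A = ≤-trans (sum-mono-≤ pointwise) (≤-reflexive (sum-χ A))
      where
      01² : ∀ {f a c} → f ≡ 0ℚ ⊎ f ≡ 1ℚ → a ≡ 0ℚ ⊎ a ≡ 1ℚ → c ≡ f * a → c * c ≤ a
      01² {a = a} (inj₁ refl) p refl = subst (_≤ a) (sym (trans (cong (λ t → t * t) (*-zeroˡ a)) (*-zeroˡ 0ℚ))) (0≤a p)
        where
        0≤a : ∀ {a} → a ≡ 0ℚ ⊎ a ≡ 1ℚ → 0ℚ ≤ a
        0≤a (inj₁ refl) = ≤-refl
        0≤a (inj₂ refl) = 0≤# 1
      01² (inj₂ refl) (inj₁ refl) refl = ≤-reflexive refl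
      01² (inj₂ refl) (inj₂ refl) refl = ≤-reflexive refl
      pointwise : ∀ v → χ (F ∩ A) v * χ (F ∩ A) v ≤ χ A v
      pointwise v = 01² (χ-indicator F v) (χ-indicator A v) (χ-∩ F A v)

    χ-∩-· : ∀ {n} (F A : Subset n) {y : V n} → (∀ v → v ∉ A → y v ≡ 0ℚ) → χ F · y ≡ χ (F ∩ A) · y
    χ-∩-· F A {y} off = sum-cong λ v → decide (v ∈? A)
      (λ p → cong (_* y v) (sym (trans (χ-∩ F A v) (trans (cong (χ F v *_) (χ-∈ p)) (*-identityʳ (χ F v))))))
      (λ p → trans (cong (χ F v *_) (off v p)) (trans (*-zeroʳ (χ F v)) (sym (trans (cong (χ (F ∩ A) v *_) (off v p)) (*-zeroʳ (χ (F ∩ A) v))))))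

    χ-·-range : ∀ {n} (F A : Subset n) {y : V n} → (∀ v → 0ℚ ≤ y v) → (∀ v → y v ≤ # 2 * χ A v) → 0ℚ ≤ χ F · y × χ F · y ≤ # 2 * ι ∣ A ∣
    χ-·-range F A {y} lo hi = ·-0≤ F lo , ≤-trans (sum-mono-≤ (λ v → ≤-trans (01*-≤ (χ-indicator F v) (lo v)) (hi v)))
      (≤-reflexive (trans (sum-* (# 2) (χ A)) (cong (# 2 *_) (sum-χ A))))

  module Setup {n t : ℕ} (𝓕 : Fin t → SetSystem n) (l : Fin t → ℕ) (1≤l : ∀ i → 1 ℕ.≤ l i) (card≤ : ∀ i → card (𝓕 i) ℕ.≤ 2 ℕ.^ l i) where
    h L w : Fin t → ℕ
    h i = herdisc (𝓕 i)
    L i = l i ℕ.* l i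
    w i = L i ℕ.* (h i ℕ.* h i)
    Λ : ℕ
    Λ = Σℕ w

    L≤w : ∀ i → 0 ℕ.< h i → L i ℕ.≤ w i
    L≤w i 0<h = ℕ.≤-trans (ℕ.≤-reflexive (sym (ℕ.*-identityʳ (L i)))) (ℕ.*-monoʳ-≤ (L i) (ℕ.*-mono-≤ 0<h 0<h))

    module Kills (A : Subset n) (0<N : 0 ℕ.< ∣ A ∣) (0<Λ : 0 ℕ.< Λ) where
      N : ℕ
      N = ∣ A ∣

      -- The two inequalities of `mid` delimit the window of N in which a system is charged at the
      -- rate √(qΛ)/l; below it the set's own size N is a good enough bound.
      data Kind (i : Fin t) (F : Subset n) (I : List (V n)) : Set where
        low  : N ℕ.* L i ℕ.≤ Λ → Kind i F I
        high : (∀ {y} → Perp y I → χ (F ∩ A) · y ≡ 0ℚ) → Kind i F I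
        mid  : Λ ℕ.< N ℕ.* L i → N ℕ.* L i ℕ.≤ 2 ℕ.^ (l i ℕ.+ 4) ℕ.* Λ → ∀ b →
               (∀ {y} → Perp y I → χ (F ∩ A) · y ≡ b · y) → ι (L i) * b · b ≤ # 4832 * ι Λ → Kind i F I

      record Kill (i : Fin t) : Set where
        field
          I      : List (V n)
          budget : length I ℕ.* (16 ℕ.* Λ) ℕ.≤ N ℕ.* w i
          kind   : ∀ {F} → F ∈ₗ 𝓕 i → 0 ℕ.< h i → Kind i F I

      -- If the share of system i does not cover all of its at most 2^l sets, then N w < 2^l · 16 Λ.
      -- This is what limits the window to l + 4 halvings.
      not-high : ∀ i → 0 ℕ.< h i → ¬ (card (𝓕 i) ℕ.* (16 ℕ.* Λ) ℕ.≤ N ℕ.* w i) → N ℕ.* L i ℕ.≤ 2 ℕ.^ (l i ℕ.+ 4) ℕ.* Λ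
      not-high i 0<h ¬p = begin
        N ℕ.* L i                            ≤⟨ ℕ.*-monoʳ-≤ N (L≤w i 0<h) ⟩
        N ℕ.* w i                            ≤⟨ ℕ.<⇒≤ (ℕ.≰⇒> ¬p) ⟩
        card (𝓕 i) ℕ.* (16 ℕ.* Λ)            ≤⟨ ℕ.*-monoˡ-≤ (16 ℕ.* Λ) (card≤ i) ⟩
        2 ℕ.^ l i ℕ.* (16 ℕ.* Λ)             ≡⟨ ℕ.*-assoc (2 ℕ.^ l i) 16 Λ ⟨
        2 ℕ.^ l i ℕ.* 2 ℕ.^ 4 ℕ.* Λ          ≡⟨ cong (ℕ._* Λ) (sym (ℕ.^-distribˡ-+-* 2 (l i) 4)) ⟩
        2 ℕ.^ (l i ℕ.+ 4) ℕ.* Λ              ∎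
        where open ℕ.≤-Reasoning

      instance
        16Λ≢0 : ℕ.NonZero (16 ℕ.* Λ)
        16Λ≢0 = ℕ.m*n≢0 16 Λ {{_}} {{ℕ.>-nonZero 0<Λ}}

      kill-all : ∀ i → card (𝓕 i) ℕ.* (16 ℕ.* Λ) ℕ.≤ N ℕ.* w i → Kill i
      kill-all i p = record
        { I = map (λ F → χ (F ∩ A)) ded
        ; budget = subst (λ t → t ℕ.* (16 ℕ.* Λ) ℕ.≤ N ℕ.* w i) (sym (length-map (λ F → χ (F ∩ A)) ded)) p
        ; kind = λ {F} F∈ _ → high (λ {y} ⊥I → trans (·-comm (χ (F ∩ A)) y) (All.lookup ⊥I (∈-map⁺ (λ F → χ (F ∩ A)) (∈-deduplicate⁺ (≡-dec Bool._≟_) F∈)))) }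
        where ded = deduplicate (≡-dec Bool._≟_) (𝓕 i)

      k : Fin t → ℕ
      k i = N ℕ.* w i ℕ./ (16 ℕ.* Λ)

      N*w< : ∀ i → N ℕ.* w i ℕ.< (k i ℕ.+ 1) ℕ.* (16 ℕ.* Λ)
      N*w< i = subst₂ ℕ._<_ (sym (ℕ.m≡m%n+[m/n]*n (N ℕ.* w i) (16 ℕ.* Λ)))
        (trans (ℕ.+-comm (16 ℕ.* Λ) (k i ℕ.* (16 ℕ.* Λ))) (trans (cong (k i ℕ.* (16 ℕ.* Λ) ℕ.+_) (sym (ℕ.*-identityˡ (16 ℕ.* Λ)))) (sym (ℕ.*-distribʳ-+ (16 ℕ.* Λ) (k i) 1))))
        (ℕ.+-monoˡ-< (k i ℕ.* (16 ℕ.* Λ)) (ℕ.m%n<n (N ℕ.* w i) (16 ℕ.* Λ)))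

      kill-some : ∀ i → 0 ℕ.< h i → Λ ℕ.< N ℕ.* L i → ¬ (card (𝓕 i) ℕ.* (16 ℕ.* Λ) ℕ.≤ N ℕ.* w i) → ∀ k′ → k i ≡ k′ → Kill i
      -- The share is less than one row, that is N w < 16 Λ; the set serves as its own residue, as
      -- l² |F ∩ A| ≤ l² N ≤ N w.
      kill-some i 0<h Λ< ¬high zero eq = record
        { I = [] ; budget = ℕ.z≤n
        ; kind = λ {F} _ _ → mid Λ< (not-high i 0<h ¬high) (χ (F ∩ A)) (λ _ → refl)
            (≤-trans (*-monoˡ-≤ (0≤ι (L i)) (χ-norm F A)) (≤-trans (≤-reflexive (sym (ι-* (L i) N))) (≤-trans (ι-mono-≤ LN≤)
              (≤-trans (≤-reflexive (ι-#* 16 Λ)) (*-monoʳ-≤ (0≤ι Λ) (Defs.ℕ→ℚ-mono-≤ {16} {4832} (ℕ.m≤m+n 16 4816))))))) }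
        where
        LN≤ : L i ℕ.* N ℕ.≤ 16 ℕ.* Λ
        LN≤ = ℕ.≤-trans (ℕ.≤-reflexive (ℕ.*-comm (L i) N)) (ℕ.≤-trans (ℕ.*-monoʳ-≤ N (L≤w i 0<h))
          (ℕ.≤-trans (ℕ.<⇒≤ (N*w< i)) (ℕ.≤-reflexive (trans (cong (λ t → (t ℕ.+ 1) ℕ.* (16 ℕ.* Λ)) eq) (ℕ.*-identityˡ (16 ℕ.* Λ))))))
      kill-some i 0<h Λ< ¬high (suc k′) eq = record
        { I = R.I
        ; budget = ℕ.≤-trans (ℕ.*-monoˡ-≤ (16 ℕ.* Λ) R.size) (ℕ.≤-trans (ℕ.≤-reflexive (cong (ℕ._* (16 ℕ.* Λ)) (sym eq))) (ℕ.m/n*n≤m (N ℕ.* w i) (16 ℕ.* Λ)))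
        ; kind = λ {F} F∈ _ → let b , red , le = R.residue (∈-map⁺ (_∩ A) F∈) in mid Λ< (not-high i 0<h ¬high) b red (bound b le) }
        where
        module R = Residual.Killed (Residual.killed (𝓕 i) A 0<N 0<h k′)
        κ = ι (suc k′)
        -- Rounding the share down costs a factor of at most 2, because k + 1 ≤ 2 k; with the 16
        -- this gives the 32 in 4832 = 32 · 151.
        Nw≤ : ι (N ℕ.* w i) ≤ # 32 * (κ * ι Λ)
        Nw≤ = ≤-trans (ι-mono-≤ (ℕ.≤-trans (ℕ.<⇒≤ (N*w< i)) (ℕ.≤-trans (ℕ.≤-reflexive (cong (λ t → (t ℕ.+ 1) ℕ.* (16 ℕ.* Λ)) eq))
            (ℕ.*-monoˡ-≤ (16 ℕ.* Λ) (ℕ.+-monoʳ-≤ (suc k′) (ℕ.s≤s ℕ.z≤n))))))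
          (≤-reflexive (trans (ι-* (suc k′ ℕ.+ suc k′) (16 ℕ.* Λ)) (trans (cong₂ _*_ (ι-+ (suc k′) (suc k′)) (ι-#* 16 Λ)) (eq₁ κ (ι Λ)))))
          where
          eq₁ : ∀ k Λ → (k + k) * (# 16 * Λ) ≡ # 32 * (k * Λ)
          eq₁ = solve-∀ ℚ-ring
        hι = ι (h i)
        bound : ∀ b → κ * b · b ≤ # 151 * (hι * hι * ι N) → ι (L i) * b · b ≤ # 4832 * ι Λ
        bound b le = *-cancelˡ-≤ (0<ι (suc k′)) (begin
          κ * (ι (L i) * b · b)                          ≡⟨ eq₂ κ (ι (L i)) (b · b) ⟩
          ι (L i) * (κ * b · b)                          ≤⟨ *-monoˡ-≤ (0≤ι (L i)) le ⟩
          ι (L i) * (# 151 * (hι * hι * ι N))            ≡⟨ eq₃ (ι (L i)) (hι * hι) (ι N) ⟩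
          # 151 * (ι N * (ι (L i) * (hι * hι)))          ≡⟨ cong (# 151 *_) (trans (ι-* N (w i)) (cong (ι N *_) (trans (ι-* (L i) (h i ℕ.* h i)) (cong (ι (L i) *_) (ι-* (h i) (h i)))))) ⟨
          # 151 * ι (N ℕ.* w i)                          ≤⟨ *-monoˡ-≤ (0≤# 151) Nw≤ ⟩
          # 151 * (# 32 * (κ * ι Λ))                     ≡⟨ eq₄ κ (ι Λ) ⟩
          κ * (# 4832 * ι Λ)                             ∎)
          where
          open ≤-Reasoning
          eq₂ : ∀ k l b → k * (l * b) ≡ l * (k * b)
          eq₂ = solve-∀ ℚ-ring
          eq₃ : ∀ l h n → l * (# 151 * (h * n)) ≡ # 151 * (n * (l * h))
          eq₃ = solve-∀ ℚ-ring
          eq₄ : ∀ k l → # 151 * (# 32 * (k * l)) ≡ k * (# 4832 * l)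
          eq₄ = solve-∀ ℚ-ring

      kill-none : ∀ i → (0 ℕ.< h i → N ℕ.* L i ℕ.≤ Λ) → Kill i
      kill-none i p = record { I = [] ; budget = ℕ.z≤n ; kind = λ _ 0<h → low (p 0<h) }

      kill : ∀ i → Kill i
      kill i = decide (1 ℕ.≤? h i)
        (λ 0<h → decide (N ℕ.* L i ℕ.≤? Λ) (λ p → kill-none i (λ _ → p))
          (λ ¬low → decide (card (𝓕 i) ℕ.* (16 ℕ.* Λ) ℕ.≤? N ℕ.* w i) (kill-all i)
            (λ ¬high → kill-some i 0<h (ℕ.≰⇒> ¬low) ¬high (k i) refl)))
        (λ ¬h → kill-none i (λ 0<h → contradiction 0<h ¬h))

      G : List (V n)
      G = gather (λ i → Kill.I (kill i))

      -- The shares N w / (16 Λ) add up to N/16, since the w add up to Λ.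
      8G≤N : 8 ℕ.* length G ℕ.≤ N
      8G≤N = ℕ.≤-trans (ℕ.*-monoˡ-≤ (length G) (ℕ.m≤m+n 8 8)) (ℕ.*-cancelʳ-≤ (16 ℕ.* length G) N Λ {{ℕ.>-nonZero 0<Λ}}
        (ℕ.≤-trans (ℕ.≤-reflexive (trans (cong (ℕ._* Λ) (ℕ.*-comm 16 (length G))) (ℕ.*-assoc (length G) 16 Λ)))
          (subst (λ t → t ℕ.* (16 ℕ.* Λ) ℕ.≤ N ℕ.* Λ) (sym (gather-length (λ i → Kill.I (kill i))))
            (Σℕ-*-≤ (λ i → length (Kill.I (kill i))) w (16 ℕ.* Λ) N (λ i → Kill.budget (kill i))))))

  module Phases {n t m : ℕ} (𝓕 : Fin t → SetSystem n) (l : Fin t → ℕ) (1≤l : ∀ i → 1 ℕ.≤ l i) (card≤ : ∀ i → card (𝓕 i) ℕ.≤ 2 ℕ.^ l i)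
                (r : ℕ) (m<2^q : suc m ℕ.≤ 2 ℕ.^ suc r) (set : Fin (suc m) → Subset n) (idx : Fin (suc m) → Fin t)
                (set∈ : ∀ k → set k ∈ₗ 𝓕 (idx k)) (0<Λ : 0 ℕ.< Setup.Λ 𝓕 l 1≤l card≤) where
    open Setup 𝓕 l 1≤l card≤

    -- 3479040 = 720 · 4832 and 4832 = 32 · 151, from the walk and the residues.
    q λ′ Y : ℚ
    q  = ι (suc r)
    λ′ = ι Λ
    Y  = # 3479040 * (q * λ′)

    0≤q : 0ℚ ≤ q
    0≤q = 0≤ι (suc r)
    0≤λ : 0ℚ ≤ λ′
    0≤λ = 0≤ι Λ
    0≤Y : 0ℚ ≤ Y
    0≤Y = 0≤* (0≤# 3479040) (0≤* 0≤q 0≤λ)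
    1≤q : 1ℚ ≤ q
    1≤q = #≤ι (ℕ.s≤s ℕ.z≤n)
    λ≤qλ : λ′ ≤ q * λ′
    λ≤qλ = ≤-trans (≤-reflexive (sym (*-identityˡ λ′))) (*-monoʳ-≤ 0≤λ 1≤q)

    change : V n → V n → Fin (suc m) → ℚ
    change x x′ k = χ (set k) · (x′ ⊕ - 1ℚ ⋆ x)

    -- The outcome weight · c² ≤ 720 q of the walk, with the weight moved to the other side: 1/N for
    -- low sets, L/(4832 Λ) for those in the window.
    data Cost (N : ℕ) (k : Fin (suc m)) (c : ℚ) : Set where
      low  : N ℕ.* L (idx k) ℕ.≤ Λ → c * c ≤ # 720 * (q * ι N) → Cost N k c
      high : c ≡ 0ℚ → Cost N k c
      mid  : Λ ℕ.< N ℕ.* L (idx k) → N ℕ.* L (idx k) ℕ.≤ 2 ℕ.^ (l (idx k) ℕ.+ 4) ℕ.* Λ → ι (L (idx k)) * (c * c) ≤ Y → Cost N k c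

    record Phase (A : Subset n) (x : V n) : Set where
      field
        A′     : Subset n
        x′     : V n
        sub    : A′ ⊆ A
        half   : 2 ℕ.* ∣ A′ ∣ ℕ.≤ ∣ A ∣
        box    : ∀ v → Box (x′ v)
        off    : ∀ v → v ∉ A → x′ v ≡ x v
        frozen : ∀ v → v ∈ A → v ∉ A′ → Frozen (x′ v)
        cost   : ∀ k → 0 ℕ.< h (idx k) → Cost ∣ A ∣ k (change x x′ k)

    phase : ∀ A x → 4 ℕ.≤ ∣ A ∣ → (∀ v → Box (x v)) → Phase A x
    phase A x 4≤N box₀ = record
      { A′ = P.A′ ; x′ = P.x′ ; sub = P.sub ; half = P.half ; box = P.box ; off = P.off ; frozen = P.frozen
      ; cost = λ k 0<h → cost k (1 ℕ.≤? h (idx k)) 0<h (P.small k) }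
      where
      0<N : 0 ℕ.< ∣ A ∣
      0<N = ℕ.≤-trans (ℕ.s≤s ℕ.z≤n) 4≤N
      open Kills A 0<N 0<Λ
      0<ιN : 0ℚ < ι N
      0<ιN = <-≤-trans (0<# 4) (#≤ι 4≤N)
      0<4832Λ : 0ℚ < # 4832 * λ′
      0<4832Λ = 0<* (0<# 4832) (<-≤-trans (0<# 1) (#≤ι 0<Λ))
      ⊥I : ∀ {y} → Perp y G → ∀ i → Perp y (Kill.I (kill i))
      ⊥I = gather-all (λ i → Kill.I (kill i))

      record Weights (i : Fin t) (F : Subset n) : Set where
        field
          wt   : ℚ
          b    : V n
          0≤wt : 0ℚ ≤ wt
          norm : wt * b · b ≤ 1ℚ
          red  : ∀ {y} → Perp y G → χ (F ∩ A) · y ≡ b · y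

      inv-norm : ∀ {c s} → 0ℚ < c → s ≤ c → inv c * s ≤ 1ℚ
      inv-norm {c} 0<c s≤c = ≤-trans (*-monoˡ-≤ (0≤inv 0<c) s≤c) (≤-reflexive (trans (*-comm (inv c) c) (*-inv (λ z → <-irrefl (sym z) 0<c))))

      -- Weight 0 for sets that the potential need not watch: those kept orthogonal, and those of
      -- systems with hereditary discrepancy 0.
      idle : ∀ i F → Weights i F
      idle i F = record { wt = 0ℚ ; b = χ (F ∩ A) ; 0≤wt = ≤-refl ; norm = ≤-trans (≤-reflexive (*-zeroˡ (χ (F ∩ A) · χ (F ∩ A)))) (0≤# 1) ; red = λ _ → refl }

      weights : ∀ i F → Kind i F (Kill.I (kill i)) → Weights i F
      weights i F (low _)  = record { wt = inv (ι N) ; b = χ (F ∩ A) ; 0≤wt = 0≤inv 0<ιN ; norm = inv-norm 0<ιN (χ-norm F A) ; red = λ _ → refl }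
      weights i F (high _) = idle i F
      weights i F (mid _ _ b red le) = record
        { wt = inv (# 4832 * λ′) * ι (L i) ; b = b ; 0≤wt = 0≤* (0≤inv 0<4832Λ) (0≤ι (L i))
        ; norm = ≤-trans (≤-reflexive (*-assoc (inv (# 4832 * λ′)) (ι (L i)) (b · b))) (inv-norm 0<4832Λ le) ; red = λ ⊥G → red (⊥I ⊥G i) }

      weights? : ∀ k → Dec (1 ℕ.≤ h (idx k)) → Weights (idx k) (set k)
      weights? k (yes 0<h) = weights (idx k) (set k) (Kill.kind (kill (idx k)) (set∈ k) 0<h)
      weights? k (no _)    = idle (idx k) (set k)

      T : Fin (suc m) → Test G
      T k = let open Weights (weights? k (1 ℕ.≤? h (idx k))) in
        record { f = χ (set k ∩ A) ; weight = wt ; b = b ; 0≤w = 0≤wt ; norm = norm ; reduces = red }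

      module P = Walk.PartialColouring (Walk.partial-colouring r A 4≤N x G 8G≤N T box₀ m<2^q)

      d : V n
      d = P.x′ ⊕ - 1ℚ ⋆ x
      d-off : ∀ v → v ∉ A → d v ≡ 0ℚ
      d-off v p = trans (cong (λ t → t + - 1ℚ * x v) (P.off v p)) (eq (x v))
        where
        eq : ∀ a → a + - 1ℚ * a ≡ 0ℚ
        eq = solve-∀ ℚ-ring
      same : ∀ k → change x P.x′ k ≡ χ (set k ∩ A) · d
      same k = χ-∩-· (set k) A d-off

      inv-bound : ∀ {c s} → 0ℚ < c → inv c * s ≤ # 720 * q → s ≤ c * (# 720 * q)
      inv-bound {c} {s} 0<c le = subst (_≤ c * (# 720 * q)) (trans (sym (*-assoc c (inv c) s)) (trans (cong (_* s) (*-inv (λ z → <-irrefl (sym z) 0<c))) (*-identityˡ s)))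
        (*-monoˡ-≤ (<⇒≤ 0<c) le)

      cost-of : ∀ k (κ : Kind (idx k) (set k) (Kill.I (kill (idx k)))) (c : ℚ) → c ≡ χ (set k ∩ A) · d →
        Weights.wt (weights (idx k) (set k) κ) * (c * c) ≤ # 720 * q → Cost N k c
      cost-of k (low p) c _ le = low p (≤-trans (inv-bound 0<ιN le) (≤-reflexive (eq (ι N) q)))
        where
        eq : ∀ N q → N * (# 720 * q) ≡ # 720 * (q * N)
        eq = solve-∀ ℚ-ring
      cost-of k (high p) c c≡ le = high (trans c≡ (p (⊥I P.perpG (idx k))))
      cost-of k (mid p p′ b red _) c _ le = mid p p′ (≤-trans (inv-bound {s = ι (L (idx k)) * (c * c)} 0<4832Λ
          (≤-trans (≤-reflexive (sym (*-assoc (inv (# 4832 * λ′)) (ι (L (idx k))) (c * c)))) le)) (≤-reflexive (eq λ′ q)))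
        where
        eq : ∀ l q → # 4832 * l * (# 720 * q) ≡ # 3479040 * (q * l)
        eq = solve-∀ ℚ-ring

      cost : ∀ k (dec : Dec (1 ℕ.≤ h (idx k))) → 0 ℕ.< h (idx k) →
        Weights.wt (weights? k dec) * ((χ (set k ∩ A) · d) * (χ (set k ∩ A) · d)) ≤ # 720 * q → Cost N k (change x P.x′ k)
      cost k (yes 0<h) _   le = subst (Cost N k) (sym (same k)) (cost-of k (Kill.kind (kill (idx k)) (set∈ k) 0<h) (χ (set k ∩ A) · d) refl le)
      cost k (no ¬h)   0<h le = contradiction 0<h ¬h

    -- In `bound-low`, 8640 is the fixed point of the geometric series: with N halved, 12 · 720 + 4
    -- · 8640 / 2 = 3 · 8640. In `bound`, s counts the window phases that can still come: each adds
    -- √Y to √L · |change| and lowers s by one, and the 1 in s + 1 pays for everything after the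
    -- window. The alternative s = l + 4 asks nothing of N, so that it can serve before the window
    -- is reached.
    record Finish (A : Subset n) (x : V n) : Set where
      field
        x*     : V n
        frozen : ∀ v → v ∈ A → Frozen (x* v)
        off    : ∀ v → v ∉ A → x* v ≡ x v
        bound-low : ∀ k → 0 ℕ.< h (idx k) → ∣ A ∣ ℕ.* L (idx k) ℕ.≤ Λ →
                 change x x* k * change x x* k ≤ # 8640 * (q * ι ∣ A ∣)
        bound  : ∀ k → 0 ℕ.< h (idx k) → ∀ s → ∣ A ∣ ℕ.* L (idx k) ℕ.≤ 2 ℕ.^ s ℕ.* Λ ⊎ s ≡ l (idx k) ℕ.+ 4 →
                 ι (L (idx k)) * (change x x* k * change x x* k) ≤ Y * (ι (suc s) * ι (suc s))

    L≤Λ : ∀ i → 0 ℕ.< h i → ι (L i) ≤ λ′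
    L≤Λ i 0<h = ι-mono-≤ (ℕ.≤-trans (L≤w i 0<h) (term≤Σℕ w i))

    1≤s² : ∀ s → 1ℚ ≤ ι (suc s) * ι (suc s)
    1≤s² s = *-mono-≤ (0≤# 1) (0≤ι (suc s)) 1≤ 1≤
      where
      1≤ : 1ℚ ≤ ι (suc s)
      1≤ = #≤ι (ℕ.s≤s ℕ.z≤n)

    ≤Y⇒≤Ys² : ∀ {a} s → a ≤ Y → a ≤ Y * (ι (suc s) * ι (suc s))
    ≤Y⇒≤Ys² s p = ≤-trans p (≤-trans (≤-reflexive (sym (*-identityʳ Y))) (*-monoˡ-≤ 0≤Y (1≤s² s)))

    -- The walk needs four alive points. The last three or fewer are simply set to 1, each moving by
    -- at most 2.
    finish-small : ∀ A x → (∀ v → Box (x v)) → ∣ A ∣ ℕ.< 4 → Finish A x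
    finish-small A x box N<4 = record
      { x* = x* ; frozen = λ v p → inj₁ (on v p) ; off = off
      ; bound-low = λ k _ _ → ≤-trans (sq≤ k) (≤-trans (slack-≤ (# 4 * (N * (# 3 - N)) + # 8628 * N)
            (0≤+ (0≤* (0≤# 4) (0≤* (0≤ι ∣ A ∣) (0≤- N≤3))) (0≤* (0≤# 8628) (0≤ι ∣ A ∣))) (eq₁ N))
          (*-monoˡ-≤ (0≤# 8640) (≤-trans (≤-reflexive (sym (*-identityˡ N))) (*-monoʳ-≤ (0≤ι ∣ A ∣) 1≤q))))
      ; bound = λ k 0<h s _ → ≤Y⇒≤Ys² s (≤-trans (*-mono-≤ (0≤ι (L (idx k))) (0≤# 36) (L≤Λ (idx k) 0<h) (sq≤36 k))
          (≤-trans (≤-reflexive (*-comm λ′ (# 36))) (*-mono-≤ (0≤# 36) (0≤* 0≤q 0≤λ) (Defs.ℕ→ℚ-mono-≤ {36} {3479040} (ℕ.m≤m+n 36 3479004)) λ≤qλ)))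
      }
      where
      N = ι ∣ A ∣
      N≤3 : N ≤ # 3
      N≤3 = ≤-trans (ι-mono-≤ (ℕ.≤-pred N<4)) (≤-reflexive (ι≡# 3))
      x* : V n
      x* v = x v + χ A v * (1ℚ - x v)
      on : ∀ v → v ∈ A → x* v ≡ 1ℚ
      on v p = trans (cong (λ t → x v + t * (1ℚ - x v)) (χ-∈ p)) (eq (x v))
        where
        eq : ∀ a → a + 1ℚ * (1ℚ - a) ≡ 1ℚ
        eq = solve-∀ ℚ-ring
      off : ∀ v → v ∉ A → x* v ≡ x v
      off v p = trans (cong (λ t → x v + t * (1ℚ - x v)) (χ-∉ p)) (eq (x v))
        where
        eq : ∀ a → a + 0ℚ * (1ℚ - a) ≡ a
        eq = solve-∀ ℚ-ring
      0≤χ : ∀ v → 0ℚ ≤ χ A v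
      0≤χ v = go (χ-indicator A v)
        where
        go : ∀ {c} → c ≡ 0ℚ ⊎ c ≡ 1ℚ → 0ℚ ≤ c
        go (inj₁ refl) = ≤-refl
        go (inj₂ refl) = 0≤# 1
      range : ∀ k → 0ℚ ≤ change x x* k × change x x* k ≤ # 2 * N
      range k = χ-·-range (set k) A
        (λ v → subst (0ℚ ≤_) (eq₂ (x v) (χ A v)) (0≤* (0≤χ v) (0≤- (proj₂ (box v)))))
        (λ v → slack-≤ (χ A v * (x v - - 1ℚ)) (0≤* (0≤χ v) (0≤- (proj₁ (box v)))) (eq₃ (x v) (χ A v)))
        where
        eq₂ : ∀ x c → c * (1ℚ - x) ≡ x + c * (1ℚ - x) + - 1ℚ * x
        eq₂ = solve-∀ ℚ-ring
        eq₃ : ∀ x c → # 2 * c ≡ x + c * (1ℚ - x) + - 1ℚ * x + c * (x - - 1ℚ)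
        eq₃ = solve-∀ ℚ-ring
      sq≤ : ∀ k → change x x* k * change x x* k ≤ # 2 * N * (# 2 * N)
      sq≤ k = *-mono-≤ (proj₁ (range k)) (≤-trans (proj₁ (range k)) (proj₂ (range k))) (proj₂ (range k)) (proj₂ (range k))
      sq≤36 : ∀ k → change x x* k * change x x* k ≤ # 36
      sq≤36 k = ≤-trans (sq≤ k) (slack-≤ (# 4 * ((# 3 - N) * (# 3 - N)) + # 8 * (N * (# 3 - N)))
        (0≤+ (0≤* (0≤# 4) (0≤² (# 3 - N))) (0≤* (0≤# 8) (0≤* (0≤ι ∣ A ∣) (0≤- N≤3)))) (eq N))
        where
        eq : ∀ N → # 36 ≡ # 2 * N * (# 2 * N) + (# 4 * ((# 3 - N) * (# 3 - N)) + # 8 * (N * (# 3 - N)))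
        eq = solve-∀ ℚ-ring
      eq₁ : ∀ N → # 8640 * N ≡ # 2 * N * (# 2 * N) + (# 4 * (N * (# 3 - N)) + # 8628 * N)
      eq₁ = solve-∀ ℚ-ring

    change-split : ∀ x x′ x* k → change x x* k ≡ change x x′ k + change x′ x* k
    change-split x x′ x* k = trans (·-linʳ F x* (- 1ℚ) x) (trans (eq (F · x) (F · x′) (F · x*))
      (cong₂ _+_ (sym (·-linʳ F x′ (- 1ℚ) x)) (sym (·-linʳ F x* (- 1ℚ) x′))))
      where
      F = χ (set k)
      eq : ∀ a b c → c + - 1ℚ * a ≡ b + - 1ℚ * a + (c + - 1ℚ * b)
      eq = solve-∀ ℚ-ring

    -- 3 (a + b)² ≤ 12 a² + 4 b²
    combine-low : ∀ {a b N N′} → a * a ≤ # 720 * (q * N) → b * b ≤ # 8640 * (q * N′) → # 2 * N′ ≤ N →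
                  (a + b) * (a + b) ≤ # 8640 * (q * N)
    combine-low {a} {b} {N} {N′} pa pb half = *-cancelˡ-≤ (0<# 3) (slack-≤
      ((# 3 * a - b) * (# 3 * a - b) + # 12 * (# 720 * (q * N) - a * a) + # 4 * (# 8640 * (q * N′) - b * b) + # 17280 * (q * (N - # 2 * N′)))
      (0≤+ (0≤+ (0≤+ (0≤² (# 3 * a - b)) (0≤* (0≤# 12) (0≤- pa))) (0≤* (0≤# 4) (0≤- pb))) (0≤* (0≤# 17280) (0≤* 0≤q (0≤- half))))
      (eq a b q N N′))
      where
      eq : ∀ a b q N N′ → # 3 * (# 8640 * (q * N)) ≡ # 3 * ((a + b) * (a + b)) +
        ((# 3 * a - b) * (# 3 * a - b) + # 12 * (# 720 * (q * N) - a * a) + # 4 * (# 8640 * (q * N′) - b * b) + # 17280 * (q * (N - # 2 * N′)))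
      eq = solve-∀ ℚ-ring

    -- p (a + b)² ≤ p (p + 1) a² + (p + 1) b²
    combine-mid : ∀ {a b c Z} p → 0ℚ ≤ c → c * (a * a) ≤ Z → c * (b * b) ≤ Z * (ι (suc p) * ι (suc p)) →
                  c * ((a + b) * (a + b)) ≤ Z * (ι (suc (suc p)) * ι (suc (suc p)))
    combine-mid {a} {b} {c} {Z} p 0≤c pa pb = *-cancelˡ-≤ (0<ι (suc p)) (slack-≤
      (c * ((P * a - b) * (P * a - b)) + P * (P + 1ℚ) * (Z - c * (a * a)) + (P + 1ℚ) * (Z * (P * P) - c * (b * b)))
      (0≤+ (0≤+ (0≤* 0≤c (0≤² (P * a - b))) (0≤* (0≤* 0≤P 0≤P+1) (0≤- pa))) (0≤* 0≤P+1 (0≤- pb)))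
      (trans (cong (λ t → P * (Z * (t * t))) (trans (ι-suc (suc p)) (+-comm 1ℚ P))) (eq a b c Z P)))
      where
      P = ι (suc p)
      0≤P : 0ℚ ≤ P
      0≤P = 0≤ι (suc p)
      0≤P+1 : 0ℚ ≤ P + 1ℚ
      0≤P+1 = 0≤+ 0≤P (0≤# 1)
      eq : ∀ a b c Z P → P * (Z * ((P + 1ℚ) * (P + 1ℚ))) ≡ P * (c * ((a + b) * (a + b))) +
        (c * ((P * a - b) * (P * a - b)) + P * (P + 1ℚ) * (Z - c * (a * a)) + (P + 1ℚ) * (Z * (P * P) - c * (b * b)))
      eq = solve-∀ ℚ-ring

    finish : ∀ d A x → (∀ v → Box (x v)) → ∣ A ∣ ℕ.≤ d → Finish A x
    continue : ∀ d A x → (∀ v → Box (x v)) → ∣ A ∣ ℕ.≤ suc d → 4 ℕ.≤ ∣ A ∣ → Finish A x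
    finish zero    A x box le = finish-small A x box (ℕ.≤-<-trans le (ℕ.s≤s ℕ.z≤n))
    finish (suc d) A x box le = decide (4 ℕ.≤? ∣ A ∣) (continue d A x box le) (λ p → finish-small A x box (ℕ.≰⇒> p))
    continue d A x box₀ le 4≤N = record
      { x* = F.x* ; frozen = frozen ; off = λ v v∉ → trans (F.off v (v∉ ∘ P.sub)) (P.off v v∉) ; bound-low = low′ ; bound = gen′ }
      where
      module P = Phase (phase A x 4≤N box₀)
      N N′ : ℕ
      N  = ∣ A ∣
      N′ = ∣ P.A′ ∣
      N′≤d : N′ ℕ.≤ d
      N′≤d = ℕ.≤-pred (ℕ.≤-trans (shrink N′ P.half) le)
        where
        shrink : ∀ a → 2 ℕ.* a ℕ.≤ N → suc a ℕ.≤ N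
        shrink zero    _ = ℕ.≤-trans (ℕ.s≤s ℕ.z≤n) 4≤N
        shrink (suc a) p = ℕ.≤-trans (ℕ.s≤s (ℕ.≤-trans (ℕ.≤-reflexive (ℕ.+-comm 1 a)) (ℕ.+-monoʳ-≤ a (ℕ.s≤s ℕ.z≤n)))) p
      module F = Finish (finish d P.A′ P.x′ P.box N′≤d)
      N′≤N : N′ ℕ.≤ N
      N′≤N = ℕ.≤-trans (ℕ.m≤m+n N′ (N′ ℕ.+ 0)) P.half
      2N′≤N : # 2 * ι N′ ≤ ι N
      2N′≤N = ≤-trans (≤-reflexive (sym (ι-#* 2 N′))) (ι-mono-≤ P.half)
      frozen : ∀ v → v ∈ A → Frozen (F.x* v)
      frozen v v∈A = decide (v ∈? P.A′) (F.frozen v) (λ v∉ → subst Frozen (sym (F.off v v∉)) (P.frozen v v∈A v∉))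
      c₁ c₂ : Fin (suc m) → ℚ
      c₁ k = change x P.x′ k
      c₂ k = change P.x′ F.x* k
      split : ∀ k → change x F.x* k ≡ c₁ k + c₂ k
      split = change-split x P.x′ F.x*
      0≤720qN : 0ℚ ≤ # 720 * (q * ι N)
      0≤720qN = 0≤* (0≤# 720) (0≤* 0≤q (0≤ι N))
      low-sum : ∀ k → 0 ℕ.< h (idx k) → N ℕ.* L (idx k) ℕ.≤ Λ → c₁ k * c₁ k ≤ # 720 * (q * ι N) → (c₁ k + c₂ k) * (c₁ k + c₂ k) ≤ # 8640 * (q * ι N)
      low-sum k 0<h p c≤ = combine-low {c₁ k} {c₂ k} c≤ (F.bound-low k 0<h (ℕ.≤-trans (ℕ.*-monoˡ-≤ (L (idx k)) N′≤N) p)) 2N′≤N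
      low-cost : ∀ k {c} → N ℕ.* L (idx k) ℕ.≤ Λ → Cost N k c → c * c ≤ # 720 * (q * ι N)
      low-cost k p (low _ c≤) = c≤
      low-cost k p (high z)   = ≤-trans (≤-reflexive (trans (cong (λ t → t * t) z) (*-zeroˡ 0ℚ))) 0≤720qN
      low-cost k p (mid q _ _) = contradiction p (ℕ.<⇒≱ q)
      low′ : ∀ k → 0 ℕ.< h (idx k) → N ℕ.* L (idx k) ℕ.≤ Λ → change x F.x* k * change x F.x* k ≤ # 8640 * (q * ι N)
      low′ k 0<h p = subst (λ t → t * t ≤ # 8640 * (q * ι N)) (sym (split k)) (low-sum k 0<h p (low-cost k p (P.cost k 0<h)))
      gen-cost : ∀ k → 0 ℕ.< h (idx k) → ∀ s → N ℕ.* L (idx k) ℕ.≤ 2 ℕ.^ s ℕ.* Λ ⊎ s ≡ l (idx k) ℕ.+ 4 → Cost N k (c₁ k) →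
        ι (L (idx k)) * ((c₁ k + c₂ k) * (c₁ k + c₂ k)) ≤ Y * (ι (suc s) * ι (suc s))
      -- Once low, always low: `low-sum` already covers this phase and all later ones, and N L ≤ Λ
      -- brings it below Y.
      gen-cost k 0<h s cond (low p c≤) = ≤Y⇒≤Ys² s (begin
        ι (L (idx k)) * ((c₁ k + c₂ k) * (c₁ k + c₂ k))  ≤⟨ *-monoˡ-≤ (0≤ι (L (idx k))) (low-sum k 0<h p c≤) ⟩
        ι (L (idx k)) * (# 8640 * (q * ι N))             ≡⟨ eq (ι (L (idx k))) q (ι N) ⟩
        # 8640 * (q * (ι N * ι (L (idx k))))             ≡⟨ cong (λ t → # 8640 * (q * t)) (ι-* N (L (idx k))) ⟨
        # 8640 * (q * ι (N ℕ.* L (idx k)))               ≤⟨ *-monoˡ-≤ (0≤# 8640) (*-monoˡ-≤ 0≤q (ι-mono-≤ p)) ⟩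
        # 8640 * (q * λ′)                                ≤⟨ *-monoʳ-≤ (0≤* 0≤q 0≤λ) (Defs.ℕ→ℚ-mono-≤ {8640} {3479040} (ℕ.m≤m+n 8640 3470400)) ⟩
        Y                                                ∎)
        where
        open ≤-Reasoning
        eq : ∀ l q n → l * (# 8640 * (q * n)) ≡ # 8640 * (q * (n * l))
        eq = solve-∀ ℚ-ring
      gen-cost k 0<h s cond (high z) = subst (λ t → ι (L (idx k)) * (t * t) ≤ Y * (ι (suc s) * ι (suc s)))
        (sym (trans (cong (_+ c₂ k) z) (+-identityˡ (c₂ k)))) (F.bound k 0<h s (Sum.map₁ (ℕ.≤-trans (ℕ.*-monoˡ-≤ (L (idx k)) N′≤N)) cond))
      gen-cost k 0<h s cond (mid Λ< ≤P c≤) = go s (bounded cond)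
        where
        -- On entering the window with s = l + 4, its upper end supplies the missing bound on N.
        bounded : N ℕ.* L (idx k) ℕ.≤ 2 ℕ.^ s ℕ.* Λ ⊎ s ≡ l (idx k) ℕ.+ 4 → N ℕ.* L (idx k) ℕ.≤ 2 ℕ.^ s ℕ.* Λ
        bounded (inj₁ p) = p
        bounded (inj₂ p) = subst (λ t → N ℕ.* L (idx k) ℕ.≤ 2 ℕ.^ t ℕ.* Λ) (sym p) ≤P
        go : ∀ s → N ℕ.* L (idx k) ℕ.≤ 2 ℕ.^ s ℕ.* Λ → ι (L (idx k)) * ((c₁ k + c₂ k) * (c₁ k + c₂ k)) ≤ Y * (ι (suc s) * ι (suc s))
        -- With s = 0 the window is already behind, so no charge at its rate is left to make.
        go zero    p = contradiction (ℕ.≤-trans p (ℕ.≤-reflexive (ℕ.*-identityˡ Λ))) (ℕ.<⇒≱ Λ<)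
        go (suc s) p = combine-mid {c₁ k} {c₂ k} s (0≤ι (L (idx k))) c≤ (F.bound k 0<h s (inj₁ (ℕ.*-cancelˡ-≤ 2
          (ℕ.≤-trans (ℕ.≤-reflexive (sym (ℕ.*-assoc 2 N′ (L (idx k))))) (ℕ.≤-trans (ℕ.*-monoˡ-≤ (L (idx k)) P.half)
            (ℕ.≤-trans p (ℕ.≤-reflexive (ℕ.*-assoc 2 (2 ℕ.^ s) Λ))))))))
      gen′ : ∀ k → 0 ℕ.< h (idx k) → ∀ s → N ℕ.* L (idx k) ℕ.≤ 2 ℕ.^ s ℕ.* Λ ⊎ s ≡ l (idx k) ℕ.+ 4 →
        ι (L (idx k)) * (change x F.x* k * change x F.x* k) ≤ Y * (ι (suc s) * ι (suc s))
      gen′ k 0<h s cond = subst (λ t → ι (L (idx k)) * (t * t) ≤ Y * (ι (suc s) * ι (suc s))) (sym (split k)) (gen-cost k 0<h s cond (P.cost k 0<h))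

  -- From frozen points to hereditary discrepancy

  isqrt : ∀ X → ∃ λ B → B ℕ.* B ℕ.≤ X × X ℕ.< suc B ℕ.* suc B
  isqrt zero    = 0 , ℕ.z≤n , ℕ.s≤s ℕ.z≤n
  isqrt (suc X) = let B , lo , hi = isqrt X in decide (suc B ℕ.* suc B ℕ.≤? suc X)
    (λ p → suc B , p , ℕ.≤-<-trans hi (ℕ.*-mono-< (ℕ.n<1+n (suc B)) (ℕ.n<1+n (suc B))))
    (λ p → B , ℕ.m≤n⇒m≤1+n lo , ℕ.≰⇒> p)

  herdisc-sq-≤ : ∀ {n} (𝓕 : SetSystem n) X →
    (∀ J → ∃ λ (x : Colouring n) → ∀ {F} → F ∈ₗ 𝓕 → let c = ℤ.∣ colourSum x (F ∩ J) ∣ in c ℕ.* c ℕ.≤ X) → herdisc 𝓕 ℕ.* herdisc 𝓕 ℕ.≤ X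
  herdisc-sq-≤ 𝓕 X good = ℕ.≤-trans (ℕ.*-mono-≤ D≤B D≤B) (proj₁ (proj₂ (isqrt X)))
    where
    B = proj₁ (isqrt X)
    D≤B : herdisc 𝓕 ℕ.≤ B
    D≤B = herdisc-≤ 𝓕 λ J → let x , ok = good J in x , λ F∈ → ℕ.≮⇒≥ λ B<c →
      ℕ.<⇒≱ (proj₂ (proj₂ (isqrt X))) (ℕ.≤-trans (ℕ.*-mono-≤ B<c B<c) (ok F∈))

  j-colourSum-J : ∀ {n} (F J : Subset n) (x : Colouring n) →
    j (colourSum x (F ∩ J)) ≡ χ F · jv (λ v → if lookup J v then lookup x v ◃ 1 else ℤ.0ℤ)
  j-colourSum-J F J x = trans (cong (λ K → j (colourSum x (F ∩ K))) (sym (tabulate∘lookup J))) (j-colourSum F (lookup J) x)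

  -- Restricting to a single point of F gives a colour sum of 1 or -1, so the sets of such a system
  -- have no points. This disposes of the systems to which (1) does not apply.
  herdisc-zero : ∀ {n} {𝓕 : SetSystem n} {F} → herdisc 𝓕 ≡ 0 → F ∈ₗ 𝓕 → ∀ y → χ F · y ≡ 0ℚ
  herdisc-zero {n} {𝓕} {F} h≡0 F∈ y = trans (·-def (χ F) y) (sum-zero λ v → trans (cong (_* y v) (χF≡0 v)) (*-zeroˡ (y v)))
    where
    χF≡0 : ∀ v → χ F v ≡ 0ℚ
    χF≡0 v = go (herdisc-colouring 𝓕 (tabulate o))
      where
      o : Fin n → Bool.Bool
      o w = ⌊ w Fin.≟ v ⌋
      go : (∃ λ x → ∀ {F} → F ∈ₗ 𝓕 → ℤ.∣ colourSum x (F ∩ tabulate o) ∣ ℕ.≤ herdisc 𝓕) → χ F v ≡ 0ℚ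
      go (x , ok) = cancel (trans (sym (trans (·-cong (λ _ → refl) pointwise) (trans (·-comm (χ F) (z₀ ⊕ c ⋆ e v)) (trans (⋆· c (e v) (χ F)) (cong (c *_) (trans (·-comm (e v) (χ F)) (·-e (χ F) v)))))))
          (trans (sym (j-colourSum F o x)) (trans (cong j (ℤ.∣i∣≡0⇒i≡0 (ℕ.n≤0⇒n≡0 (subst (ℤ.∣ colourSum x (F ∩ tabulate o) ∣ ℕ.≤_) h≡0 (ok F∈))))) j-0)))
        where
        c = j (lookup x v ◃ 1)
        c≢0 : c ≢ 0ℚ
        c≢0 p = sign≢0 (lookup x v) (j-injective (trans p (sym j-0)))
          where
          sign≢0 : ∀ s → s ◃ 1 ≢ ℤ.0ℤ
          sign≢0 Sign.+ ()
          sign≢0 Sign.- ()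
        cancel : c * χ F v ≡ 0ℚ → χ F v ≡ 0ℚ
        cancel p with χ F v ≟ 0ℚ
        ... | yes z = z
        ... | no nz = contradiction p (*≢0 c≢0 nz)
        pointwise : ∀ w → j (if o w then lookup x w ◃ 1 else ℤ.0ℤ) ≡ 0ℚ + c * e v w
        pointwise w with w Fin.≟ v
        ... | yes refl = sym (trans (cong (λ t → 0ℚ + c * t) (e-self v)) (trans (+-identityˡ (c * 1ℚ)) (*-identityʳ c)))
        ... | no  w≢v  = trans j-0 (sym (trans (cong (λ t → 0ℚ + c * t) (e-other w≢v)) (trans (+-identityˡ (c * 0ℚ)) (*-zeroʳ c))))

  signs : ∀ {n} → V n → Colouring n
  signs x = tabulate (λ v → if ⌊ x v ≟ 1ℚ ⌋ then Sign.+ else Sign.-)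

  signs-frozen : ∀ {n} (x : V n) v → Frozen (x v) → j (lookup (signs x) v ◃ 1) ≡ x v
  signs-frozen x v fr = trans (cong (λ s → j (s ◃ 1)) (lookup∘tabulate (λ v → if ⌊ x v ≟ 1ℚ ⌋ then Sign.+ else Sign.-) v)) (go (x v) fr)
    where
    j-1 : j (ℤ.+ 1) ≡ 1ℚ
    j-1 = trans (j-ι 1) (ι≡# 1)
    go : ∀ a → Frozen a → j ((if ⌊ a ≟ 1ℚ ⌋ then Sign.+ else Sign.-) ◃ 1) ≡ a
    go a (inj₁ refl) = j-1
    go a (inj₂ refl) = trans (j-neg (ℤ.+ 1)) (cong -_ j-1)

  ∈-⋃ : ∀ {n t} (𝓕 : Fin t → SetSystem n) {F} → F ∈ₗ ⋃ 𝓕 → ∃ λ i → F ∈ₗ 𝓕 i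
  ∈-⋃ 𝓕 F∈ = let xs , F∈xs , xs∈ = ∈-concat⁻′ (List.tabulate 𝓕) F∈ ; i , eq = ∈-tabulate⁻ xs∈ in i , subst (_ ∈ₗ_) eq F∈xs

  module Bound {n t : ℕ} (𝓕 : Fin t → SetSystem n) (l : Fin t → ℕ) (1≤l : ∀ i → 1 ℕ.≤ l i) (card≤ : ∀ i → card (𝓕 i) ℕ.≤ 2 ℕ.^ l i)
               (r : ℕ) (card⋃≤ : card (⋃ 𝓕) ℕ.≤ 2 ℕ.^ suc r) where
    open Setup 𝓕 l 1≤l card≤

    X : ℕ
    X = 125245440 ℕ.* (suc r ℕ.* Λ)

    Good : Subset n → Colouring n → Subset n → Set
    Good J x F = ℤ.∣ colourSum x (F ∩ J) ∣ ℕ.* ℤ.∣ colourSum x (F ∩ J) ∣ ℕ.≤ X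

    good-empty : ∀ J x {F i} → F ∈ₗ 𝓕 i → h i ≡ 0 → Good J x F
    good-empty J x {F} F∈ h≡0 = subst (λ c → ℤ.∣ c ∣ ℕ.* ℤ.∣ c ∣ ℕ.≤ X) (sym (j-injective (trans (j-colourSum-J F J x)
      (trans (herdisc-zero h≡0 F∈ (jv (λ v → if lookup J v then lookup x v ◃ 1 else ℤ.0ℤ))) (sym j-0))))) ℕ.z≤n

    U : SetSystem n
    U = deduplicate (≡-dec Bool._≟_) (⋃ 𝓕)

    index-of : ∀ {F} → F ∈ₗ ⋃ 𝓕 → ∃ λ k → List.lookup U k ≡ F
    index-of F∈ = let F∈U = ∈-deduplicate⁺ (≡-dec Bool._≟_) F∈ in Any.index F∈U , sym (Any.lookup-index F∈U)

    solution : 0 ℕ.< Λ → ∀ m (c : card (⋃ 𝓕) ≡ suc m) J → ∃ λ x → ∀ {F} → F ∈ₗ ⋃ 𝓕 → Good J x F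
    solution 0<Λ m c J = signs F.x* , λ F∈ → let k , eq = index-of F∈ in
        subst (Good J (signs F.x*)) (trans (cong (List.lookup U) (cast-cast k)) eq) (good (Fin.cast c k))
      where
      set : Fin (suc m) → Subset n
      set k = List.lookup U (Fin.cast (sym c) k)
      cast-cast : ∀ k → Fin.cast (sym c) (Fin.cast c k) ≡ k
      cast-cast k = toℕ-injective (trans (toℕ-cast (sym c) (Fin.cast c k)) (toℕ-cast c k))
      home : ∀ k → ∃ λ i → set k ∈ₗ 𝓕 i
      home k = ∈-⋃ 𝓕 (∈-deduplicate⁻ (≡-dec Bool._≟_) (⋃ 𝓕) (∈-lookup (Fin.cast (sym c) k)))
      idx : Fin (suc m) → Fin t
      idx k = proj₁ (home k)
      module Ph = Phases 𝓕 l 1≤l card≤ r (subst (ℕ._≤ 2 ℕ.^ suc r) c card⋃≤) set idx (λ k → proj₂ (home k)) 0<Λ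
      module F = Ph.Finish (Ph.finish ∣ J ∣ J z₀ (λ _ → neg-antimono-≤ (0≤# 1) , 0≤# 1) ℕ.≤-refl)
      x = signs F.x*
      change≡ : ∀ k → j (colourSum x (set k ∩ J)) ≡ Ph.change z₀ F.x* k
      change≡ k = trans (j-colourSum-J (set k) J x) (·-cong (λ _ → refl) λ v → decide (v ∈? J)
        (λ v∈ → trans (cong (λ b → j (if b then lookup x v ◃ 1 else ℤ.0ℤ)) ([]=⇒lookup v∈)) (trans (signs-frozen F.x* v (F.frozen v v∈)) (eq (F.x* v))))
        (λ v∉ → trans (cong (λ b → j (if b then lookup x v ◃ 1 else ℤ.0ℤ)) (∉⇒lookup v∉)) (trans j-0 (sym (trans (cong (λ t → t + - 1ℚ * 0ℚ) (F.off v v∉)) refl)))))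
        where
        eq : ∀ a → a ≡ a + - 1ℚ * 0ℚ
        eq = solve-∀ ℚ-ring
        ∉⇒lookup : ∀ {v} → v ∉ J → lookup J v ≡ false
        ∉⇒lookup {v} v∉ = ¬-not (λ p → v∉ (lookup⇒[]= v J p))
      good : ∀ k → Good J x (set k)
      good k = decide (1 ℕ.≤? h (idx k)) big (λ ¬h → good-empty J x (proj₂ (home k)) (ℕ.n≤0⇒n≡0 (ℕ.≮⇒≥ ¬h)))
        where
        c′ = ℤ.∣ colourSum x (set k ∩ J) ∣
        Lι = ι (l (idx k))
        ch = Ph.change z₀ F.x* k
        c² : ι (c′ ℕ.* c′) ≡ ch * ch
        c² = trans (ι-* c′ c′) (trans (j-abs² (colourSum x (set k ∩ J))) (cong (λ t → t * t) (change≡ k)))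
        big : 0 ℕ.< h (idx k) → Good J x (set k)
        big 0<h = ι-cancel-≤ (≤-trans (≤-reflexive c²) (*-cancelˡ-≤ (0<* 0<Lι 0<Lι) (begin
          Lι * Lι * (ch * ch)                               ≡⟨ cong (_* (ch * ch)) (ι-* (l (idx k)) (l (idx k))) ⟨
          ι (L (idx k)) * (ch * ch)                         ≤⟨ F.bound k 0<h (l (idx k) ℕ.+ 4) (inj₂ refl) ⟩
          Ph.Y * (S * S)                                    ≤⟨ *-monoˡ-≤ Ph.0≤Y (*-mono-≤ (0≤ι (suc (l (idx k) ℕ.+ 4))) (0≤* (0≤# 6) (0≤ι (l (idx k)))) S≤ S≤) ⟩
          Ph.Y * (# 6 * Lι * (# 6 * Lι))                    ≡⟨ eq (Ph.q * ι Λ) Lι ⟩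
          Lι * Lι * (# 125245440 * (Ph.q * ι Λ))            ≡⟨ cong (Lι * Lι *_) (trans (ι-#* 125245440 (suc r ℕ.* Λ)) (cong (# 125245440 *_) (ι-* (suc r) Λ))) ⟨
          Lι * Lι * ι X                                     ∎)))
          where
          open ≤-Reasoning
          S = ι (suc (l (idx k) ℕ.+ 4))
          0<Lι : 0ℚ < Lι
          0<Lι = <-≤-trans (0<# 1) (#≤ι (1≤l (idx k)))
          -- s + 1 = l + 5 ≤ 6 l because l ≥ 1. The number of window phases thus cancels against the
          -- factor L = l² on the left and leaves only 36.
          S≤ : S ≤ # 6 * Lι
          S≤ = slack-≤ (# 5 * (Lι - 1ℚ)) (0≤* (0≤# 5) (0≤- (#≤ι (1≤l (idx k))))) (trans (eq′ Lι) (cong (_+ # 5 * (Lι - 1ℚ)) (sym (trans (ι-suc (l (idx k) ℕ.+ 4)) (cong (1ℚ +_) (trans (ι-+ (l (idx k)) 4) (cong (Lι +_) (ι≡# 4))))))))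
            where
            eq′ : ∀ a → # 6 * a ≡ 1ℚ + (a + # 4) + # 5 * (a - 1ℚ)
            eq′ = solve-∀ ℚ-ring
          eq : ∀ y l → # 3479040 * y * (# 6 * l * (# 6 * l)) ≡ l * l * (# 125245440 * y)
          eq = solve-∀ ℚ-ring

    all-good : ∀ J → ∃ λ x → ∀ {F} → F ∈ₗ ⋃ 𝓕 → Good J x F
    -- If Λ = 0, every system has hereditary discrepancy 0 as all l are positive, and any colouring
    -- will do.
    all-good J = decide (1 ℕ.≤? Λ) (λ 0<Λ → go 0<Λ (card (⋃ 𝓕)) refl) (λ ¬Λ → signs z₀ , λ F∈ → let i , F∈i = ∈-⋃ 𝓕 F∈ in good-empty J (signs z₀) F∈i (h≡0 ¬Λ i))
      where
      h≡0 : ¬ 1 ℕ.≤ Λ → ∀ i → h i ≡ 0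
      h≡0 ¬Λ i = ℕ.n≤0⇒n≡0 (ℕ.≮⇒≥ λ 0<h → ¬Λ (ℕ.≤-trans (ℕ.≤-trans (ℕ.*-mono-≤ (1≤l i) (1≤l i)) (L≤w i 0<h)) (term≤Σℕ w i)))
      go : 0 ℕ.< Λ → ∀ m → card (⋃ 𝓕) ≡ m → ∃ λ x → ∀ {F} → F ∈ₗ ⋃ 𝓕 → Good J x F
      go 0<Λ zero    c = signs z₀ , λ F∈ → contradiction (subst Fin c (proj₁ (index-of F∈))) (λ ())
      go 0<Λ (suc m) c = solution 0<Λ m c J

    herdisc² : herdisc (⋃ 𝓕) ℕ.* herdisc (⋃ 𝓕) ℕ.≤ X
    herdisc² = herdisc-sq-≤ (⋃ 𝓕) X all-good

open import Defs
open import Data.Fin using (Fin; zero; suc)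
open import Data.Nat using (ℕ; zero; suc; _⊔_)
open import Data.Product using (Σ-syntax; _×_; _,_; ∃; proj₁; proj₂)
open import Data.Rational using (ℚ; mkℚ; 0ℚ; 1ℚ; ↥_; ↧ₙ_; *≤*)
open import Function using (_∘_)
open import Relation.Binary.PropositionalEquality
open import Relation.Nullary using (contradiction)
import Data.Integer as ℤ
import Data.Integer.Properties as ℤ
import Data.Nat as ℕ
import Data.Nat.Properties as ℕ
import Data.Rational as ℚ
import Data.Rational.Properties as ℚ
open import Data.Nat.Tactic.RingSolver using () renaming (solve-∀ to solve-∀ℕ)
open import Tactic.RingSolver using (solve-∀)
open Combinatorial using (ι; ι≡#; ι-+; ι-*; ι-mono-≤; 0≤ι; 0≤*; *-mono-≤; *-monoˡ-≤; ²-cancel-≤; ℚ-ring; decide; Σℕ; module Setup; module Bound)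
open ℝ₀⁺

-- Rational lower bounds on the right-hand side

infix 4 _≼ᴿ_
_≼ᴿ_ : ℚ → ℝ₀⁺ → Set
c ≼ᴿ x = ∀ {r} → Above x r → c ℚ.≤ r

≼-fromℕ : ∀ n → ι n ≼ᴿ fromℕ n
≼-fromℕ n (p , (_ , n≤p) , p<r) = ℚ.≤-trans (ℚ.≤-reflexive (ι≡# n)) (ℚ.≤-trans n≤p (ℚ.<⇒≤ p<r))

≼-+ : ∀ {x y c d} → c ≼ᴿ x → d ≼ᴿ y → c ℚ.+ d ≼ᴿ x + y
≼-+ cx dy (p , (_ , a , b , xa , yb , a+b≤p) , p<r) = ℚ.≤-trans (ℚ.+-mono-≤ (cx xa) (dy yb)) (ℚ.≤-trans a+b≤p (ℚ.<⇒≤ p<r))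

≼-* : ∀ {x y c d} → 0ℚ ℚ.≤ c → c ≼ᴿ x → d ≼ᴿ y → c ℚ.* d ≼ᴿ x * y
≼-* {y = y} 0≤c cx dy (p , (_ , a , b , xa , yb , ab≤p) , p<r) =
  ℚ.≤-trans (*-mono-≤ 0≤c (ℚ.<⇒≤ (positive y yb)) (cx xa) (dy yb)) (ℚ.≤-trans ab≤p (ℚ.<⇒≤ p<r))

≼-∑ : ∀ {t} (f : Fin t → ℝ₀⁺) (g : Fin t → ℕ) → (∀ i → ι (g i) ≼ᴿ f i) → ι (Σℕ g) ≼ᴿ ∑ f
≼-∑ {zero}  f g p = ≼-fromℕ 0
≼-∑ {suc t} f g p {r} ab = ℚ.≤-trans (ℚ.≤-reflexive (ι-+ (g zero) (Σℕ (g ∘ suc)))) (≼-+ {f zero} {∑ (f ∘ suc)} (p zero) (≼-∑ (f ∘ suc) (g ∘ suc) (p ∘ suc)) ab)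

-- If m^b ≤ 2^a, then 2^(L b) ≤ 2^a, and strict monotonicity of the powers of 2 gives L ≤ a/b.
≼-log : ∀ {m L} → 2 ℕ.^ L ℕ.≤ m → ι L ≼ᴿ log m
≼-log {m} {L} 2^L≤m (p , (0<p , le) , p<r) = ℚ.≤-trans (ℚ.≤-trans (ℚ.≤-reflexive (ι≡# L)) (go p 0<p le)) (ℚ.<⇒≤ p<r)
  where
  go : ∀ p → 0ℚ ℚ.< p → m ℕ.^ ↧ₙ p ℕ.≤ 2 ℕ.^ ℤ.∣ ↥ p ∣ → ℕ→ℚ L ℚ.≤ p
  go (mkℚ (ℤ.+ a) d-1 _) _ le = *≤* (subst₂ ℤ._≤_ (ℤ.pos-* L (suc d-1)) (sym (ℤ.*-identityʳ (ℤ.+ a))) (ℤ.+≤+ (ℕ.≮⇒≥ λ a< →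
    ℕ.<⇒≱ (ℕ.^-monoʳ-< 2 (ℕ.s≤s (ℕ.s≤s ℕ.z≤n)) a<) (ℕ.≤-trans (ℕ.≤-reflexive (sym (ℕ.^-*-assoc 2 L (suc d-1)))) (ℕ.≤-trans (ℕ.^-monoˡ-≤ (suc d-1) 2^L≤m) le)))))
  go p@(mkℚ (ℤ.-[1+ _ ]) _ _) 0<p _ = contradiction (ℚ.<-trans 0<p (ℚ.negative⁻¹ p)) (ℚ.<-irrefl refl)

log₂-bounds : ∀ M → 1 ℕ.≤ M → ∃ λ L → 2 ℕ.^ L ℕ.≤ M × M ℕ.< 2 ℕ.^ suc L
log₂-bounds (suc zero)    _ = 0 , ℕ.≤-refl , ℕ.s≤s (ℕ.s≤s ℕ.z≤n)
log₂-bounds (suc (suc M)) _ = let L , lo , hi = log₂-bounds (suc M) (ℕ.s≤s ℕ.z≤n) in decide (2 ℕ.^ suc L ℕ.≤? suc (suc M))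
  (λ p → suc L , p , ℕ.≤-<-trans hi (ℕ.^-monoʳ-< 2 (ℕ.s≤s (ℕ.s≤s ℕ.z≤n)) (ℕ.n<1+n (suc L))))
  (λ p → L , ℕ.m≤n⇒m≤1+n lo , ℕ.≰⇒> p)

-- L bounds the logarithm from below and L + 1 from above. Taking M ⊔ 2 makes L at least 1, so that
-- the two are within a factor 2.
⌊log⌋ : ∀ M → ∃ λ L → 1 ℕ.≤ L × 2 ℕ.^ L ℕ.≤ M ⊔ 2 × M ℕ.≤ 2 ℕ.^ suc L
⌊log⌋ M = go (log₂-bounds (M ⊔ 2) (ℕ.≤-trans (ℕ.s≤s ℕ.z≤n) (ℕ.m≤n⊔m M 2)))
  where
  go : (∃ λ L → 2 ℕ.^ L ℕ.≤ M ⊔ 2 × M ⊔ 2 ℕ.< 2 ℕ.^ suc L) → ∃ λ L → 1 ℕ.≤ L × 2 ℕ.^ L ℕ.≤ M ⊔ 2 × M ℕ.≤ 2 ℕ.^ suc L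
  go (zero  , lo , hi) = contradiction (ℕ.m≤n⊔m M 2) (ℕ.<⇒≱ hi)
  go (suc L , lo , hi) = suc L , ℕ.s≤s ℕ.z≤n , lo , ℕ.≤-trans (ℕ.m≤m⊔n M 2) (ℕ.<⇒≤ hi)

Σℕ-mono : ∀ {t} {f g : Fin t → ℕ} c → (∀ i → f i ℕ.≤ c ℕ.* g i) → Σℕ f ℕ.≤ c ℕ.* Σℕ g
Σℕ-mono {zero}  c p = ℕ.z≤n
Σℕ-mono {suc t} {f} {g} c p = ℕ.≤-trans (ℕ.+-mono-≤ (p zero) (Σℕ-mono c (p ∘ suc))) (ℕ.≤-reflexive (sym (ℕ.*-distribˡ-+ c (g zero) (Σℕ (g ∘ suc)))))

suc≤2* : ∀ {L} → 1 ℕ.≤ L → suc L ℕ.≤ 2 ℕ.* L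
suc≤2* {L} 1≤L = ℕ.+-mono-≤ 1≤L (ℕ.m≤m+n L 0)

-- The combinatorial bound uses the logarithms rounded up, the theorem needs them rounded down. This
-- costs 2 for the union and 4 for the squared logarithms of the parts, hence the 8.
enlarge : ∀ K c ℓ S Λ {X} → X ℕ.≤ K ℕ.* (suc ℓ ℕ.* Λ) → suc ℓ ℕ.≤ 2 ℕ.* ℓ → Λ ℕ.≤ 4 ℕ.* S → K ℕ.* 8 ℕ.≤ c ℕ.* c →
          X ℕ.≤ c ℕ.* c ℕ.* (ℓ ℕ.* S)
enlarge K c ℓ S Λ p q r s = ℕ.≤-trans p (ℕ.≤-trans (ℕ.*-monoʳ-≤ K (ℕ.*-mono-≤ q r))
  (ℕ.≤-trans (ℕ.≤-reflexive (eq K ℓ S)) (ℕ.*-monoˡ-≤ (ℓ ℕ.* S) s)))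
  where
  eq : ∀ K a b → K ℕ.* ((2 ℕ.* a) ℕ.* (4 ℕ.* b)) ≡ K ℕ.* 8 ℕ.* (a ℕ.* b)
  eq = solve-∀ℕ

-- c₀² ≥ 8 · 125245440 and 125245440 = 36 · 3479040.
c₀ : ℕ
c₀ = 31654

module _ {n t : ℕ} (𝓕 : Fin t → SetSystem n) where
  L : Fin t → ℕ
  L i = proj₁ (⌊log⌋ (card (𝓕 i)))
  1≤L : ∀ i → 1 ℕ.≤ L i
  1≤L i = proj₁ (proj₂ (⌊log⌋ (card (𝓕 i))))
  ℓ : ℕ
  ℓ = proj₁ (⌊log⌋ (card (⋃ 𝓕)))
  H : Fin t → ℕ
  H i = herdisc (𝓕 i)
  g : Fin t → ℕ
  g i = (L i ℕ.* L i) ℕ.* (H i ℕ.* H i)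
  D : ℕ
  D = herdisc (⋃ 𝓕)

  D²≤ : D ℕ.* D ℕ.≤ c₀ ℕ.* c₀ ℕ.* (ℓ ℕ.* Σℕ g)
  D²≤ = enlarge 125245440 c₀ ℓ (Σℕ g) (Setup.Λ 𝓕 (suc ∘ L) (λ _ → ℕ.s≤s ℕ.z≤n) card≤)
    (Bound.herdisc² 𝓕 (suc ∘ L) (λ _ → ℕ.s≤s ℕ.z≤n) card≤ ℓ (proj₂ (proj₂ (proj₂ (⌊log⌋ (card (⋃ 𝓕)))))))
    -- 1001963520 = 8 · 125245440, and adding 12196 gives the square of `c₀`.
    (suc≤2* (proj₁ (proj₂ (⌊log⌋ (card (⋃ 𝓕)))))) (Σℕ-mono 4 each) (ℕ.m≤m+n 1001963520 12196)
    where
    card≤ : ∀ i → card (𝓕 i) ℕ.≤ 2 ℕ.^ suc (L i)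
    card≤ i = proj₂ (proj₂ (proj₂ (⌊log⌋ (card (𝓕 i)))))
    eq : ∀ a b → (2 ℕ.* a) ℕ.* (2 ℕ.* a) ℕ.* b ≡ 4 ℕ.* (a ℕ.* a ℕ.* b)
    eq = solve-∀ℕ
    each : ∀ i → suc (L i) ℕ.* suc (L i) ℕ.* (H i ℕ.* H i) ℕ.≤ 4 ℕ.* g i
    each i = ℕ.≤-trans (ℕ.*-monoˡ-≤ (H i ℕ.* H i) (ℕ.*-mono-≤ (suc≤2* (1≤L i)) (suc≤2* (1≤L i)))) (ℕ.≤-reflexive (eq (L i) (H i ℕ.* H i)))

  -- The square of the right-hand side is at least c₀² ℓ Σ L² H².
  herdisc-bound : fromℕ D ≤ fromℕ c₀ * √ (log (card (⋃ 𝓕) ⊔ 2)) * √ (∑ (λ i → log (card (𝓕 i) ⊔ 2) ² * fromℕ (herdisc (𝓕 i)) ²))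
  herdisc-bound r (p , (_ , a , b , (p′ , (_ , a₁ , a₂ , C<a₁ , (s , (0<s , log<s²) , s<a₂) , a₁a₂≤p′) , p′<a) , (s′ , (0<s′ , ∑<s′²) , s′<b) , ab≤p) , p<r) =
    conclude (ℚ.<-dense D<r)
    where
    open ℚ.≤-Reasoning
    square : ∀ {a b} → 0ℚ ℚ.≤ a → a ℚ.≤ b → a ℚ.* a ℚ.≤ b ℚ.* b
    square 0≤a a≤b = *-mono-≤ 0≤a (ℚ.≤-trans 0≤a a≤b) a≤b a≤b
    c : ℚ
    c = ι c₀
    c≤a₁ : c ℚ.≤ a₁
    c≤a₁ = ≼-fromℕ c₀ C<a₁
    ℓ≤s² : ι ℓ ℚ.≤ s ℚ.* s
    ℓ≤s² = ≼-log (proj₁ (proj₂ (proj₂ (⌊log⌋ (card (⋃ 𝓕)))))) log<s²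
    ι-g : ∀ i → ι (g i) ≼ᴿ log (card (𝓕 i) ⊔ 2) ² * fromℕ (herdisc (𝓕 i)) ²
    ι-g i above = ℚ.≤-trans (ℚ.≤-reflexive (trans (ι-* (L i ℕ.* L i) (H i ℕ.* H i)) (cong₂ ℚ._*_ (ι-* (L i) (L i)) (ι-* (H i) (H i)))))
      (≼-* {log (card (𝓕 i) ⊔ 2) ²} {fromℕ (herdisc (𝓕 i)) ²} (0≤* (0≤ι (L i)) (0≤ι (L i)))
        (≼-* {log (card (𝓕 i) ⊔ 2)} {log (card (𝓕 i) ⊔ 2)} (0≤ι (L i)) lg lg) (≼-* {fromℕ (H i)} {fromℕ (H i)} (0≤ι (H i)) (≼-fromℕ (H i)) (≼-fromℕ (H i))) above)
      where
      lg : ι (L i) ≼ᴿ log (card (𝓕 i) ⊔ 2)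
      lg = ≼-log (proj₁ (proj₂ (proj₂ (⌊log⌋ (card (𝓕 i))))))
    Σ≤s′² : ι (Σℕ g) ℚ.≤ s′ ℚ.* s′
    Σ≤s′² = ≼-∑ (λ i → log (card (𝓕 i) ⊔ 2) ² * fromℕ (herdisc (𝓕 i)) ²) g ι-g ∑<s′²
    0≤s = ℚ.<⇒≤ 0<s
    0≤s′ = ℚ.<⇒≤ 0<s′
    0≤css′ : 0ℚ ℚ.≤ c ℚ.* s ℚ.* s′
    0≤css′ = 0≤* (0≤* (0≤ι c₀) 0≤s) 0≤s′
    css′≤p : c ℚ.* s ℚ.* s′ ℚ.≤ p
    css′≤p = begin
      c ℚ.* s ℚ.* s′   ≤⟨ *-mono-≤ (0≤* (0≤ι c₀) 0≤s) (ℚ.≤-trans 0≤s′ (ℚ.<⇒≤ s′<b)) cs≤a (ℚ.<⇒≤ s′<b) ⟩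
      a ℚ.* b          ≤⟨ ab≤p ⟩
      p                ∎
      where
      cs≤a : c ℚ.* s ℚ.≤ a
      cs≤a = ℚ.≤-trans (*-mono-≤ (0≤ι c₀) (ℚ.≤-trans 0≤s (ℚ.<⇒≤ s<a₂)) c≤a₁ (ℚ.<⇒≤ s<a₂)) (ℚ.≤-trans a₁a₂≤p′ (ℚ.<⇒≤ p′<a))
    D²≤p² : ι D ℚ.* ι D ℚ.≤ p ℚ.* p
    D²≤p² = begin
      ι D ℚ.* ι D                                  ≡⟨ ι-* D D ⟨
      ι (D ℕ.* D)                                  ≤⟨ ι-mono-≤ D²≤ ⟩
      ι (c₀ ℕ.* c₀ ℕ.* (ℓ ℕ.* Σℕ g))               ≡⟨ trans (ι-* (c₀ ℕ.* c₀) (ℓ ℕ.* Σℕ g)) (cong₂ ℚ._*_ (ι-* c₀ c₀) (ι-* ℓ (Σℕ g))) ⟩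
      c ℚ.* c ℚ.* (ι ℓ ℚ.* ι (Σℕ g))               ≤⟨ *-monoˡ-≤ (0≤* (0≤ι c₀) (0≤ι c₀)) (*-mono-≤ (0≤ι ℓ) (0≤* 0≤s′ 0≤s′) ℓ≤s² Σ≤s′²) ⟩
      c ℚ.* c ℚ.* (s ℚ.* s ℚ.* (s′ ℚ.* s′))        ≡⟨ eq c s s′ ⟩
      c ℚ.* s ℚ.* s′ ℚ.* (c ℚ.* s ℚ.* s′)          ≤⟨ square 0≤css′ css′≤p ⟩
      p ℚ.* p                                      ∎
      where
      eq : ∀ c s t → c ℚ.* c ℚ.* (s ℚ.* s ℚ.* (t ℚ.* t)) ≡ c ℚ.* s ℚ.* t ℚ.* (c ℚ.* s ℚ.* t)
      eq = solve-∀ ℚ-ring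
    D<r : ι D ℚ.< r
    D<r = ℚ.≤-<-trans (²-cancel-≤ (ℚ.≤-trans 0≤css′ css′≤p) D²≤p²) p<r
    -- Membership in the open cut needs a positive witness strictly below r; a rational strictly
    -- between D and r is positive even when D = 0.
    conclude : (∃ λ m → ι D ℚ.< m × m ℚ.< r) → Above (fromℕ D) r
    conclude (m , D<m , m<r) = m , (ℚ.≤-<-trans (0≤ι D) D<m , ℚ.<⇒≤ (subst (ℚ._< m) (ι≡# D) D<m)) , m<r

theorem5p1 : Σ[ C ∈ ℝ₀⁺ ] (fromℕ 0 < C × (∀ (n t : ℕ) (𝓕 : Fin t → SetSystem n) →
    fromℕ (herdisc (⋃ 𝓕)) ≤
    C * √ (log (card (⋃ 𝓕) ⊔ 2)) * √ (∑ (λ i → log (card (𝓕 i) ⊔ 2) ² * fromℕ (herdisc (𝓕 i)) ²))))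
theorem5p1 = fromℕ c₀ , (1ℚ , (ℚ.½ , (ℚ.positive⁻¹ ℚ.½ , ℚ.<⇒≤ (ℚ.positive⁻¹ ℚ.½)) , ½<1) , 1≤) , λ n t 𝓕 → herdisc-bound 𝓕
  where
  ½<1 : ℚ.½ ℚ.< 1ℚ
  ½<1 = ℚ.*<* (ℤ.+<+ (ℕ.s≤s (ℕ.s≤s ℕ.z≤n)))
  1≤ : ∀ r → Above (fromℕ c₀) r → 1ℚ ℚ.≤ r
  1≤ r above = ℚ.≤-trans (ℕ→ℚ-mono-≤ {1} {c₀} (ℕ.s≤s ℕ.z≤n)) (ℚ.≤-trans (ℚ.≤-reflexive (sym (ι≡# c₀))) (≼-fromℕ c₀ above))
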